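{- For each $k\in\{1,2,3,4,5,6,7,10,11\}$ there exists a finite $(3,3)$-homogeneous orthomodular poset $L$ with at most $19$ atoms that has exactly $k$ pure states.
   Context: An orthomodular poset (OMP) is a poset $L$ with least element $0$ and greatest element $1$ and an order-reversing involution $x\mapsto x^{\perp}$ such that $x\wedge x^{\perp}=0$ and $x\vee x^{\perp}=1$, such that $x\vee y$ exists whenever $x\perp y$ (i.e. $x\le y^{\perp}$), and such that $x\le y$ implies $y=x\vee(y\wedge x^{\perp})$. For a finite OMP $L$, a block is a maximal (with respect to inclusion) set of pairwise orthogonal atoms. $L$ is $(n,m)$-homogeneous if every atom of $L$ is contained in exactly $n$ blocks and every block has exactly $m$ elements. A state on $L$ is a map $s:L\to[0,1]$ with $s(1)=1$ and $s(x\vee y)=s(x)+s(y)$ whenever $x\perp y$. $S(L)$ denotes the convex set of all states on $L$; a state is pure if it is an extreme point of $S(L)$. -}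

module Defs where

open import Algebra.Bundles using (module AbelianGroup)
open import Algebra.Definitions using (Involutive)
import Algebra.Properties.CommutativeSemigroup as CommutativeSemigroupProperties
import Algebra.Properties.Ring as RingProperties
open import Data.Fin.Base using (Fin)
open import Data.Fin.Subset using (Subset; _∈_; _⊆_; ∣_∣)
open import Data.Nat.Base using (ℕ; _⊔_) renaming (_≤_ to _≤ⁿ_)
import Data.Nat.Properties as ℕₚ
open import Data.Product.Base using (∃; ∃-syntax; _×_; _,_)
open import Data.Rational.Base as ℚ using (ℚ; 0ℚ; 1ℚ; ½; Positive; positive; nonNegative)
import Data.Rational.Properties as ℚₚ
open import Data.Sum.Base using (_⊎_)
open import Function.Definitions using (Injective)
open import Level using (Level; 0ℓ) renaming (_⊔_ to _⊔ˡ_)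
open import Relation.Binary.Core using (Rel)
open import Relation.Binary.Definitions using (Minimum; Maximum)
open import Relation.Binary.PropositionalEquality
  using (_≡_; _≢_; refl; sym; trans; cong; cong₂; subst; module ≡-Reasoning)
open import Relation.Binary.Structures using (IsPartialOrder)
open import Relation.Unary using (Pred)

private
  variable
    a p ℓ : Level

-- Exactly k elements satisfy P, where elements are counted up to _≈_.
HasExactly : {A : Set a} → Rel A ℓ → ℕ → Pred A p → Set (a ⊔ˡ ℓ ⊔ˡ p)
HasExactly {A = A} _≈_ k P =
  ∃[ f ] Injective {A = Fin k} {B = A} _≡_ _≈_ f
       × (∀ i → P (f i))
       × (∀ x → P x → ∃[ i ] f i ≈ x)

------------------------------------------------------------------------
-- Real numbers, as Cauchy sequences of rationals.  The existential
-- quantifiers are Σ-types, so a real carries a modulus of convergence.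
-- Distinct sequences may denote the same real: equality of reals is _≈_.

Eventually : Pred ℕ 0ℓ → Set
Eventually P = ∃[ N ] (∀ n → N ≤ⁿ n → P n)

IsCauchy : (ℕ → ℚ) → Set
IsCauchy x = ∀ ε → 0ℚ ℚ.< ε →
  ∃[ N ] (∀ m n → N ≤ⁿ m → N ≤ⁿ n → ℚ.∣ x m ℚ.- x n ∣ ℚ.≤ ε)

record ℝ : Set where
  constructor mkℝ
  field
    seq    : ℕ → ℚ
    cauchy : IsCauchy seq

open ℝ public

infix 4 _≈_ _≤_ _<_

_≈_ : Rel ℝ 0ℓ
x ≈ y = ∀ ε → 0ℚ ℚ.< ε → Eventually (λ n → ℚ.∣ seq x n ℚ.- seq y n ∣ ℚ.≤ ε)

_≤_ : Rel ℝ 0ℓ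
x ≤ y = ∀ ε → 0ℚ ℚ.< ε → Eventually (λ n → seq x n ℚ.≤ seq y n ℚ.+ ε)

_<_ : Rel ℝ 0ℓ
x < y = ∃[ ε ] 0ℚ ℚ.< ε × Eventually (λ n → seq x n ℚ.+ ε ℚ.≤ seq y n)

private
  module ℚᴿ = RingProperties ℚₚ.+-*-ring
  module ℚ⁺ = CommutativeSemigroupProperties
    (AbelianGroup.commutativeSemigroup ℚₚ.+-0-abelianGroup)

  +-‿-‿interchange : ∀ p q r s →
    (p ℚ.+ q) ℚ.- (r ℚ.+ s) ≡ (p ℚ.- r) ℚ.+ (q ℚ.- s)
  +-‿-‿interchange p q r s =
    trans (cong ((p ℚ.+ q) ℚ.+_) (ℚₚ.neg-distrib-+ r s))
          (ℚ⁺.interchange p q (ℚ.- r) (ℚ.- s))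

  *-‿-‿telescope : ∀ p q r s →
    p ℚ.* q ℚ.- r ℚ.* s ≡ p ℚ.* (q ℚ.- s) ℚ.+ s ℚ.* (p ℚ.- r)
  *-‿-‿telescope p q r s = begin
    p ℚ.* q ℚ.- r ℚ.* s
      ≡⟨ cong (ℚ._- r ℚ.* s) (sym (ℚᴿ.//-rightDividesˡ (p ℚ.* s) (p ℚ.* q))) ⟩
    ((p ℚ.* q ℚ.- p ℚ.* s) ℚ.+ p ℚ.* s) ℚ.- r ℚ.* s
      ≡⟨ ℚₚ.+-assoc (p ℚ.* q ℚ.- p ℚ.* s) (p ℚ.* s) (ℚ.- (r ℚ.* s)) ⟩
    (p ℚ.* q ℚ.- p ℚ.* s) ℚ.+ (p ℚ.* s ℚ.- r ℚ.* s)
      ≡⟨ cong₂ ℚ._+_ (sym (ℚᴿ.x[y-z]≈xy-xz p q s)) (sym (ℚᴿ.[y-z]x≈yx-zx s p r)) ⟩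
    p ℚ.* (q ℚ.- s) ℚ.+ (p ℚ.- r) ℚ.* s
      ≡⟨ cong (p ℚ.* (q ℚ.- s) ℚ.+_) (ℚₚ.*-comm (p ℚ.- r) s) ⟩
    p ℚ.* (q ℚ.- s) ℚ.+ s ℚ.* (p ℚ.- r) ∎
    where open ≡-Reasoning

  half-pos : ∀ {ε} → 0ℚ ℚ.< ε → 0ℚ ℚ.< ½ ℚ.* ε
  half-pos {ε} 0<ε =
    ℚₚ.positive⁻¹ (½ ℚ.* ε) {{ℚₚ.pos*pos⇒pos ½ ε {{positive 0<ε}}}}

  half+half : ∀ ε → ½ ℚ.* ε ℚ.+ ½ ℚ.* ε ≡ ε
  half+half ε = trans (sym (ℚₚ.*-distribʳ-+ ε ½ ½)) (ℚₚ.*-identityˡ ε)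

  const-cauchy : ∀ q → IsCauchy (λ _ → q)
  const-cauchy q ε 0<ε = 0 , λ _ _ _ _ →
    subst (ℚ._≤ ε) (sym (cong ℚ.∣_∣ (ℚₚ.+-inverseʳ q))) (ℚₚ.<⇒≤ 0<ε)

  neg-cauchy : ∀ x → IsCauchy x → IsCauchy (λ n → ℚ.- x n)
  neg-cauchy x cx ε 0<ε with cx ε 0<ε
  ... | N , h = N , λ m n N≤m N≤n →
    subst (ℚ._≤ ε)
      (trans (sym (ℚₚ.∣-p∣≡∣p∣ (x m ℚ.- x n)))
             (cong ℚ.∣_∣ (ℚₚ.neg-distrib-+ (x m) (ℚ.- x n))))
      (h m n N≤m N≤n)

  +-cauchy : ∀ x y → IsCauchy x → IsCauchy y → IsCauchy (λ n → x n ℚ.+ y n)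
  +-cauchy x y cx cy ε 0<ε
    with cx (½ ℚ.* ε) (half-pos 0<ε) | cy (½ ℚ.* ε) (half-pos 0<ε)
  ... | M , h | N , k = M ⊔ N , λ m n le le′ →
    begin
      ℚ.∣ (x m ℚ.+ y m) ℚ.- (x n ℚ.+ y n) ∣
        ≡⟨ cong ℚ.∣_∣ (+-‿-‿interchange (x m) (y m) (x n) (y n)) ⟩
      ℚ.∣ (x m ℚ.- x n) ℚ.+ (y m ℚ.- y n) ∣
        ≤⟨ ℚₚ.∣p+q∣≤∣p∣+∣q∣ (x m ℚ.- x n) (y m ℚ.- y n) ⟩
      ℚ.∣ x m ℚ.- x n ∣ ℚ.+ ℚ.∣ y m ℚ.- y n ∣
        ≤⟨ ℚₚ.+-mono-≤ (h m n (ℕₚ.m⊔n≤o⇒m≤o M N le) (ℕₚ.m⊔n≤o⇒m≤o M N le′))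
                       (k m n (ℕₚ.m⊔n≤o⇒n≤o M N le) (ℕₚ.m⊔n≤o⇒n≤o M N le′)) ⟩
      ½ ℚ.* ε ℚ.+ ½ ℚ.* ε
        ≡⟨ half+half ε ⟩
      ε ∎
    where
    open ℚₚ.≤-Reasoning

  cauchy-bounded : ∀ x → IsCauchy x →
    ∃[ B ] Positive B × Eventually (λ n → ℚ.∣ x n ∣ ℚ.≤ B)
  cauchy-bounded x cx with cx 1ℚ (ℚₚ.positive⁻¹ 1ℚ)
  ... | N , h =
    1ℚ ℚ.+ ℚ.∣ x N ∣ ,
    ℚₚ.pos+nonNeg⇒pos 1ℚ ℚ.∣ x N ∣ {{nonNegative (ℚₚ.0≤∣p∣ (x N))}} ,
    N , λ n N≤n →
    begin
      ℚ.∣ x n ∣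
        ≡⟨ cong ℚ.∣_∣ (sym (ℚᴿ.//-rightDividesˡ (x N) (x n))) ⟩
      ℚ.∣ (x n ℚ.- x N) ℚ.+ x N ∣
        ≤⟨ ℚₚ.∣p+q∣≤∣p∣+∣q∣ (x n ℚ.- x N) (x N) ⟩
      ℚ.∣ x n ℚ.- x N ∣ ℚ.+ ℚ.∣ x N ∣
        ≤⟨ ℚₚ.+-monoˡ-≤ ℚ.∣ x N ∣ (h n N N≤n ℕₚ.≤-refl) ⟩
      1ℚ ℚ.+ ℚ.∣ x N ∣ ∎
    where
    open ℚₚ.≤-Reasoning

  divide : ∀ B ε → Positive B → 0ℚ ℚ.< ε → ∃[ δ ] 0ℚ ℚ.< δ × B ℚ.* δ ≡ ε
  divide B ε posB 0<ε = 1/B ℚ.* ε , 0<δ , eq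
    where
    instance
      _ = posB
      _ = positive 0<ε
      _ = ℚₚ.pos⇒nonZero B
    1/B = ℚ.1/ B
    0<δ = ℚₚ.positive⁻¹ (1/B ℚ.* ε) {{ℚₚ.pos*pos⇒pos 1/B {{ℚₚ.1/pos⇒pos B}} ε}}
    eq = trans (sym (ℚₚ.*-assoc B 1/B ε))
           (trans (cong (ℚ._* ε) (ℚₚ.*-inverseʳ B)) (ℚₚ.*-identityˡ ε))

  ∣*∣-mono-≤ : ∀ {B δ} p q → Positive B →
    ℚ.∣ p ∣ ℚ.≤ B → ℚ.∣ q ∣ ℚ.≤ δ → ℚ.∣ p ℚ.* q ∣ ℚ.≤ B ℚ.* δ
  ∣*∣-mono-≤ {B} {δ} p q posB p≤B q≤δ =
    begin
      ℚ.∣ p ℚ.* q ∣          ≡⟨ ℚₚ.∣p*q∣≡∣p∣*∣q∣ p q ⟩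
      ℚ.∣ p ∣ ℚ.* ℚ.∣ q ∣    ≤⟨ ℚₚ.*-monoʳ-≤-nonNeg ℚ.∣ q ∣ {{nonNegative (ℚₚ.0≤∣p∣ q)}} p≤B ⟩
      B ℚ.* ℚ.∣ q ∣          ≤⟨ ℚₚ.*-monoˡ-≤-nonNeg B {{ℚₚ.pos⇒nonNeg B {{posB}}}} q≤δ ⟩
      B ℚ.* δ ∎
    where open ℚₚ.≤-Reasoning

  *-cauchy : ∀ x y → IsCauchy x → IsCauchy y → IsCauchy (λ n → x n ℚ.* y n)
  *-cauchy x y cx cy ε 0<ε
    with cauchy-bounded x cx | cauchy-bounded y cy
  ... | X , posX , K , boundx | Y , posY , L , boundy
    with divide X (½ ℚ.* ε) posX (half-pos 0<ε) | divide Y (½ ℚ.* ε) posY (half-pos 0<ε)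
  ... | δy , 0<δy , eqy | δx , 0<δx , eqx
    with cx δx 0<δx | cy δy 0<δy
  ... | M , h | N , k = (K ⊔ L) ⊔ (M ⊔ N) , λ m n le le′ →
    let
      K≤m = ℕₚ.m⊔n≤o⇒m≤o K L (ℕₚ.m⊔n≤o⇒m≤o (K ⊔ L) (M ⊔ N) le)
      L≤n = ℕₚ.m⊔n≤o⇒n≤o K L (ℕₚ.m⊔n≤o⇒m≤o (K ⊔ L) (M ⊔ N) le′)
      M≤m = ℕₚ.m⊔n≤o⇒m≤o M N (ℕₚ.m⊔n≤o⇒n≤o (K ⊔ L) (M ⊔ N) le)
      M≤n = ℕₚ.m⊔n≤o⇒m≤o M N (ℕₚ.m⊔n≤o⇒n≤o (K ⊔ L) (M ⊔ N) le′)
      N≤m = ℕₚ.m⊔n≤o⇒n≤o M N (ℕₚ.m⊔n≤o⇒n≤o (K ⊔ L) (M ⊔ N) le)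
      N≤n = ℕₚ.m⊔n≤o⇒n≤o M N (ℕₚ.m⊔n≤o⇒n≤o (K ⊔ L) (M ⊔ N) le′)
    in begin
      ℚ.∣ x m ℚ.* y m ℚ.- x n ℚ.* y n ∣
        ≡⟨ cong ℚ.∣_∣ (*-‿-‿telescope (x m) (y m) (x n) (y n)) ⟩
      ℚ.∣ x m ℚ.* (y m ℚ.- y n) ℚ.+ y n ℚ.* (x m ℚ.- x n) ∣
        ≤⟨ ℚₚ.∣p+q∣≤∣p∣+∣q∣ (x m ℚ.* (y m ℚ.- y n)) (y n ℚ.* (x m ℚ.- x n)) ⟩
      ℚ.∣ x m ℚ.* (y m ℚ.- y n) ∣ ℚ.+ ℚ.∣ y n ℚ.* (x m ℚ.- x n) ∣
        ≤⟨ ℚₚ.+-mono-≤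
             (∣*∣-mono-≤ (x m) (y m ℚ.- y n) posX (boundx m K≤m) (k m n N≤m N≤n))
             (∣*∣-mono-≤ (y n) (x m ℚ.- x n) posY (boundy n L≤n) (h m n M≤m M≤n)) ⟩
      X ℚ.* δy ℚ.+ Y ℚ.* δx
        ≡⟨ cong₂ ℚ._+_ eqy eqx ⟩
      ½ ℚ.* ε ℚ.+ ½ ℚ.* ε
        ≡⟨ half+half ε ⟩
      ε ∎
    where
    open ℚₚ.≤-Reasoning

infixl 6 _+_ _-_
infixl 7 _*_
infix  8 -_

fromℚ : ℚ → ℝ
fromℚ q = mkℝ (λ _ → q) (const-cauchy q)

0ℝ 1ℝ : ℝ
0ℝ = fromℚ 0ℚ
1ℝ = fromℚ 1ℚ

_+_ : ℝ → ℝ → ℝ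
x + y = mkℝ (λ n → seq x n ℚ.+ seq y n) (+-cauchy (seq x) (seq y) (cauchy x) (cauchy y))

-_ : ℝ → ℝ
- x = mkℝ (λ n → ℚ.- seq x n) (neg-cauchy (seq x) (cauchy x))

_-_ : ℝ → ℝ → ℝ
x - y = x + (- y)

_*_ : ℝ → ℝ → ℝ
x * y = mkℝ (λ n → seq x n ℚ.* seq y n) (*-cauchy (seq x) (seq y) (cauchy x) (cauchy y))

infix 4 _≐_

_≐_ : {A : Set a} → Rel (A → ℝ) a
f ≐ g = ∀ x → f x ≈ g x

IsExtremePoint : {A : Set a} → Pred (A → ℝ) p → Pred (A → ℝ) (a ⊔ˡ p)
IsExtremePoint S s = S s × (∀ s₁ s₂ t → S s₁ → S s₂ → 0ℝ < t → t < 1ℝ →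
  s ≐ (λ x → t * s₁ x + (1ℝ - t) * s₂ x) → s₁ ≐ s × s₂ ≐ s)

------------------------------------------------------------------------
-- Orthomodular posets

module _ {A : Set a} (_⊑_ : Rel A ℓ) where

  IsJoin : A → A → A → Set (a ⊔ˡ ℓ)
  IsJoin x y z = x ⊑ z × y ⊑ z × (∀ w → x ⊑ w → y ⊑ w → z ⊑ w)

  IsMeet : A → A → A → Set (a ⊔ˡ ℓ)
  IsMeet x y z = z ⊑ x × z ⊑ y × (∀ w → w ⊑ x → w ⊑ y → w ⊑ z)

record IsOrthomodularPoset {A : Set a} (_⊑_ : Rel A ℓ)
                           (_^⊥ : A → A) (𝟘 𝟙 : A) : Set (a ⊔ˡ ℓ) where
  field
    isPartialOrder  : IsPartialOrder _≡_ _⊑_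
    minimum         : Minimum _⊑_ 𝟘
    maximum         : Maximum _⊑_ 𝟙
    ⊥-antitone      : ∀ x y → x ⊑ y → (y ^⊥) ⊑ (x ^⊥)
    ⊥-involutive    : Involutive _≡_ _^⊥
    meet-complement : ∀ x → IsMeet _⊑_ x (x ^⊥) 𝟘
    join-complement : ∀ x → IsJoin _⊑_ x (x ^⊥) 𝟙
    orthogonal-join : ∀ x y → x ⊑ (y ^⊥) → ∃ (IsJoin _⊑_ x y)
    orthomodular    : ∀ x y → x ⊑ y →
                      ∃[ z ] IsMeet _⊑_ y (x ^⊥) z × IsJoin _⊑_ x z y

-- A finite orthomodular poset is presented on the carrier Fin size, which
-- loses nothing up to isomorphism.
record FiniteOMP : Set₁ where
  infix  4 _⊑_ _⟂_
  infix  8 _^⊥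
  field
    size                : ℕ
    _⊑_                 : Rel (Fin size) 0ℓ
    _^⊥                 : Fin size → Fin size
    𝟘 𝟙                 : Fin size
    isOrthomodularPoset : IsOrthomodularPoset _⊑_ _^⊥ 𝟘 𝟙

  open IsOrthomodularPoset isOrthomodularPoset public

  Element : Set
  Element = Fin size

  _⟂_ : Rel Element 0ℓ
  x ⟂ y = x ⊑ y ^⊥

  IsAtom : Pred Element 0ℓ
  IsAtom x = x ≢ 𝟘 × (∀ y → y ⊑ x → y ≡ 𝟘 ⊎ y ≡ x)

  IsOrthogonalSetOfAtoms : Pred (Subset size) 0ℓ
  IsOrthogonalSetOfAtoms B =
    (∀ x → x ∈ B → IsAtom x) × (∀ x y → x ∈ B → y ∈ B → x ≢ y → x ⟂ y)

  IsBlock : Pred (Subset size) 0ℓ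
  IsBlock B = IsOrthogonalSetOfAtoms B
            × (∀ C → IsOrthogonalSetOfAtoms C → B ⊆ C → B ≡ C)

  IsHomogeneous : ℕ → ℕ → Set
  IsHomogeneous n m =
    (∀ x → IsAtom x → HasExactly _≡_ n (λ B → IsBlock B × x ∈ B))
    × (∀ B → IsBlock B → ∣ B ∣ ≡ m)

  record IsState (s : Element → ℝ) : Set where
    field
      nonneg   : ∀ x → 0ℝ ≤ s x
      ≤1       : ∀ x → s x ≤ 1ℝ
      unit     : s 𝟙 ≈ 1ℝ
      additive : ∀ x y z → x ⟂ y → IsJoin _⊑_ x y z → s z ≈ s x + s y

  IsPureState : Pred (Element → ℝ) 0ℓ
  IsPureState = IsExtremePoint IsState

{-# OPTIONS --safe #-}
-- A (3,3)-homogeneous orthomodular poset is determined by the configuration of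
-- its atoms and blocks, and conversely a configuration without triangles whose
-- lines have three points and whose points lie on three lines yields such a poset
-- with elements 0, 1, the points and their complements.  A state is a nonnegative
-- weighting of the points with sum 1 on every line, so the pure states are the
-- vertices of a polytope, which are rational.
--
-- Constructively, everything rests on the fact that every state s dominates θ v
-- on the points, for one of the listed vertices v and a fixed θ > 0: otherwise s
-- is small somewhere on the support of each v, and for each such choice of points
-- an integer combination of the line equations bounds the sum of s over the chosen
-- points from below.  If s is pure, s = θ v + (1 - θ) s' then gives s = v.
-- Conversely, the supports of the vertices form an antichain, so a state s that
-- vanishes off the support of v dominates θ v for this very v; the remainder s'
-- again vanishes there, and iterating shows s ≥ (1 - (1 - θ)^m) v for all m.
-- Hence s = v, which makes v pure.
module Submission where

open import Defs
open import Data.Bool.Base using (Bool; true; false; T; if_then_else_)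
open import Data.Bool.ListAction using (any; all)
open import Data.Bool.Properties using (T?)
open import Data.Empty using (⊥-elim)
open import Data.Fin.Base using (Fin; zero; suc; toℕ; _↑ˡ_; _↑ʳ_; splitAt)
import Data.Fin.Properties as Finₚ
open import Data.Fin.Subset using (Subset; ∣_∣; ⁅_⁆; _∪_; inside; outside)
  renaming (_∈_ to _∈ˢ_; _∉_ to _∉ˢ_; _⊆_ to _⊆ˢ_)
import Data.Fin.Subset.Properties as Subsetₚ
import Data.Integer.Base as ℤ
import Data.Integer.Properties as ℤₚ
open import Data.List.Base using (List; []; _∷_; map; mapMaybe; length; filter; upTo; allFin)
open import Data.List.Membership.Propositional using (_∈_; find)
open import Data.List.Membership.Propositional.Properties using (∈-filter⁺; ∈-upTo⁺)
open import Data.List.Relation.Unary.All as All using (All; []; _∷_)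
import Data.List.Relation.Unary.All.Properties as Allₚ
open import Data.List.Relation.Unary.Any as Any using (Any; here; there)
import Data.List.Relation.Unary.Any.Properties as Anyₚ
open import Data.Maybe.Base using (Maybe; just; nothing)
open import Data.Nat.Base using (ℕ; zero; suc; z≤n; s≤s; _⊔_; _≡ᵇ_)
  renaming (_≤_ to _≤ⁿ_; _<_ to _<ⁿ_; _+_ to _+ⁿ_)
import Data.Nat.Coprimality as Coprime
open import Data.Nat.DivMod using (_mod_; m<n⇒m%n≡m)
import Data.Nat.Properties as ℕₚ
open import Data.Product.Base using (_×_; _,_; proj₁; proj₂; swap; ∃; ∃-syntax; Σ-syntax)
open import Data.Product.Properties using (≡-dec)
open import Data.Rational.Base as ℚ
  using (ℚ; mkℚ; 0ℚ; 1ℚ; ½; Positive; positive; nonNegative; *≤*)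
import Data.Rational.Properties as ℚₚ
open import Data.Rational.Solver using (module +-*-Solver)
import Data.Rational.Unnormalised.Base as ℚᵘ
import Data.Rational.Unnormalised.Properties as ℚᵘₚ
open import Data.Sum.Base as Sum using (_⊎_; inj₁; inj₂)
open import Data.Vec.Base as Vec using (Vec; []; _∷_)
open import Function.Base using (_∘_)
open import Level using (0ℓ)
open import Relation.Binary.Core using (Rel)
open import Relation.Binary.Definitions using (DecidableEquality)
open import Relation.Binary.PropositionalEquality
  using (_≡_; _≢_; refl; sym; trans; cong; subst; subst₂; isEquivalence; module ≡-Reasoning)
open import Relation.Binary.Structures using (IsPartialOrder)
open import Relation.Nullary using (¬_; Dec; yes; no; does; contradiction)
open import Relation.Nullary.Decidable
  using (_×-dec_; _⊎-dec_; _→-dec_; ¬?; from-yes; toWitness)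

open +-*-Solver using (solve; _:=_; _:+_; _:*_; _:-_; :-_; con)

-- Order on rationals and reals

-- The combinations of line equations come from Farkas' lemma. A set Z of points meets the support
-- of every vertex exactly when no state vanishes on all of Z, because a nonempty face of the
-- polytope contains a vertex. The infeasibility of "s vanishes on Z" then has an integral witness:
-- more lines counted positively than negatively, such that every point with a positive net
-- coefficient lies in Z. Completeness of the list of vertices thus becomes a finite search over
-- transversals, with no vertex enumeration and no compactness argument.
--
-- The obstacle is that equality and order of reals are undecidable, so one cannot ask at which
-- points a state vanishes. A rational approximation does decide between "at least θ" and "at most
-- 3θ". The witnesses have to survive this blur: their excess must be so short that values of at
-- most 3θ still cannot add up to 1. This fixes how small θ has to be, and it is why domination is
-- by a constant on the support and not by the values of the vertex.

≤ℚ-by-difference : ∀ {p q r s} → p ℚ.≤ q → s ℚ.- r ≡ q ℚ.- p → r ℚ.≤ s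
≤ℚ-by-difference {p} {q} {r} {s} p≤q eq = begin
  r                        ≡⟨ solve 2 (λ p r → r := (p :- p) :+ r) refl p r ⟩
  (p ℚ.- p) ℚ.+ r          ≤⟨ ℚₚ.+-monoˡ-≤ r (ℚₚ.+-monoˡ-≤ (ℚ.- p) p≤q) ⟩
  (q ℚ.- p) ℚ.+ r          ≡⟨ cong (ℚ._+ r) (sym eq) ⟩
  (s ℚ.- r) ℚ.+ r          ≡⟨ solve 2 (λ r s → (s :- r) :+ r := s) refl r s ⟩
  s                        ∎
  where open ℚₚ.≤-Reasoning

half-pos : ∀ {ε} → 0ℚ ℚ.< ε → 0ℚ ℚ.< ½ ℚ.* ε
half-pos {ε} 0<ε =
  ℚₚ.positive⁻¹ (½ ℚ.* ε) {{ℚₚ.pos*pos⇒pos ½ ε {{positive 0<ε}}}}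

half+half : ∀ ε → ½ ℚ.* ε ℚ.+ ½ ℚ.* ε ≡ ε
half+half ε = trans (sym (ℚₚ.*-distribʳ-+ ε ½ ½)) (ℚₚ.*-identityˡ ε)

∣∣≤-intro : ∀ {p q ε} → p ℚ.≤ q ℚ.+ ε → q ℚ.≤ p ℚ.+ ε → ℚ.∣ p ℚ.- q ∣ ℚ.≤ ε
∣∣≤-intro {p} {q} {ε} p≤ q≤ with ℚₚ.∣p∣≡p∨∣p∣≡-p (p ℚ.- q)
... | inj₁ eq = subst (ℚ._≤ ε) (sym eq)
      (≤ℚ-by-difference p≤ (solve 3 (λ p q e → e :- (p :- q) := (q :+ e) :- p) refl p q ε))
... | inj₂ eq = subst (ℚ._≤ ε) (sym eq)
      (≤ℚ-by-difference q≤ (solve 3 (λ p q e → e :- (:- (p :- q)) := (p :+ e) :- q) refl p q ε))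

p≤∣p∣ : ∀ p → p ℚ.≤ ℚ.∣ p ∣
p≤∣p∣ p with ℚₚ.≤-total 0ℚ p
... | inj₁ 0≤p = ℚₚ.≤-reflexive (sym (ℚₚ.0≤p⇒∣p∣≡p 0≤p))
... | inj₂ p≤0 = ℚₚ.≤-trans p≤0 (ℚₚ.0≤∣p∣ p)

∣∣≤-elim : ∀ {p q ε} → ℚ.∣ p ℚ.- q ∣ ℚ.≤ ε → p ℚ.≤ q ℚ.+ ε
∣∣≤-elim {p} {q} {ε} h = ≤ℚ-by-difference (ℚₚ.≤-trans (p≤∣p∣ (p ℚ.- q)) h)
  (solve 3 (λ p q e → (q :+ e) :- p := e :- (p :- q)) refl p q ε)

eventually : ∀ {P Q} → (∀ n → P n → Q n) → Eventually P → Eventually Q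
eventually f (N , h) = N , λ n N≤n → f n (h n N≤n)

eventually₂ : ∀ {P Q R} → (∀ n → P n → Q n → R n) → Eventually P → Eventually Q → Eventually R
eventually₂ f (M , h) (N , k) = M ⊔ N , λ n le →
  f n (h n (ℕₚ.m⊔n≤o⇒m≤o M N le)) (k n (ℕₚ.m⊔n≤o⇒n≤o M N le))

infix 4 _≲_ _≋_

-- _≤_ and _≈_ unfold to statements about sequences, from which Agda cannot
-- recover the reals being compared; the wrappers make them inferable.
record _≲_ (x y : ℝ) : Set where
  constructor wrap
  field unwrap : x ≤ y

open _≲_

record _≋_ (x y : ℝ) : Set where
  constructor ≲-antisym
  field
    ≋⇒≲ : x ≲ y
    ≋⇒≳ : y ≲ x

open _≋_

≋⇒≈ : ∀ {x y} → x ≋ y → x ≈ y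
≋⇒≈ (≲-antisym (wrap x≤y) (wrap y≤x)) ε 0<ε = eventually₂ (λ n → ∣∣≤-intro) (x≤y ε 0<ε) (y≤x ε 0<ε)

≈⇒≋ : ∀ {x y} → x ≈ y → x ≋ y
≈⇒≋ {x} {y} x≈y = ≲-antisym
  (wrap (λ ε 0<ε → eventually (λ n → ∣∣≤-elim) (x≈y ε 0<ε)))
  (wrap (λ ε 0<ε → eventually
    (λ n p → ∣∣≤-elim (subst (ℚ._≤ ε) (trans (sym (ℚₚ.∣-p∣≡∣p∣ (seq x n ℚ.- seq y n)))
      (cong ℚ.∣_∣ (solve 2 (λ x y → :- (x :- y) := y :- x) refl (seq x n) (seq y n)))) p))
    (x≈y ε 0<ε)))

p≤p+ε : ∀ p {ε} → 0ℚ ℚ.< ε → p ℚ.≤ p ℚ.+ ε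
p≤p+ε p {ε} 0<ε = ≤ℚ-by-difference (ℚₚ.<⇒≤ 0<ε)
  (solve 2 (λ y e → (y :+ e) :- y := e :- con 0ℚ) refl p ε)

≲-pointwise : ∀ {x y} → (∀ n → seq x n ℚ.≤ seq y n) → x ≲ y
≲-pointwise h = wrap λ ε 0<ε → 0 , λ n _ → ℚₚ.≤-trans (h n) (p≤p+ε _ 0<ε)

≋-pointwise : ∀ {x y} → (∀ n → seq x n ≡ seq y n) → x ≋ y
≋-pointwise h = ≲-antisym
  (≲-pointwise (λ n → ℚₚ.≤-reflexive (h n))) (≲-pointwise (λ n → ℚₚ.≤-reflexive (sym (h n))))

≲-refl : ∀ {x} → x ≲ x
≲-refl = ≲-pointwise (λ _ → ℚₚ.≤-refl)

≲-trans : ∀ {x y z} → x ≲ y → y ≲ z → x ≲ z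
≲-trans {x} {y} {z} (wrap x≤y) (wrap y≤z) = wrap λ ε 0<ε → eventually₂
  (λ n p q → ℚₚ.≤-trans p (≤ℚ-by-difference q
    (trans (cong (λ e → (seq z n ℚ.+ e) ℚ.- (seq y n ℚ.+ ½ ℚ.* ε)) (sym (half+half ε)))
      (solve 3 (λ y z h → (z :+ (h :+ h)) :- (y :+ h) := (z :+ h) :- y) refl (seq y n) (seq z n) (½ ℚ.* ε)))))
  (x≤y (½ ℚ.* ε) (half-pos 0<ε)) (y≤z (½ ℚ.* ε) (half-pos 0<ε))

+-mono-≲ : ∀ {x y u v} → x ≲ y → u ≲ v → x + u ≲ y + v
+-mono-≲ {x} {y} {u} {v} (wrap x≤y) (wrap u≤v) = wrap λ ε 0<ε → eventually₂
  (λ n p q → ≤ℚ-by-difference (ℚₚ.+-mono-≤ p q)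
    (trans (cong (λ e → ((seq y n ℚ.+ seq v n) ℚ.+ e) ℚ.- (seq x n ℚ.+ seq u n)) (sym (half+half ε)))
      (solve 5 (λ x y u v h → ((y :+ v) :+ (h :+ h)) :- (x :+ u) := ((y :+ h) :+ (v :+ h)) :- (x :+ u)) refl
         (seq x n) (seq y n) (seq u n) (seq v n) (½ ℚ.* ε))))
  (x≤y (½ ℚ.* ε) (half-pos 0<ε)) (u≤v (½ ℚ.* ε) (half-pos 0<ε))

*-monoˡ-≲ : ∀ c .{{_ : Positive c}} x y → x ≲ y → fromℚ c * x ≲ fromℚ c * y
*-monoˡ-≲ c {{posc}} x y (wrap x≤y) = wrap λ ε 0<ε →
  let
    -- Tolerance ε / c in the premise is scaled by c to exactly ε.
    δ = ℚ.1/ c ℚ.* ε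
    0<δ = ℚₚ.positive⁻¹ δ {{ℚₚ.pos*pos⇒pos (ℚ.1/ c) {{ℚₚ.1/pos⇒pos c}} ε {{positive 0<ε}}}}
    cδ≡ε = trans (sym (ℚₚ.*-assoc c (ℚ.1/ c) ε))
             (trans (cong (ℚ._* ε) (ℚₚ.*-inverseʳ c)) (ℚₚ.*-identityˡ ε))
  in eventually
    (λ n p → ℚₚ.≤-trans (ℚₚ.*-monoˡ-≤-nonNeg c {{ℚₚ.pos⇒nonNeg c}} p)
      (ℚₚ.≤-reflexive (trans (ℚₚ.*-distribˡ-+ c (seq y n) δ) (cong (c ℚ.* seq y n ℚ.+_) cδ≡ε))))
    (x≤y δ 0<δ)
  where
  instance
    _ = ℚₚ.pos⇒nonZero c

≋-refl : ∀ {x} → x ≋ x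
≋-refl = ≲-antisym ≲-refl ≲-refl

≋-sym : ∀ {x y} → x ≋ y → y ≋ x
≋-sym (≲-antisym p q) = ≲-antisym q p

≋-trans : ∀ {x y z} → x ≋ y → y ≋ z → x ≋ z
≋-trans (≲-antisym p q) (≲-antisym r s) = ≲-antisym (≲-trans p r) (≲-trans s q)

+-cong : ∀ {x y u v} → x ≋ y → u ≋ v → x + u ≋ y + v
+-cong (≲-antisym p q) (≲-antisym r s) = ≲-antisym (+-mono-≲ p r) (+-mono-≲ q s)

*-congˡ : ∀ c .{{_ : Positive c}} x y → x ≋ y → fromℚ c * x ≋ fromℚ c * y
*-congˡ c x y (≲-antisym p q) = ≲-antisym (*-monoˡ-≲ c x y p) (*-monoˡ-≲ c y x q)

-- Linear inequalities are all proved in this form: the known ones are added up by `+-mono-≲`, and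
-- what remains is a termwise ring identity for the solver.
≲-by-difference : ∀ {x y u v} → x ≲ y → (∀ n → seq (v - u) n ≡ seq (y - x) n) → u ≲ v
≲-by-difference {x} {y} {u} {v} (wrap x≤y) eq = wrap λ ε 0<ε → eventually
  (λ n p → ≤ℚ-by-difference p (begin
    (seq v n ℚ.+ ε) ℚ.- seq u n  ≡⟨ solve 3 (λ v u e → (v :+ e) :- u := (v :- u) :+ e) refl (seq v n) (seq u n) ε ⟩
    (seq v n ℚ.- seq u n) ℚ.+ ε  ≡⟨ cong (ℚ._+ ε) (eq n) ⟩
    (seq y n ℚ.- seq x n) ℚ.+ ε  ≡⟨ solve 3 (λ y x e → (y :- x) :+ e := (y :+ e) :- x) refl (seq y n) (seq x n) ε ⟩
    (seq y n ℚ.+ ε) ℚ.- seq x n  ∎))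
  (x≤y ε 0<ε)
  where open ≡-Reasoning

≋-by-difference : ∀ {x y u v} → x ≋ y → (∀ n → seq (v - u) n ≡ seq (y - x) n) → u ≋ v
≋-by-difference {x} {y} {u} {v} (≲-antisym x≲y y≲x) eq = ≲-antisym (≲-by-difference x≲y eq)
  (≲-by-difference y≲x (λ n → begin
    seq u n ℚ.- seq v n           ≡⟨ flip- (seq u n) (seq v n) ⟩
    ℚ.- (seq v n ℚ.- seq u n)     ≡⟨ cong ℚ.-_ (eq n) ⟩
    ℚ.- (seq y n ℚ.- seq x n)     ≡⟨ flip- (seq x n) (seq y n) ⟨
    seq x n ℚ.- seq y n           ∎))
  where
  open ≡-Reasoning
  flip- : ∀ p q → p ℚ.- q ≡ ℚ.- (q ℚ.- p)
  flip- = solve 2 (λ p q → p :- q := :- (q :- p)) refl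

fromℚ-mono-≲ : ∀ {p q} → p ℚ.≤ q → fromℚ p ≲ fromℚ q
fromℚ-mono-≲ p≤q = ≲-pointwise (λ _ → p≤q)

≲-limit : ∀ {x y} → (∀ ε → 0ℚ ℚ.< ε → x ≲ y + fromℚ ε) → x ≲ y
≲-limit {x} {y} h = wrap λ ε 0<ε → eventually
  (λ n p → subst (seq x n ℚ.≤_)
    (trans (ℚₚ.+-assoc (seq y n) (½ ℚ.* ε) (½ ℚ.* ε)) (cong (seq y n ℚ.+_) (half+half ε))) p)
  (unwrap (h (½ ℚ.* ε) (half-pos 0<ε)) (½ ℚ.* ε) (half-pos 0<ε))

-- Rational order is decidable, so refuting q < p suffices: with half the gap as tolerance, any late
-- index gives p ≤ q + (p - q) / 2.
fromℚ-cancel-≲ : ∀ {p q} → fromℚ p ≲ fromℚ q → p ℚ.≤ q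
fromℚ-cancel-≲ {p} {q} h with p ℚₚ.≤? q
... | yes p≤q = p≤q
... | no  p≰q = contradiction (ℚₚ.<-≤-trans 0<½d (≤ℚ-by-difference (proj₂ bound N ℕₚ.≤-refl)
        (trans (solve 1 (λ h → con 0ℚ :- h := h :- (h :+ h)) refl ½d)
          (trans (cong (ℚ._-_ ½d) (half+half (p ℚ.- q)))
            (solve 3 (λ p q h → h :- (p :- q) := (q :+ h) :- p) refl p q ½d)))))
        (ℚₚ.<-irrefl refl)
  where
  ½d = ½ ℚ.* (p ℚ.- q)
  0<½d : 0ℚ ℚ.< ½d
  0<½d = half-pos (subst (ℚ._< p ℚ.- q) (ℚₚ.+-inverseʳ q) (ℚₚ.+-monoˡ-< (ℚ.- q) (ℚₚ.≰⇒> p≰q)))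
  bound = unwrap h ½d 0<½d
  N = proj₁ bound

-- Approximate comparability: a term within ε of the limit is compared with m. The alternatives
-- overlap on an interval of width 2ε, which is the price of decidability.
≲-or-≳ : ∀ m ε → 0ℚ ℚ.< ε → ∀ x → fromℚ (m ℚ.- ε) ≲ x ⊎ x ≲ fromℚ (m ℚ.+ ε)
≲-or-≳ m ε 0<ε x with cauchy x ε 0<ε
... | N , close with ℚₚ.≤-total m (seq x N)
... | inj₁ m≤xN = inj₁ (wrap λ δ 0<δ → N , λ n N≤n → ℚₚ.≤-trans
        (≤ℚ-by-difference {r = m ℚ.- ε} {s = seq x n} (ℚₚ.+-mono-≤ m≤xN (∣∣≤-elim (close N n ℕₚ.≤-refl N≤n)))
          (solve 4 (λ m e y z → z :- (m :- e) := (y :+ (z :+ e)) :- (m :+ y)) refl m ε (seq x N) (seq x n)))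
        (p≤p+ε (seq x n) 0<δ))
... | inj₂ xN≤m = inj₂ (wrap λ δ 0<δ → N , λ n N≤n → ℚₚ.≤-trans
        (≤ℚ-by-difference {r = seq x n} {s = m ℚ.+ ε} (ℚₚ.+-mono-≤ xN≤m (∣∣≤-elim (close n N N≤n ℕₚ.≤-refl)))
          (solve 4 (λ m e y z → (m :+ e) :- z := (m :+ (y :+ e)) :- (y :+ z)) refl m ε (seq x N) (seq x n)))
        (p≤p+ε (m ℚ.+ ε) 0<δ))

≡1⇒≤1 : ∀ {p q} → 0ℚ ℚ.≤ p → p ℚ.+ q ≡ 1ℚ → q ℚ.≤ 1ℚ
≡1⇒≤1 {p} {q} 0≤p eq = ≤ℚ-by-difference 0≤p
  (trans (cong (ℚ._- q) (sym eq)) (solve 2 (λ p q → (p :+ q) :- q := p :- con 0ℚ) refl p q))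

-- The product t x is controlled through the positive lower bound of t, so that
-- x and y need not be bounded.
convex-vanish : ∀ {t u x y} → 0ℝ < t → 0ℝ < u → (∀ n → seq t n ℚ.+ seq u n ≡ 1ℚ) →
  0ℝ ≲ y → t * x + u * y ≲ 0ℝ → x ≲ 0ℝ
convex-vanish {t} {u} {x} {y} (δ , 0<δ , δ≤t) (γ , 0<γ , γ≤u) t+u≡1 (wrap 0≤y) (wrap tx+uy≤0) =
  wrap λ ε 0<ε →
  let
    -- Half of δ ε, because η is paid twice, for the sum being only at most η and for y being only
    -- at least -η, and the total is then divided by the lower bound δ of t.
    η = ½ ℚ.* (δ ℚ.* ε)
    0<η = half-pos (ℚₚ.positive⁻¹ (δ ℚ.* ε) {{ℚₚ.pos*pos⇒pos δ {{positive 0<δ}} ε {{positive 0<ε}}}})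
  in eventually₂ (λ n b (0≤ , ≤0) → b 0≤ ≤0)
       (eventually₂ (λ n δ≤ γ≤ → bound ε 0<ε (seq t n) (seq u n) (seq x n) (seq y n) δ≤ γ≤ (t+u≡1 n)) δ≤t γ≤u)
       (eventually₂ (λ n → _,_) (0≤y η 0<η) (tx+uy≤0 η 0<η))
  where
  bound : ∀ ε → 0ℚ ℚ.< ε → ∀ t u x y → 0ℚ ℚ.+ δ ℚ.≤ t → 0ℚ ℚ.+ γ ℚ.≤ u → t ℚ.+ u ≡ 1ℚ →
    0ℚ ℚ.≤ y ℚ.+ ½ ℚ.* (δ ℚ.* ε) → t ℚ.* x ℚ.+ u ℚ.* y ℚ.≤ 0ℚ ℚ.+ ½ ℚ.* (δ ℚ.* ε) → x ℚ.≤ 0ℚ ℚ.+ ε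
  bound ε 0<ε t u x y δ≤t γ≤u t+u≡1 0≤y ≤η with ℚₚ.≤-total x 0ℚ
  ... | inj₁ x≤0 = ℚₚ.≤-trans x≤0 (p≤p+ε 0ℚ 0<ε)
  ... | inj₂ 0≤x = ℚₚ.*-cancelˡ-≤-pos δ {{positive 0<δ}} (begin
    δ ℚ.* x                        ≤⟨ ℚₚ.*-monoʳ-≤-nonNeg x {{nonNegative 0≤x}} (subst (ℚ._≤ t) (ℚₚ.+-identityˡ δ) δ≤t) ⟩
    t ℚ.* x                        ≤⟨ ≤ℚ-by-difference (ℚₚ.+-mono-≤ ≤η u[y+η]≥0)
                                        (solve 4 (λ tx u y h → (h :+ u :* h) :- tx := (con 0ℚ :+ h :+ u :* (y :+ h)) :- (tx :+ u :* y :+ con 0ℚ)) refl (t ℚ.* x) u y η) ⟩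
    η ℚ.+ u ℚ.* η                  ≤⟨ ℚₚ.+-monoʳ-≤ η (ℚₚ.*-monoʳ-≤-nonNeg η {{nonNegative (ℚₚ.<⇒≤ 0<η)}} u≤1) ⟩
    η ℚ.+ 1ℚ ℚ.* η                 ≡⟨ cong (η ℚ.+_) (ℚₚ.*-identityˡ η) ⟩
    η ℚ.+ η                        ≡⟨ half+half (δ ℚ.* ε) ⟩
    δ ℚ.* ε                        ≡⟨ cong (δ ℚ.*_) (ℚₚ.+-identityˡ ε) ⟨
    δ ℚ.* (0ℚ ℚ.+ ε)               ∎)
    where
    open ℚₚ.≤-Reasoning
    η = ½ ℚ.* (δ ℚ.* ε)
    0<η = half-pos (ℚₚ.positive⁻¹ (δ ℚ.* ε) {{ℚₚ.pos*pos⇒pos δ {{positive 0<δ}} ε {{positive 0<ε}}}})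
    0≤t = ℚₚ.≤-trans (ℚₚ.<⇒≤ 0<δ) (subst (ℚ._≤ t) (ℚₚ.+-identityˡ δ) δ≤t)
    0≤u = ℚₚ.≤-trans (ℚₚ.<⇒≤ 0<γ) (subst (ℚ._≤ u) (ℚₚ.+-identityˡ γ) γ≤u)
    u≤1 = ≡1⇒≤1 0≤t t+u≡1
    u[y+η]≥0 : 0ℚ ℚ.≤ u ℚ.* (y ℚ.+ η)
    u[y+η]≥0 = subst (ℚ._≤ u ℚ.* (y ℚ.+ η)) (ℚₚ.*-zeroʳ u)
      (ℚₚ.*-monoˡ-≤-nonNeg u {{nonNegative 0≤u}} 0≤y)

-- Powers and fractions

-- Recursive, so that `ι (suc m)` unfolds to a sum that the ring solver can treat with `ι m` as a
-- variable.
ι : ℕ → ℚ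
ι zero    = 0ℚ
ι (suc m) = 1ℚ ℚ.+ ι m

ι-+ : ∀ m n → ι (m +ⁿ n) ≡ ι m ℚ.+ ι n
ι-+ zero    n = sym (ℚₚ.+-identityˡ (ι n))
ι-+ (suc m) n = trans (cong (1ℚ ℚ.+_) (ι-+ m n)) (sym (ℚₚ.+-assoc 1ℚ (ι m) (ι n)))

0≤ι : ∀ m → 0ℚ ℚ.≤ ι m
0≤ι zero    = ℚₚ.≤-refl
0≤ι (suc m) = ℚₚ.+-mono-≤ {0ℚ} {1ℚ} (ℚₚ.<⇒≤ (ℚₚ.positive⁻¹ 1ℚ)) (0≤ι m)

toℚᵘ-ι : ∀ m → ℚ.toℚᵘ (ι m) ℚᵘ.≃ ℚᵘ.mkℚᵘ (ℤ.+ m) 0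
toℚᵘ-ι zero    = ℚᵘₚ.≃-refl
toℚᵘ-ι (suc m) = ℚᵘₚ.≃-trans (ℚₚ.toℚᵘ-homo-+ 1ℚ (ι m))
  (ℚᵘₚ.≃-trans (ℚᵘₚ.+-congʳ ℚᵘ.1ℚᵘ (toℚᵘ-ι m))
    (ℚᵘ.*≡* (cong (λ z → (ℤ.+ 1 ℤ.+ z) ℤ.* ℤ.+ 1) (ℤₚ.*-identityʳ (ℤ.+ m)))))

1/1+ : ℕ → ℚ
1/1+ d = mkℚ (ℤ.+ 1) d (Coprime.1-coprimeTo (suc d))

ι*1/≡1 : ∀ d → ι (suc d) ℚ.* 1/1+ d ≡ 1ℚ
ι*1/≡1 d = ℚₚ.toℚᵘ-injective (ℚᵘₚ.≃-trans (ℚₚ.toℚᵘ-homo-* (ι (suc d)) (1/1+ d))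
  (ℚᵘₚ.≃-trans (ℚᵘₚ.*-congʳ {ℚ.toℚᵘ (1/1+ d)} (toℚᵘ-ι (suc d)))
    (ℚᵘ.*≡* (trans (ℤₚ.*-identityʳ _) (trans (ℤₚ.*-identityʳ (ℤ.+ suc d))
      (sym (trans (ℤₚ.*-identityˡ _) (cong ℤ.+_ (ℕₚ.+-identityʳ (suc d))))))))))

-- The numerator of a positive p is at least 1, so multiplying by the denominator already reaches 1.
archimedean : ∀ p → 0ℚ ℚ.< p → ∃[ m ] 1ℚ ℚ.≤ ι m ℚ.* p
archimedean p@(mkℚ ℤ.+[1+ n ] d c) _ = suc d , (begin
  1ℚ                      ≡⟨ ι*1/≡1 d ⟨
  ι (suc d) ℚ.* 1/1+ d    ≤⟨ ℚₚ.*-monoˡ-≤-nonNeg (ι (suc d)) {{nonNegative (0≤ι (suc d))}} 1/1+d≤p ⟩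
  ι (suc d) ℚ.* p         ∎)
  where
  open ℚₚ.≤-Reasoning
  1/1+d≤p : 1/1+ d ℚ.≤ p
  1/1+d≤p = *≤* (ℤₚ.*-monoʳ-≤-nonNeg (ℤ.+ suc d) (ℤ.+≤+ (s≤s {n = n} z≤n)))
archimedean (mkℚ (ℤ.+ 0) d c) (ℚ.*<* (ℤ.+<+ ()))
archimedean (mkℚ ℤ.-[1+ n ] d c) (ℚ.*<* ())

infixr 8 _^_
_^_ : ℚ → ℕ → ℚ
q ^ zero  = 1ℚ
q ^ suc m = q ℚ.* q ^ m

module _ (θ : ℚ) (0<θ : 0ℚ ℚ.< θ) (θ≤1 : θ ℚ.≤ 1ℚ) where

  private
    q = 1ℚ ℚ.- θ
    0≤q : 0ℚ ℚ.≤ q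
    0≤q = ≤ℚ-by-difference θ≤1 (solve 1 (λ t → (con 1ℚ :- t) :- con 0ℚ := con 1ℚ :- t) refl θ)
    0≤θ = ℚₚ.<⇒≤ 0<θ

    0≤-* : ∀ {a b} → 0ℚ ℚ.≤ a → 0ℚ ℚ.≤ b → 0ℚ ℚ.≤ a ℚ.* b
    0≤-* {a} {b} 0≤a 0≤b = subst (ℚ._≤ a ℚ.* b) (ℚₚ.*-zeroʳ a) (ℚₚ.*-monoˡ-≤-nonNeg a {{nonNegative 0≤a}} 0≤b)

  0≤^ : ∀ m → 0ℚ ℚ.≤ q ^ m
  0≤^ zero    = ℚₚ.<⇒≤ (ℚₚ.positive⁻¹ 1ℚ)
  0≤^ (suc m) = 0≤-* 0≤q (0≤^ m)

  -- Since (1 - θ)(1 + (m + 1)θ) = 1 + mθ - (m + 1)θ², the product decreases with m. The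
  -- multiplicative form avoids dividing by 1 + mθ.
  bernoulli : ∀ m → q ^ m ℚ.* (1ℚ ℚ.+ ι m ℚ.* θ) ℚ.≤ 1ℚ
  bernoulli zero    = ℚₚ.≤-reflexive (solve 1 (λ t → con 1ℚ :* (con 1ℚ :+ con 0ℚ :* t) := con 1ℚ) refl θ)
  bernoulli (suc m) = ≤ℚ-by-difference (ℚₚ.+-mono-≤ (bernoulli m) (0≤-* (0≤-* 0≤θ 0≤θ) (0≤-* (0≤^ m) (0≤ι (suc m)))))
    (solve 3 (λ t p i → con 1ℚ :- ((con 1ℚ :- t) :* p) :* (con 1ℚ :+ (con 1ℚ :+ i) :* t)
        := (con 1ℚ :+ (t :* t) :* (p :* (con 1ℚ :+ i))) :- (p :* (con 1ℚ :+ i :* t) :+ con 0ℚ)) refl θ (q ^ m) (ι m))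

  ^-tends-to-0 : ∀ ε → 0ℚ ℚ.< ε → ∃[ m ] q ^ m ℚ.≤ ε
  -- From m θ ε ≥ 1 follows (1 + m θ) ε ≥ 1; inserting this factor brings `q ^ m` into the shape of
  -- `bernoulli`.
  ^-tends-to-0 ε 0<ε with archimedean (θ ℚ.* ε) (ℚₚ.positive⁻¹ _ {{ℚₚ.pos*pos⇒pos θ {{positive 0<θ}} ε {{positive 0<ε}}}})
  ... | m , 1≤mθε = m , (begin
    q ^ m                                  ≡⟨ ℚₚ.*-identityʳ (q ^ m) ⟨
    q ^ m ℚ.* 1ℚ                           ≤⟨ ℚₚ.*-monoˡ-≤-nonNeg (q ^ m) {{nonNegative (0≤^ m)}}
                                               (≤ℚ-by-difference (ℚₚ.+-mono-≤ 1≤mθε (ℚₚ.<⇒≤ 0<ε))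
                                                 (solve 3 (λ i t e → (con 1ℚ :+ i :* t) :* e :- con 1ℚ := (i :* (t :* e) :+ e) :- (con 1ℚ :+ con 0ℚ)) refl (ι m) θ ε)) ⟩
    q ^ m ℚ.* ((1ℚ ℚ.+ ι m ℚ.* θ) ℚ.* ε)   ≡⟨ ℚₚ.*-assoc (q ^ m) _ ε ⟨
    q ^ m ℚ.* (1ℚ ℚ.+ ι m ℚ.* θ) ℚ.* ε     ≤⟨ ℚₚ.*-monoʳ-≤-nonNeg ε {{nonNegative (ℚₚ.<⇒≤ 0<ε)}} (bernoulli m) ⟩
    1ℚ ℚ.* ε                               ≡⟨ ℚₚ.*-identityˡ ε ⟩
    ε                                      ∎)
    where open ℚₚ.≤-Reasoning

ι-mono : ∀ {m n} → m ≤ⁿ n → ι m ℚ.≤ ι n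
ι-mono {m} {n} m≤n with ℕₚ.m≤n⇒∃[o]m+o≡n m≤n
... | o , refl = ≤ℚ-by-difference (0≤ι o)
  (trans (cong (λ z → z ℚ.- ι m) (ι-+ m o)) (solve 2 (λ m o → (m :+ o) :- m := o :- con 0ℚ) refl (ι m) (ι o)))

-- The orthomodular poset of a configuration

-- A (3,3)-homogeneous orthomodular poset is given by its atoms and, for each
-- atom, the three pairs of atoms completing it to a block.
record Configuration : Set where
  field
    #points  : ℕ
  Point : Set
  Point = Fin #points
  field
    -- Excludes the empty configuration, in whose poset `𝟙` would be an atom.
    origin   : Point
    pencil   : Point → Fin 3 → Point × Point

  Block : Point → Point → Point → Set
  Block a b c = ∃[ i ] (pencil a i ≡ (b , c) ⊎ pencil a i ≡ (c , b))

  field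
    block-flip   : ∀ {a b c} → Block a b c → Block b a c
    block-irrefl : ∀ {a c} → ¬ Block a a c
    -- Besides triangles this excludes two lines through a and b: taking for c the third point of
    -- the second line, it gives c ≡ x.
    triangle     : ∀ {a b c x y z} → Block a b x → Block b c y → Block a c z → c ≡ x
    -- Makes the three lines through a distinct, so that a lies in exactly three blocks.
    pencil-disjoint : ∀ a i j →
      proj₁ (pencil a i) ≡ proj₁ (pencil a j) ⊎ proj₁ (pencil a i) ≡ proj₂ (pencil a j) → i ≡ j

  block-swap : ∀ {a b c} → Block a b c → Block a c b
  block-swap (i , p) = i , Sum.swap p

  pencil-block : ∀ a i → Block a (proj₁ (pencil a i)) (proj₂ (pencil a i))
  pencil-block a i = i , inj₁ refl

  block-distinct : ∀ {a b c} → Block a b c → a ≢ b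
  block-distinct p refl = block-irrefl p

module Poset (C : Configuration) where
  open Configuration C

  data Element : Set where
    𝟘 𝟙   : Element
    at co : Point → Element

  infix 4 _⊑_
  -- Greechie's pasting of one eight-element Boolean algebra per line: an atom lies below `co b`
  -- exactly when it shares a line with b and differs from b.
  data _⊑_ : Rel Element 0ℓ where
    𝟘⊑    : ∀ {x} → 𝟘 ⊑ x
    ⊑𝟙    : ∀ {x} → x ⊑ 𝟙
    at⊑at : ∀ {a} → at a ⊑ at a
    co⊑co : ∀ {a} → co a ⊑ co a
    at⊑co : ∀ {a b c} → Block a b c → at a ⊑ co b

  infix 8 _^⊥
  _^⊥ : Element → Element
  𝟘    ^⊥ = 𝟙
  𝟙    ^⊥ = 𝟘
  at a ^⊥ = co a
  co a ^⊥ = at a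

  ⊑-refl : ∀ {x} → x ⊑ x
  ⊑-refl {𝟘}    = 𝟘⊑
  ⊑-refl {𝟙}    = ⊑𝟙
  ⊑-refl {at a} = at⊑at
  ⊑-refl {co a} = co⊑co

  ⊑-trans : ∀ {x y z} → x ⊑ y → y ⊑ z → x ⊑ z
  ⊑-trans 𝟘⊑        _         = 𝟘⊑
  ⊑-trans ⊑𝟙        ⊑𝟙        = ⊑𝟙
  ⊑-trans at⊑at     q         = q
  ⊑-trans co⊑co     q         = q
  ⊑-trans (at⊑co p) ⊑𝟙        = ⊑𝟙
  ⊑-trans (at⊑co p) co⊑co     = at⊑co p

  ⊑-antisym : ∀ {x y} → x ⊑ y → y ⊑ x → x ≡ y
  ⊑-antisym 𝟘⊑    𝟘⊑    = refl
  ⊑-antisym ⊑𝟙    ⊑𝟙    = refl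
  ⊑-antisym at⊑at _     = refl
  ⊑-antisym co⊑co _     = refl

  ^⊥-antitone : ∀ x y → x ⊑ y → y ^⊥ ⊑ x ^⊥
  ^⊥-antitone _ _ 𝟘⊑        = ⊑𝟙
  ^⊥-antitone _ _ ⊑𝟙        = 𝟘⊑
  ^⊥-antitone _ _ at⊑at     = co⊑co
  ^⊥-antitone _ _ co⊑co     = at⊑at
  ^⊥-antitone _ _ (at⊑co p) = at⊑co (block-flip p)

  ^⊥-involutive : ∀ x → x ^⊥ ^⊥ ≡ x
  ^⊥-involutive 𝟘      = refl
  ^⊥-involutive 𝟙      = refl
  ^⊥-involutive (at a) = refl
  ^⊥-involutive (co a) = refl

  -- De Morgan for an antitone involution; every meet in the axioms is obtained from an explicit
  -- join.
  join⇒meet : ∀ {x y z} → IsJoin _⊑_ x y z → IsMeet _⊑_ (x ^⊥) (y ^⊥) (z ^⊥)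
  join⇒meet {x} {y} {z} (x⊑z , y⊑z , least) =
    ^⊥-antitone x z x⊑z , ^⊥-antitone y z y⊑z , λ w w⊑x⊥ w⊑y⊥ →
      subst (_⊑ z ^⊥) (^⊥-involutive w) (^⊥-antitone z (w ^⊥) (least (w ^⊥)
        (subst (_⊑ w ^⊥) (^⊥-involutive x) (^⊥-antitone w (x ^⊥) w⊑x⊥))
        (subst (_⊑ w ^⊥) (^⊥-involutive y) (^⊥-antitone w (y ^⊥) w⊑y⊥))))

  join-swap : ∀ {x y z} → IsJoin _⊑_ x y z → IsJoin _⊑_ y x z
  join-swap (x⊑z , y⊑z , least) = y⊑z , x⊑z , λ w y⊑w x⊑w → least w x⊑w y⊑w

  join-unique : ∀ {x y z w} → IsJoin _⊑_ x y z → IsJoin _⊑_ x y w → z ≡ w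
  join-unique (x⊑z , y⊑z , z-least) (x⊑w , y⊑w , w-least) =
    ⊑-antisym (z-least _ x⊑w y⊑w) (w-least _ x⊑z y⊑z)

  join-𝟘 : ∀ y → IsJoin _⊑_ 𝟘 y y
  join-𝟘 y = 𝟘⊑ , ⊑-refl , λ _ _ y⊑w → y⊑w

  join-^⊥ : ∀ x → IsJoin _⊑_ x (x ^⊥) 𝟙
  join-^⊥ x = ⊑𝟙 , ⊑𝟙 , least x
    where
    least : ∀ x w → x ⊑ w → x ^⊥ ⊑ w → 𝟙 ⊑ w
    least 𝟘      _ _         ⊑𝟙        = ⊑𝟙
    least 𝟙      _ ⊑𝟙        _         = ⊑𝟙
    least (at a) _ ⊑𝟙        _         = ⊑𝟙
    least (at a) _ (at⊑co p) co⊑co     = ⊥-elim (block-irrefl p)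
    least (co a) _ ⊑𝟙        _         = ⊑𝟙
    least (co a) _ co⊑co     (at⊑co p) = ⊥-elim (block-irrefl p)

  -- An upper bound of both atoms other than `𝟙` is some `co d` with d collinear with a and with b;
  -- the absence of triangles leaves only d = c.
  join-block : ∀ {a b c} → Block a b c → IsJoin _⊑_ (at a) (at b) (co c)
  join-block {a} {b} {c} p = at⊑co (block-swap p) , at⊑co (block-swap (block-flip p)) , least
    where
    least : ∀ w → at a ⊑ w → at b ⊑ w → co c ⊑ w
    least _ ⊑𝟙        _         = ⊑𝟙
    least _ at⊑at     at⊑at     = ⊥-elim (block-irrefl p)
    least _ (at⊑co q) (at⊑co r) with refl ← triangle p r q = co⊑co

  orthogonal-join : ∀ x y → x ⊑ y ^⊥ → ∃ (IsJoin _⊑_ x y)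
  orthogonal-join 𝟘      y      _               = y , join-𝟘 y
  orthogonal-join x      𝟘      _               = x , join-swap (join-𝟘 x)
  orthogonal-join (at a) (at b) (at⊑co {c = c} p) = co c , join-block p
  orthogonal-join (at a) (co a) at⊑at           = 𝟙 , join-^⊥ (at a)
  orthogonal-join (co a) (at a) co⊑co           = 𝟙 , join-^⊥ (co a)

  orthomodular : ∀ x y → x ⊑ y → ∃[ z ] IsMeet _⊑_ y (x ^⊥) z × IsJoin _⊑_ x z y
  orthomodular 𝟘      y      _     = y , (⊑-refl , ⊑𝟙 , λ _ w⊑y _ → w⊑y) , join-𝟘 y
  orthomodular x      𝟙      _     = x ^⊥ , (⊑𝟙 , ⊑-refl , λ _ _ w⊑x⊥ → w⊑x⊥) , join-^⊥ x
  orthomodular (at a) (at a) at⊑at = 𝟘 , join⇒meet (join-^⊥ (co a)) , join-swap (join-𝟘 (at a))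
  orthomodular (co a) (co a) co⊑co = 𝟘 , join⇒meet (join-^⊥ (at a)) , join-swap (join-𝟘 (co a))
  orthomodular (at a) (co b) (at⊑co {c = c} p) =
    at c , join⇒meet (join-block (block-flip p)) , join-block (block-swap p)

  isOrthomodularPoset : IsOrthomodularPoset _⊑_ _^⊥ 𝟘 𝟙
  isOrthomodularPoset = record
    { isPartialOrder  = record
      { isPreorder = record
        { isEquivalence = isEquivalence ; reflexive = λ { refl → ⊑-refl } ; trans = ⊑-trans }
      ; antisym    = ⊑-antisym
      }
    ; minimum         = λ _ → 𝟘⊑
    ; maximum         = λ _ → ⊑𝟙
    ; ⊥-antitone      = ^⊥-antitone
    ; ⊥-involutive    = ^⊥-involutive
    ; meet-complement = λ x → subst (λ y → IsMeet _⊑_ y (x ^⊥) 𝟘) (^⊥-involutive x)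
                                (join⇒meet (join-swap (join-^⊥ x)))
    ; join-complement = join-^⊥
    ; orthogonal-join = orthogonal-join
    ; orthomodular    = orthomodular
    }

-- Transport of an orthomodular poset along a bijection

module _ {A B : Set} (f : B → A) (g : A → B) (f∘g : ∀ x → f (g x) ≡ x) (g∘f : ∀ y → g (f y) ≡ y)
         {_⊑_ : Rel A 0ℓ} {_^⊥ : A → A} {𝟘 𝟙 : A} where

  private
    _⊑′_ : Rel B 0ℓ
    x ⊑′ y = f x ⊑ f y

  join-pull : ∀ {x y z} → IsJoin _⊑_ (f x) (f y) (f z) → IsJoin _⊑′_ x y z
  join-pull (x⊑z , y⊑z , least) = x⊑z , y⊑z , λ w → least (f w)

  transport : IsOrthomodularPoset _⊑_ _^⊥ 𝟘 𝟙 →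
    IsOrthomodularPoset _⊑′_ (λ x → g (f x ^⊥)) (g 𝟘) (g 𝟙)
  transport omp = record
    { isPartialOrder  = record
      { isPreorder = record
        { isEquivalence = isEquivalence ; reflexive = λ { refl → O.refl′ } ; trans = O.trans′ }
      ; antisym    = λ p q → trans (sym (g∘f _)) (trans (cong g (O.antisym p q)) (g∘f _))
      }
    ; minimum         = λ x → subst (_⊑ f x) (sym (f∘g 𝟘)) (O.minimum (f x))
    ; maximum         = λ x → subst (f x ⊑_) (sym (f∘g 𝟙)) (O.maximum (f x))
    ; ⊥-antitone      = λ x y p → subst₂ _⊑_ (sym (f∘g _)) (sym (f∘g _)) (O.⊥-antitone (f x) (f y) p)
    ; ⊥-involutive    = λ x → trans (cong (λ y → g (y ^⊥)) (f∘g (f x ^⊥)))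
                                (trans (cong g (O.⊥-involutive (f x))) (g∘f x))
    ; meet-complement = λ x → meet (subst₂ (IsMeet _⊑_ (f x)) (sym (f∘g _)) (sym (f∘g _)) (O.meet-complement (f x)))
    ; join-complement = λ x → join-pull (subst₂ (IsJoin _⊑_ (f x)) (sym (f∘g _)) (sym (f∘g _)) (O.join-complement (f x)))
    ; orthogonal-join = λ x y p →
        let z , j = O.orthogonal-join (f x) (f y) (subst (f x ⊑_) (f∘g _) p)
        in g z , join-pull (subst (IsJoin _⊑_ (f x) (f y)) (sym (f∘g z)) j)
    ; orthomodular    = λ x y p →
        let z , m , j = O.orthomodular (f x) (f y) p
        in g z , meet (subst₂ (IsMeet _⊑_ (f y)) (sym (f∘g _)) (sym (f∘g z)) m)
               , join-pull (subst (λ v → IsJoin _⊑_ (f x) v (f y)) (sym (f∘g z)) j)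
    }
    where
    module O where
      open IsOrthomodularPoset omp public
      open IsPartialOrder isPartialOrder public
        using (antisym) renaming (refl to refl′; trans to trans′)
    meet : ∀ {x y z} → IsMeet _⊑_ (f x) (f y) (f z) → IsMeet _⊑′_ x y z
    meet (z⊑x , z⊑y , greatest) = z⊑x , z⊑y , λ w → greatest (f w)

-- Atoms, blocks and homogeneity of the finite poset

∣⁅x⁆∪p∣ : ∀ {n} (x : Fin n) (p : Subset n) → x ∉ˢ p → ∣ ⁅ x ⁆ ∪ p ∣ ≡ suc ∣ p ∣
∣⁅x⁆∪p∣ zero    (outside ∷ p) x∉p = cong (suc ∘ ∣_∣) (Subsetₚ.∪-identityˡ p)
∣⁅x⁆∪p∣ zero    (inside  ∷ p) x∉p = contradiction Vec.here x∉p
∣⁅x⁆∪p∣ (suc x) (outside ∷ p) x∉p = ∣⁅x⁆∪p∣ x p (x∉p ∘ Vec.there)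
∣⁅x⁆∪p∣ (suc x) (inside  ∷ p) x∉p = cong suc (∣⁅x⁆∪p∣ x p (x∉p ∘ Vec.there))

module Logic (C : Configuration) where
  open Configuration C
  private module P = Poset C
  open Poset.Element

  size : ℕ
  size = 2 +ⁿ (#points +ⁿ #points)

  encode : P.Element → Fin size
  encode 𝟘      = zero
  encode 𝟙      = suc zero
  encode (at a) = suc (suc (a ↑ˡ #points))
  encode (co a) = suc (suc (#points ↑ʳ a))

  decode : Fin size → P.Element
  decode zero          = 𝟘
  decode (suc zero)    = 𝟙
  decode (suc (suc i)) = Sum.[ at , co ] (splitAt #points i)

  decode-encode : ∀ x → decode (encode x) ≡ x
  decode-encode 𝟘      = refl
  decode-encode 𝟙      = refl
  decode-encode (at a) = cong Sum.[ at , co ] (Finₚ.splitAt-↑ˡ #points a #points)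
  decode-encode (co a) = cong Sum.[ at , co ] (Finₚ.splitAt-↑ʳ #points #points a)

  encode-decode : ∀ x → encode (decode x) ≡ x
  encode-decode zero          = refl
  encode-decode (suc zero)    = refl
  encode-decode (suc (suc i)) with splitAt #points i in eq
  ... | inj₁ a = cong (λ j → Fin.suc (Fin.suc j)) (Finₚ.splitAt⁻¹-↑ˡ eq)
  ... | inj₂ a = cong (λ j → Fin.suc (Fin.suc j)) (Finₚ.splitAt⁻¹-↑ʳ eq)

  L : FiniteOMP
  L = record
    { size                = size
    ; _⊑_                 = λ x y → decode x P.⊑ decode y
    ; _^⊥                 = λ x → encode (decode x P.^⊥)
    ; 𝟘                   = encode 𝟘
    ; 𝟙                   = encode 𝟙
    ; isOrthomodularPoset = transport decode encode decode-encode encode-decode P.isOrthomodularPoset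
    }

  open FiniteOMP L using (_⊑_; _⟂_; IsAtom; IsOrthogonalSetOfAtoms; IsBlock; IsHomogeneous)

  encode-injective : ∀ {x y} → encode x ≡ encode y → x ≡ y
  encode-injective {x} {y} eq = trans (sym (decode-encode x)) (trans (cong decode eq) (decode-encode y))

  encode-mono : ∀ {x y} → x P.⊑ y → encode x ⊑ encode y
  encode-mono = subst₂ P._⊑_ (sym (decode-encode _)) (sym (decode-encode _))

  ⟂⇒⊑ : ∀ {x y} → x ⟂ y → decode x P.⊑ decode y P.^⊥
  ⟂⇒⊑ = subst (_ P.⊑_) (decode-encode _)

  ⊑⇒⟂ : ∀ {x y} → x P.⊑ y P.^⊥ → encode x ⟂ encode y
  ⊑⇒⟂ {x} {y} p = encode-mono (subst (λ z → x P.⊑ z P.^⊥) (sym (decode-encode y)) p)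

  join-encode : ∀ {x y z} → IsJoin P._⊑_ x y z → IsJoin _⊑_ (encode x) (encode y) (encode z)
  join-encode {x} {y} {z} (x⊑z , y⊑z , least) = encode-mono x⊑z , encode-mono y⊑z , λ w x⊑w y⊑w →
    subst (P._⊑ decode w) (sym (decode-encode z))
      (least (decode w) (subst (P._⊑ decode w) (decode-encode x) x⊑w) (subst (P._⊑ decode w) (decode-encode y) y⊑w))

  join-decode : ∀ {x y z} → IsJoin _⊑_ x y z → IsJoin P._⊑_ (decode x) (decode y) (decode z)
  join-decode (x⊑z , y⊑z , least) = x⊑z , y⊑z , λ w x⊑w y⊑w →
    subst (_ P.⊑_) (decode-encode w) (least (encode w)
      (subst (_ P.⊑_) (sym (decode-encode w)) x⊑w) (subst (_ P.⊑_) (sym (decode-encode w)) y⊑w))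

  atom : Point → Fin size
  atom a = encode (at a)

  atom-injective : ∀ {a b} → atom a ≡ atom b → a ≡ b
  atom-injective {a} {b} eq with refl ← encode-injective {at a} {at b} eq = refl

  atom-isAtom : ∀ a → IsAtom (atom a)
  atom-isAtom a = (λ ()) , λ y y⊑a → below (decode y) (subst (decode y P.⊑_) (decode-encode (at a)) y⊑a) (encode-decode y)
    where
    below : ∀ {y} e → e P.⊑ at a → encode e ≡ y → y ≡ encode 𝟘 ⊎ y ≡ atom a
    below _ P.𝟘⊑    eq = inj₁ (sym eq)
    below _ P.at⊑at eq = inj₂ (sym eq)

  isAtom⇒atom : ∀ x → IsAtom x → ∃[ a ] atom a ≡ x
  isAtom⇒atom x (x≢𝟘 , minimal) = view (decode x) refl
    where
    notAbove : ∀ {e a} → decode x ≡ e → e ≢ at a → ¬ at a P.⊑ e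
    notAbove {e} {a} eq e≢at a⊑e with minimal (atom a) (subst₂ P._⊑_ (sym (decode-encode (at a))) (sym eq) a⊑e)
    ... | inj₁ ()
    ... | inj₂ a≡x = e≢at (trans (sym eq) (trans (cong decode (sym a≡x)) (decode-encode (at a))))
    view : ∀ e → decode x ≡ e → ∃[ a ] atom a ≡ x
    view 𝟘      eq = contradiction (trans (sym (encode-decode x)) (cong encode eq)) x≢𝟘
    view 𝟙      eq = ⊥-elim (notAbove {a = origin} eq (λ ()) P.⊑𝟙)
    view (at a) eq = a , trans (cong encode (sym eq)) (encode-decode x)
    view (co a) eq = ⊥-elim (notAbove eq (λ ()) (P.at⊑co (block-flip (pencil-block a zero))))

  #atoms : HasExactly _≡_ #points IsAtom
  #atoms = atom , atom-injective , atom-isAtom , isAtom⇒atom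

  atom-⟂ : ∀ {a b c} → Block a b c → atom a ⟂ atom b
  atom-⟂ p = ⊑⇒⟂ (P.at⊑co p)

  ⟂⇒block : ∀ {a b} → atom a ⟂ atom b → ∃[ c ] Block a b c
  ⟂⇒block {a} {b} p
    with P.at⊑co {c = c} q ← subst₂ (λ x y → x P.⊑ y P.^⊥) (decode-encode (at a)) (decode-encode (at b)) (⟂⇒⊑ {atom a} {atom b} p)
    = c , q

  triple : Point → Point → Point → Subset size
  triple a b c = ⁅ atom a ⁆ ∪ (⁅ atom b ⁆ ∪ ⁅ atom c ⁆)

  ∈-triple⁺ : ∀ {a b c d} → d ≡ a ⊎ d ≡ b ⊎ d ≡ c → atom d ∈ˢ triple a b c
  ∈-triple⁺ {a} {b} {c} (inj₁ refl) =
    Subsetₚ.p⊆p∪q (⁅ atom b ⁆ ∪ ⁅ atom c ⁆) (Subsetₚ.x∈⁅x⁆ (atom a))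
  ∈-triple⁺ {a} {b} {c} (inj₂ (inj₁ refl)) =
    Subsetₚ.q⊆p∪q ⁅ atom a ⁆ _ (Subsetₚ.p⊆p∪q ⁅ atom c ⁆ (Subsetₚ.x∈⁅x⁆ (atom b)))
  ∈-triple⁺ {a} {b} {c} (inj₂ (inj₂ refl)) =
    Subsetₚ.q⊆p∪q ⁅ atom a ⁆ _ (Subsetₚ.q⊆p∪q ⁅ atom b ⁆ _ (Subsetₚ.x∈⁅x⁆ (atom c)))

  ∈-triple⁻ : ∀ {a b c x} → x ∈ˢ triple a b c → x ≡ atom a ⊎ x ≡ atom b ⊎ x ≡ atom c
  ∈-triple⁻ {a} {b} {c} x∈ = Sum.map (Subsetₚ.x∈⁅y⁆⇒x≡y _)
    (λ x∈′ → Sum.map (Subsetₚ.x∈⁅y⁆⇒x≡y _) (Subsetₚ.x∈⁅y⁆⇒x≡y _) (Subsetₚ.x∈p∪q⁻ ⁅ atom b ⁆ ⁅ atom c ⁆ x∈′))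
    (Subsetₚ.x∈p∪q⁻ ⁅ atom a ⁆ (⁅ atom b ⁆ ∪ ⁅ atom c ⁆) x∈)

  atom∈-triple⁻ : ∀ {a b c d} → atom d ∈ˢ triple a b c → d ≡ a ⊎ d ≡ b ⊎ d ≡ c
  atom∈-triple⁻ d∈ = Sum.map atom-injective (Sum.map atom-injective atom-injective) (∈-triple⁻ d∈)

  triple-orthogonal : ∀ {a b c} → Block a b c → IsOrthogonalSetOfAtoms (triple a b c)
  triple-orthogonal {a} {b} {c} p = isAtom , orthogonal
    where
    isAtom : ∀ x → x ∈ˢ triple a b c → IsAtom x
    isAtom x x∈ with ∈-triple⁻ {a} x∈
    ... | inj₁ refl        = atom-isAtom a
    ... | inj₂ (inj₁ refl) = atom-isAtom b
    ... | inj₂ (inj₂ refl) = atom-isAtom c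
    orthogonal : ∀ x y → x ∈ˢ triple a b c → y ∈ˢ triple a b c → x ≢ y → x ⟂ y
    orthogonal x y x∈ y∈ x≢y with ∈-triple⁻ {a} x∈ | ∈-triple⁻ {a} y∈
    ... | inj₁ refl        | inj₁ refl        = contradiction refl x≢y
    ... | inj₁ refl        | inj₂ (inj₁ refl) = atom-⟂ p
    ... | inj₁ refl        | inj₂ (inj₂ refl) = atom-⟂ (block-swap p)
    ... | inj₂ (inj₁ refl) | inj₁ refl        = atom-⟂ (block-flip p)
    ... | inj₂ (inj₁ refl) | inj₂ (inj₁ refl) = contradiction refl x≢y
    ... | inj₂ (inj₁ refl) | inj₂ (inj₂ refl) = atom-⟂ (block-swap (block-flip p))
    ... | inj₂ (inj₂ refl) | inj₁ refl        = atom-⟂ (block-flip (block-swap p))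
    ... | inj₂ (inj₂ refl) | inj₂ (inj₁ refl) = atom-⟂ (block-flip (block-swap (block-flip p)))
    ... | inj₂ (inj₂ refl) | inj₂ (inj₂ refl) = contradiction refl x≢y

  -- A further atom of B is collinear with both a and b, hence by `triangle` it is the third point
  -- c. Both the maximality of triples and the classification of blocks rest on this.
  orthogonal⊆triple : ∀ {a b c B} → Block a b c → IsOrthogonalSetOfAtoms B → atom a ∈ˢ B → atom b ∈ˢ B →
    B ⊆ˢ triple a b c
  orthogonal⊆triple {a} {b} {c} {B} p (isAtom , orthogonal) a∈B b∈B {x} x∈B
    with isAtom⇒atom x (isAtom x x∈B)
  ... | d , refl with d Finₚ.≟ a | d Finₚ.≟ b
  ... | yes d≡a | _ = ∈-triple⁺ (inj₁ d≡a)
  ... | no  _   | yes d≡b = ∈-triple⁺ (inj₂ (inj₁ d≡b))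
  ... | no  d≢a | no d≢b = ∈-triple⁺ (inj₂ (inj₂
    (triangle p (proj₂ (⟂⇒block (orthogonal (atom b) (atom d) b∈B x∈B (d≢b ∘ sym ∘ atom-injective))))
                (proj₂ (⟂⇒block (orthogonal (atom a) (atom d) a∈B x∈B (d≢a ∘ sym ∘ atom-injective)))))))

  triple-isBlock : ∀ {a b c} → Block a b c → IsBlock (triple a b c)
  triple-isBlock p = triple-orthogonal p , λ C orth B⊆C → Subsetₚ.⊆-antisym B⊆C
    (orthogonal⊆triple p orth (B⊆C (∈-triple⁺ (inj₁ refl))) (B⊆C (∈-triple⁺ (inj₂ (inj₁ refl)))))

  isBlock⇒triple : ∀ {a B} → IsBlock B → atom a ∈ˢ B → ∃[ b ] ∃[ c ] Block a b c × B ≡ triple a b c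
  isBlock⇒triple {a} {B} ((isAtom , orthogonal) , maximal) a∈B
    with Finₚ.any? (λ x → (x Subsetₚ.∈? B) ×-dec ¬? (x Finₚ.≟ atom a))
  ... | yes (x , x∈B , x≢a) with isAtom⇒atom x (isAtom x x∈B)
  ...   | b , refl with ⟂⇒block (orthogonal (atom a) (atom b) a∈B x∈B (x≢a ∘ sym))
  ...     | c , p = b , c , p , maximal (triple a b c) (triple-orthogonal p)
                                  (orthogonal⊆triple p (isAtom , orthogonal) a∈B x∈B)
  -- If a were the only member, B would be contained in every triple through a; maximality equates
  -- it with one of them, so no contradiction has to be extracted.
  isBlock⇒triple {a} {B} ((isAtom , orthogonal) , maximal) a∈B | no noOther =
    let p = pencil-block a zero
    in _ , _ , p , maximal (triple a _ _) (triple-orthogonal p) only-a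
    where
    only-a : B ⊆ˢ triple a _ _
    only-a {x} x∈B with x Finₚ.≟ atom a
    ... | yes refl = ∈-triple⁺ (inj₁ refl)
    ... | no  x≢a  = contradiction (x , x∈B , x≢a) noOther

  triple-swap : ∀ a b c → triple a b c ≡ triple a c b
  triple-swap a b c = cong (⁅ atom a ⁆ ∪_) (Subsetₚ.∪-comm ⁅ atom b ⁆ ⁅ atom c ⁆)

  pencilBlock : Point → Fin 3 → Subset size
  pencilBlock a i = triple a (proj₁ (pencil a i)) (proj₂ (pencil a i))

  pencilBlock-injective : ∀ a {i j} → pencilBlock a i ≡ pencilBlock a j → i ≡ j
  pencilBlock-injective a {i} {j} eq
    with atom∈-triple⁻ {a} (subst (atom (proj₁ (pencil a i)) ∈ˢ_) eq (∈-triple⁺ (inj₂ (inj₁ refl))))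
  ... | inj₁ b≡a = contradiction (sym b≡a) (block-distinct (pencil-block a i))
  ... | inj₂ b∈  = pencil-disjoint a i j b∈

  #blocks : ∀ x → IsAtom x → HasExactly _≡_ 3 (λ B → IsBlock B × x ∈ˢ B)
  #blocks x x-isAtom with isAtom⇒atom x x-isAtom
  ... | a , refl = pencilBlock a , pencilBlock-injective a
    , (λ i → triple-isBlock (pencil-block a i) , ∈-triple⁺ (inj₁ refl))
    , λ B (isBlock , a∈B) → onPencil (isBlock⇒triple isBlock a∈B)
    where
    onPencil : ∀ {B} → ∃[ b ] ∃[ c ] Block a b c × B ≡ triple a b c → ∃[ i ] pencilBlock a i ≡ B
    onPencil (b , c , (i , inj₁ eq) , refl) = i , cong (λ (b , c) → triple a b c) eq
    onPencil (b , c , (i , inj₂ eq) , refl) = i , trans (cong (λ (b , c) → triple a b c) eq) (triple-swap a c b)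

  ∣triple∣ : ∀ {a b c} → Block a b c → ∣ triple a b c ∣ ≡ 3
  ∣triple∣ {a} {b} {c} p = trans (∣⁅x⁆∪p∣ (atom a) _ a∉) (cong suc
    (trans (∣⁅x⁆∪p∣ (atom b) _ b∉) (cong suc (Subsetₚ.∣⁅x⁆∣≡1 (atom c)))))
    where
    b∉ : atom b ∉ˢ ⁅ atom c ⁆
    b∉ b∈ = block-distinct (block-swap (block-flip p)) (atom-injective (Subsetₚ.x∈⁅y⁆⇒x≡y _ b∈))
    a∉ : atom a ∉ˢ ⁅ atom b ⁆ ∪ ⁅ atom c ⁆
    a∉ a∈ with Subsetₚ.x∈p∪q⁻ ⁅ atom b ⁆ ⁅ atom c ⁆ a∈
    ... | inj₁ a∈b = block-distinct p (atom-injective (Subsetₚ.x∈⁅y⁆⇒x≡y _ a∈b))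
    ... | inj₂ a∈c = block-distinct (block-swap p) (atom-injective (Subsetₚ.x∈⁅y⁆⇒x≡y _ a∈c))

  block-size : ∀ B → IsBlock B → ∣ B ∣ ≡ 3
  block-size B isBlock@((isAtom , _) , maximal) with Subsetₚ.nonempty? B
  ... | yes (x , x∈B) with isAtom⇒atom x (isAtom x x∈B)
  ...   | a , refl with isBlock⇒triple isBlock x∈B
  ...     | b , c , p , refl = ∣triple∣ p
  -- The empty set lies in the triple through `origin`, and maximality again equates the two.
  block-size B isBlock@(_ , maximal) | no empty =
    let p = pencil-block origin zero
    in trans (cong ∣_∣ (maximal _ (triple-orthogonal p) (λ x∈B → contradiction (_ , x∈B) empty))) (∣triple∣ p)

  isHomogeneous : IsHomogeneous 3 3
  isHomogeneous = #blocks , block-size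

-- States and weights

module States (C : Configuration) where
  open Configuration C
  open Logic C
  open FiniteOMP L using (IsState; IsPureState)
  open Poset C using (𝟘; 𝟙; at; co; at⊑at; co⊑co; at⊑co; 𝟘⊑)
  private module P = Poset C

  -- Abstract, since Agda's positivity analysis of a record type with these
  -- fields gets lost in the definition of _+_ on Cauchy sequences.
  abstract
    IsWeight : (Point → ℝ) → Set
    IsWeight w = (∀ a → 0ℝ ≲ w a) × (∀ a b c → Block a b c → w a + w b + w c ≋ 1ℝ)

    weight : ∀ {w} → (∀ a → 0ℝ ≲ w a) → (∀ a b c → Block a b c → w a + w b + w c ≋ 1ℝ) → IsWeight w
    weight = _,_

    0≲ : ∀ {w} → IsWeight w → ∀ a → 0ℝ ≲ w a
    0≲ = proj₁

    block-sum : ∀ {w} → IsWeight w → ∀ {a b c} → Block a b c → w a + w b + w c ≋ 1ℝ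
    block-sum isWeight = proj₂ isWeight _ _ _

  ≲1 : ∀ {w} → IsWeight w → ∀ a → w a ≲ 1ℝ
  ≲1 {w} isWeight a =
    let p = pencil-block a zero ; b , c = pencil a zero
    in ≲-by-difference (+-mono-≲ (≋⇒≲ (block-sum isWeight p)) (+-mono-≲ (0≲ isWeight b) (0≲ isWeight c))) (λ n →
         solve 3 (λ a b c → con 1ℚ :- a := (con 1ℚ :+ (b :+ c)) :- ((a :+ b :+ c) :+ (con 0ℚ :+ con 0ℚ))) refl
           (seq (w a) n) (seq (w b) n) (seq (w c) n))

  extendᴱ : (Point → ℝ) → P.Element → ℝ
  extendᴱ w 𝟘      = 0ℝ
  extendᴱ w 𝟙      = 1ℝ
  extendᴱ w (at a) = w a
  extendᴱ w (co a) = 1ℝ - w a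

  extend : (Point → ℝ) → Fin size → ℝ
  extend w x = extendᴱ w (decode x)

  extend-atom : ∀ w a → extend w (atom a) ≡ w a
  extend-atom w a = cong (extendᴱ w) (decode-encode (at a))

  module _ {w : Point → ℝ} (isWeight : IsWeight w) where
    private
      nonneg : ∀ e → 0ℝ ≲ extendᴱ w e
      nonneg 𝟘      = ≲-refl
      nonneg 𝟙      = fromℚ-mono-≲ (ℚₚ.<⇒≤ (ℚₚ.positive⁻¹ 1ℚ))
      nonneg (at a) = 0≲ isWeight a
      nonneg (co a) = ≲-by-difference (≲1 isWeight a) (λ n →
        solve 1 (λ x → (con 1ℚ :- x) :- con 0ℚ := con 1ℚ :- x) refl (seq (w a) n))

      bounded : ∀ e → extendᴱ w e ≲ 1ℝ
      bounded 𝟘      = nonneg 𝟙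
      bounded 𝟙      = ≲-refl
      bounded (at a) = ≲1 isWeight a
      bounded (co a) = ≲-by-difference (0≲ isWeight a) (λ n →
        solve 1 (λ x → con 1ℚ :- (con 1ℚ :- x) := x :- con 0ℚ) refl (seq (w a) n))

      -- Returning the join along with its value leaves a case distinction on orthogonal pairs only;
      -- `join-unique` later identifies it with whichever join is given.
      additive : ∀ e f → e P.⊑ f P.^⊥ → ∃[ g ] IsJoin P._⊑_ e f g × extendᴱ w g ≋ extendᴱ w e + extendᴱ w f
      additive 𝟘 f _ = f , P.join-𝟘 f , ≋-pointwise (λ n → sym (ℚₚ.+-identityˡ (seq (extendᴱ w f) n)))
      additive e 𝟘 _ = e , P.join-swap (P.join-𝟘 e) , ≋-pointwise (λ n → sym (ℚₚ.+-identityʳ (seq (extendᴱ w e) n)))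
      additive (at a) (at b) (at⊑co {c = c} p) = co c , P.join-block p ,
        ≋-by-difference (≋-sym (block-sum isWeight p)) (λ n →
          solve 3 (λ a b c → (a :+ b) :- (con 1ℚ :- c) := (a :+ b :+ c) :- con 1ℚ) refl
            (seq (w a) n) (seq (w b) n) (seq (w c) n))
      additive (at a) (co a) at⊑at = 𝟙 , P.join-^⊥ (at a) ,
        ≋-pointwise (λ n → solve 1 (λ a → con 1ℚ := a :+ (con 1ℚ :- a)) refl (seq (w a) n))
      additive (co a) (at a) co⊑co = 𝟙 , P.join-^⊥ (co a) ,
        ≋-pointwise (λ n → solve 1 (λ a → con 1ℚ := (con 1ℚ :- a) :+ a) refl (seq (w a) n))

    extend-isState : IsState (extend w)
    extend-isState = record
      { nonneg   = λ x → unwrap (nonneg (decode x))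
      ; ≤1       = λ x → unwrap (bounded (decode x))
      ; unit     = ≋⇒≈ (≋-refl {1ℝ})
      ; additive = λ x y z x⟂y j →
          let g , join , eq = additive (decode x) (decode y) (⟂⇒⊑ {x} {y} x⟂y)
          in ≋⇒≈ (subst (λ h → extendᴱ w h ≋ extend w x + extend w y) (P.join-unique join (join-decode {x} {y} {z} j)) eq)
      }

  module _ {s : Fin size → ℝ} (isState : IsState s) where
    open IsState isState

    private
      additive′ : ∀ {e f g} → e P.⊑ f P.^⊥ → IsJoin P._⊑_ e f g →
        s (encode g) ≋ s (encode e) + s (encode f)
      additive′ e⟂f j = ≈⇒≋ (additive _ _ _ (⊑⇒⟂ e⟂f) (join-encode j))

      s-co : ∀ a → s (encode (co a)) ≋ 1ℝ - s (atom a)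
      s-co a = ≋-by-difference
        (≋-trans (≋-sym (additive′ (at⊑at {a}) (P.join-^⊥ (at a)))) (≈⇒≋ {y = 1ℝ} unit))
        (λ n → solve 2 (λ x y → (con 1ℚ :- x) :- y := con 1ℚ :- (x :+ y)) refl (seq (s (atom a)) n) (seq (s (encode (co a))) n))

    restrict-isWeight : IsWeight (s ∘ atom)
    restrict-isWeight = weight
      (λ a → wrap (nonneg (atom a)))
      (λ a b c p → ≋-by-difference
          (≋-trans (≋-sym (additive′ (at⊑co p) (P.join-block p))) (s-co c))
          (λ n → solve 3 (λ a b c → con 1ℚ :- (a :+ b :+ c) := (con 1ℚ :- c) :- (a :+ b)) refl
             (seq (s (atom a)) n) (seq (s (atom b)) n) (seq (s (atom c)) n)))

    state≋extend : ∀ x → s x ≋ extend (s ∘ atom) x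
    state≋extend x = subst (λ y → s y ≋ extend (s ∘ atom) x) (encode-decode x) (onElement (decode x))
      where
      onElement : ∀ e → s (encode e) ≋ extendᴱ (s ∘ atom) e
      -- Additivity at 𝟘 ∨ 𝟘 = 𝟘 says s 𝟘 = s 𝟘 + s 𝟘.
      onElement 𝟘 = ≋-by-difference (≋-sym (additive′ 𝟘⊑ (P.join-𝟘 𝟘)))
        (λ n → solve 1 (λ x → con 0ℚ :- x := x :- (x :+ x)) refl (seq (s (encode 𝟘)) n))
      onElement 𝟙      = ≈⇒≋ unit
      onElement (at a) = ≋-refl
      onElement (co a) = s-co a

  extend-cong : ∀ {v w} → (∀ a → v a ≋ w a) → ∀ x → extend v x ≋ extend w x
  extend-cong {v} {w} v≋w x = onElement (decode x)
    where
    onElement : ∀ e → extendᴱ v e ≋ extendᴱ w e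
    onElement 𝟘      = ≋-refl
    onElement 𝟙      = ≋-refl
    onElement (at a) = v≋w a
    onElement (co a) = ≋-by-difference (≋-sym (v≋w a))
      (λ n → solve 2 (λ x y → (con 1ℚ :- y) :- (con 1ℚ :- x) := x :- y) refl (seq (v a) n) (seq (w a) n))

  -- The listed vertices as exactly the pure states

  module Vertices (θ : ℚ) (0<θ : 0ℚ ℚ.< θ) (θ<1 : θ ℚ.< 1ℚ)
    {k : ℕ} (v : Fin k → Point → ℚ)
    (v-isWeight : ∀ i → IsWeight (fromℚ ∘ v i))
    (dominated : ∀ w → IsWeight w → ∃[ i ] (∀ a → v i a ≡ 0ℚ ⊎ fromℚ θ ≲ w a))
    (antichain : ∀ i j → i ≢ j → ∃[ a ] v i a ≡ 0ℚ × v j a ≢ 0ℚ)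
    where

    private
      q = 1ℚ ℚ.- θ

      0<q : 0ℚ ℚ.< q
      0<q = subst (ℚ._< q) (ℚₚ.+-inverseʳ θ) (ℚₚ.+-monoˡ-< (ℚ.- θ) θ<1)

      q-positive : Positive q
      q-positive = positive 0<q

      -- Sealed so that the inverse stays a symbol, known through its positivity and `1/q*q`.
      abstract
        1/q : ℚ
        1/q = (ℚ.1/ q) {{ℚₚ.pos⇒nonZero q {{q-positive}}}}

        1/q-positive : Positive 1/q
        1/q-positive = ℚₚ.1/pos⇒pos q {{q-positive}}

        1/q*q : 1/q ℚ.* q ≡ 1ℚ
        1/q*q = ℚₚ.*-inverseˡ q {{ℚₚ.pos⇒nonZero q {{q-positive}}}}

      q/q : ∀ z → q ℚ.* (1/q ℚ.* z) ≡ z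
      q/q z = trans (sym (ℚₚ.*-assoc q 1/q z)) (trans (cong (ℚ._* z) (trans (ℚₚ.*-comm q 1/q) 1/q*q)) (ℚₚ.*-identityˡ z))

    state : Fin k → Fin size → ℝ
    state i = extend (fromℚ ∘ v i)

    -- The solution s' of w = θ v + (1 - θ) s'.
    peel : Fin k → (Point → ℝ) → Point → ℝ
    peel i w a = fromℚ 1/q * (w a - fromℚ (θ ℚ.* v i a))

    peel-identity : ∀ i w a n → seq (w a) n ≡ θ ℚ.* v i a ℚ.+ q ℚ.* seq (peel i w a) n
    peel-identity i w a n = sym (trans (cong (θ ℚ.* v i a ℚ.+_) (q/q _))
      (solve 2 (λ t w → t :+ (w :- t) := w) refl (θ ℚ.* v i a) (seq (w a) n)))

    peel-sum : ∀ x₁ x₂ x₃ y₁ y₂ y₃ → x₁ + x₂ + x₃ ≋ 1ℝ → fromℚ y₁ + fromℚ y₂ + fromℚ y₃ ≋ 1ℝ →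
      fromℚ 1/q * (x₁ - fromℚ (θ ℚ.* y₁)) + fromℚ 1/q * (x₂ - fromℚ (θ ℚ.* y₂)) + fromℚ 1/q * (x₃ - fromℚ (θ ℚ.* y₃)) ≋ 1ℝ
    peel-sum x₁ x₂ x₃ y₁ y₂ y₃ x-sum y-sum =
      ≋-trans factored (≋-trans (*-congˡ 1/q {{1/q-positive}} (x-sum′ - fromℚ θ * y-sum′) (fromℚ q) remainder) last)
      where
      x-sum′ = x₁ + x₂ + x₃
      y-sum′ = fromℚ y₁ + fromℚ y₂ + fromℚ y₃
      last : fromℚ 1/q * fromℚ q ≋ 1ℝ
      last = ≋-pointwise λ n → 1/q*q
      factored : fromℚ 1/q * (x₁ - fromℚ (θ ℚ.* y₁)) + fromℚ 1/q * (x₂ - fromℚ (θ ℚ.* y₂)) + fromℚ 1/q * (x₃ - fromℚ (θ ℚ.* y₃))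
        ≋ fromℚ 1/q * (x-sum′ - fromℚ θ * y-sum′)
      factored = ≋-pointwise λ n → solve 8 (λ q w₁ w₂ w₃ t v₁ v₂ v₃ →
        q :* (w₁ :- t :* v₁) :+ q :* (w₂ :- t :* v₂) :+ q :* (w₃ :- t :* v₃)
        := q :* ((w₁ :+ w₂ :+ w₃) :- t :* (v₁ :+ v₂ :+ v₃))) refl
        1/q (seq x₁ n) (seq x₂ n) (seq x₃ n) θ y₁ y₂ y₃
      remainder : x-sum′ - fromℚ θ * y-sum′ ≋ fromℚ q
      remainder = ≋-by-difference
        (+-cong x-sum (≋-sym (*-congˡ θ {{positive 0<θ}} y-sum′ 1ℝ y-sum)))
        λ n → solve 3 (λ w t v →
          (con 1ℚ :- t) :- (w :- t :* v) := (con 1ℚ :+ t :* v) :- (w :+ t :* con 1ℚ)) refl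
          (seq x-sum′ n) θ (y₁ ℚ.+ y₂ ℚ.+ y₃)

    module _ {i w} (isWeight : IsWeight w) (w-dominates : ∀ a → v i a ≡ 0ℚ ⊎ fromℚ θ ≲ w a) where
      private
        -- Off the support of v the subtracted term is 0. On the support θ v ≤ θ ≤ w, because v ≤ 1;
        -- so a constant lower bound there is enough.
        0≲w-θv : ∀ a → 0ℝ ≲ w a - fromℚ (θ ℚ.* v i a)
        0≲w-θv a with w-dominates a
        ... | inj₁ v≡0 = ≲-trans (0≲ isWeight a) (≋⇒≲ (≋-pointwise λ n →
                trans (sym (ℚₚ.+-identityʳ _)) (cong (λ z → seq (w a) n ℚ.- z)
                  (sym (trans (cong (θ ℚ.*_) v≡0) (ℚₚ.*-zeroʳ θ))))))
        ... | inj₂ θ≲w = ≲-by-difference (≲-trans (*-monoˡ-≲ θ {{positive 0<θ}} (fromℚ (v i a)) 1ℝ (≲1 (v-isWeight i) a))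
                (≲-trans {y = fromℚ θ} (≋⇒≲ (≋-pointwise λ _ → ℚₚ.*-identityʳ θ)) θ≲w))
                (λ n → solve 2 (λ x y → (x :- y) :- con 0ℚ := x :- y) refl (seq (w a) n) (θ ℚ.* v i a))

      peel-isWeight : IsWeight (peel i w)
      peel-isWeight = weight
        (λ a → ≲-trans {y = fromℚ 1/q * 0ℝ} (≋⇒≲ (≋-pointwise λ _ → sym (ℚₚ.*-zeroʳ 1/q)))
          (*-monoˡ-≲ 1/q {{1/q-positive}} 0ℝ (w a - fromℚ (θ ℚ.* v i a)) (0≲w-θv a)))
        (λ a b c p → peel-sum (w a) (w b) (w c) (v i a) (v i b) (v i c)
          (block-sum isWeight p) (block-sum (v-isWeight i) p))

    VanishesOff : Fin k → (Point → ℝ) → Set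
    VanishesOff i w = ∀ a → v i a ≡ 0ℚ → w a ≲ 0ℝ

    -- If the dominated vertex were some other j, then at the point supplied by `antichain` w would
    -- be at most 0 and at least θ.
    on-face : ∀ {i w} → IsWeight w → VanishesOff i w → ∀ a → v i a ≡ 0ℚ ⊎ fromℚ θ ≲ w a
    on-face {i} {w} isWeight vanishes with dominated w isWeight
    ... | j , w-dominates with i Finₚ.≟ j
    ...   | yes refl = w-dominates
    ...   | no  i≢j  with antichain i j i≢j
    ...     | a , vᵢ≡0 , vⱼ≢0 with w-dominates a
    ...       | inj₁ vⱼ≡0 = contradiction vⱼ≡0 vⱼ≢0
    ...       | inj₂ θ≲w  = contradiction (ℚₚ.<-≤-trans 0<θ (fromℚ-cancel-≲ (≲-trans θ≲w (vanishes a vᵢ≡0)))) (ℚₚ.<-irrefl refl)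

    peel-vanishes : ∀ {i w} → VanishesOff i w → VanishesOff i (peel i w)
    peel-vanishes {i} {w} vanishes a v≡0 = ≲-trans {y = fromℚ 1/q * 0ℝ}
      (*-monoˡ-≲ 1/q {{1/q-positive}} (w a - fromℚ (θ ℚ.* v i a)) 0ℝ (≲-trans {y = w a} (≋⇒≲ (≋-pointwise λ n →
        trans (cong (λ z → seq (w a) n ℚ.- z) (trans (cong (θ ℚ.*_) v≡0) (ℚₚ.*-zeroʳ θ))) (ℚₚ.+-identityʳ _))) (vanishes a v≡0)))
      (≋⇒≲ (≋-pointwise λ _ → ℚₚ.*-zeroʳ 1/q))

    -- Peeling shrinks the defect of a weight on the face of v i by the factor q.
    defect : ∀ i m {w} → IsWeight w → VanishesOff i w → ∀ a → fromℚ (v i a) ≲ w a + fromℚ (q ^ m)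
    defect i zero {w} isWeight vanishes a =
      ≲-by-difference (+-mono-≲ (≲1 (v-isWeight i) a) (0≲ isWeight a)) (λ n →
        solve 2 (λ v w → (w :+ con 1ℚ) :- v := (con 1ℚ :+ w) :- (v :+ con 0ℚ)) refl (v i a) (seq (w a) n))
    defect i (suc m) {w} isWeight vanishes a =
      -- v = θ v + q v, and the induction hypothesis for the peeled weight bounds q v; adding θ v
      -- back reassembles w.
      ≲-by-difference
        (*-monoˡ-≲ q {{q-positive}} (fromℚ (v i a)) (peel i w a + fromℚ (q ^ m))
          (defect i m (peel-isWeight isWeight (on-face isWeight vanishes)) (peel-vanishes vanishes) a))
        (λ n → trans
          (cong (λ z → (z ℚ.+ q ℚ.* q ^ m) ℚ.- v i a) (peel-identity i w a n))
          (solve 4 (λ t v p x → (t :* v :+ (con 1ℚ :- t) :* x) :+ (con 1ℚ :- t) :* p :- v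
            := (con 1ℚ :- t) :* (x :+ p) :- (con 1ℚ :- t) :* v) refl θ (v i a) (q ^ m) (seq (peel i w a) n)))

    -- The lower bound at all points already forces equality: on a line through a both weights sum
    -- to 1, so the lower bounds at the other two points become an upper bound at a.
    face-trivial : ∀ i {w} → IsWeight w → VanishesOff i w → ∀ a → w a ≋ fromℚ (v i a)
    face-trivial i {w} isWeight vanishes a = ≲-antisym w≲v (v≲w a)
      where
      v≲w : ∀ a → fromℚ (v i a) ≲ w a
      v≲w a = ≲-limit λ ε 0<ε →
        let m , small = ^-tends-to-0 θ 0<θ (ℚₚ.<⇒≤ θ<1) ε 0<ε
        in ≲-trans (defect i m isWeight vanishes a)
             (+-mono-≲ {w a} {w a} {fromℚ (q ^ m)} {fromℚ ε} ≲-refl (fromℚ-mono-≲ small))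
      w≲v : w a ≲ fromℚ (v i a)
      w≲v =
        let p = pencil-block a zero ; b , c = pencil a zero
        in ≲-by-difference
             (+-mono-≲ (+-mono-≲ (v≲w b) (v≲w c))
               (+-mono-≲ (≋⇒≲ (block-sum isWeight p)) (≋⇒≳ (block-sum (v-isWeight i) p))))
             (λ n → solve 6 (λ w₁ w₂ w₃ v₁ v₂ v₃ → v₁ :- w₁
               := (w₂ :+ w₃ :+ (con 1ℚ :+ (v₁ :+ v₂ :+ v₃))) :- (v₂ :+ v₃ :+ (w₁ :+ w₂ :+ w₃ :+ con 1ℚ))) refl
               (seq (w a) n) (seq (w b) n) (seq (w c) n) (v i a) (v i b) (v i c))

    state-isState : ∀ i → IsState (state i)
    state-isState i = extend-isState (v-isWeight i)

    on-face-of-state : ∀ i {s} → IsState s → VanishesOff i (s ∘ atom) → s ≐ state i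
    on-face-of-state i isState vanishes x = ≋⇒≈ (≋-trans (state≋extend isState x)
      (extend-cong (face-trivial i (restrict-isWeight isState) vanishes) x))

    -- Where `v i` vanishes, two nonnegative terms add up to 0, so s₁ vanishes there too and lies on
    -- the face. Having both coefficients as parameters lets the same argument treat s₂ after
    -- exchanging the summands.
    convex-state : ∀ i {s₁ s₂} (t u : ℝ) → IsState s₁ → IsState s₂ → 0ℝ < t → 0ℝ < u →
      (∀ n → seq t n ℚ.+ seq u n ≡ 1ℚ) → (∀ x → t * s₁ x + u * s₂ x ≋ state i x) → s₁ ≐ state i
    convex-state i {s₁} {s₂} t u isState₁ isState₂ 0<t 0<u t+u≡1 eq =
      on-face-of-state i isState₁ λ a v≡0 →
        convex-vanish {t} {u} {s₁ (atom a)} {s₂ (atom a)} 0<t 0<u t+u≡1 (wrap (IsState.nonneg isState₂ (atom a)))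
          (≲-trans {y = state i (atom a)} (≋⇒≲ (eq (atom a)))
            (≋⇒≲ (subst (_≋ 0ℝ) (sym (extend-atom (fromℚ ∘ v i) a)) (≋-pointwise λ _ → v≡0))))

    state-isPure : ∀ i → IsPureState (state i)
    state-isPure i = state-isState i , extreme
      where
      extreme : ∀ s₁ s₂ t → IsState s₁ → IsState s₂ → 0ℝ < t → t < 1ℝ →
        state i ≐ (λ x → t * s₁ x + (1ℝ - t) * s₂ x) → s₁ ≐ state i × s₂ ≐ state i
      extreme s₁ s₂ t isState₁ isState₂ 0<t (δ , 0<δ , t+δ≤1) eq =
        convex-state i t (1ℝ - t) isState₁ isState₂ 0<t 0<1-t
          (λ n → solve 1 (λ t → t :+ (con 1ℚ :- t) := con 1ℚ) refl (seq t n))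
          eq′ ,
        convex-state i (1ℝ - t) t isState₂ isState₁ 0<1-t 0<t
          (λ n → solve 1 (λ t → (con 1ℚ :- t) :+ t := con 1ℚ) refl (seq t n))
          (λ x → ≋-trans {y = t * s₁ x + (1ℝ - t) * s₂ x}
            (≋-pointwise λ n → ℚₚ.+-comm (seq ((1ℝ - t) * s₂ x) n) (seq (t * s₁ x) n)) (eq′ x))
        where
        0<1-t : 0ℝ < 1ℝ - t
        0<1-t = δ , 0<δ , eventually
          (λ n h → ≤ℚ-by-difference h
            (solve 2 (λ t e → (con 1ℚ :- t) :- (con 0ℚ :+ e) := con 1ℚ :- (t :+ e)) refl (seq t n) δ))
          t+δ≤1
        eq′ : ∀ x → t * s₁ x + (1ℝ - t) * s₂ x ≋ state i x
        eq′ x = ≋-sym (≈⇒≋ {state i x} {t * s₁ x + (1ℝ - t) * s₂ x} (eq x))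

    peel-decomposition : ∀ i w x →
      extend w x ≋ fromℚ θ * state i x + (1ℝ - fromℚ θ) * extend (peel i w) x
    -- Without the final step, conversion checking would compare Cauchy proofs.
    peel-decomposition i w x = ≋-trans (onElement (decode x)) (≋-pointwise λ _ → refl)
      where
      onElement : ∀ e → extendᴱ w e ≋ fromℚ θ * extendᴱ (fromℚ ∘ v i) e + (1ℝ - fromℚ θ) * extendᴱ (peel i w) e
      onElement 𝟘      = ≋-pointwise λ n → solve 1 (λ t → con 0ℚ := t :* con 0ℚ :+ (con 1ℚ :- t) :* con 0ℚ) refl θ
      onElement 𝟙      = ≋-pointwise λ n → solve 1 (λ t → con 1ℚ := t :* con 1ℚ :+ (con 1ℚ :- t) :* con 1ℚ) refl θ
      onElement (at a) = ≋-pointwise λ n → peel-identity i w a n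
      onElement (co a) = ≋-pointwise λ n → trans (cong (ℚ._-_ 1ℚ) (peel-identity i w a n))
        (solve 3 (λ t v x → con 1ℚ :- (t :* v :+ (con 1ℚ :- t) :* x)
          := t :* (con 1ℚ :- v) :+ (con 1ℚ :- t) :* (con 1ℚ :- x)) refl θ (v i a) (seq (peel i w a) n))

    θ<1ℝ : 0ℝ < fromℚ θ × fromℚ θ < 1ℝ
    θ<1ℝ = (θ , 0<θ , 0 , λ _ _ → ℚₚ.≤-reflexive (ℚₚ.+-identityˡ θ))
         , (q , 0<q , 0 , λ _ _ → ℚₚ.≤-reflexive (solve 1 (λ t → t :+ (con 1ℚ :- t) := con 1ℚ) refl θ))

    pure-dominating : ∀ i s → IsPureState s → (∀ a → v i a ≡ 0ℚ ⊎ fromℚ θ ≲ s (atom a)) → state i ≐ s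
    pure-dominating i s (isState , extreme) s-dominates =
      proj₁ (extreme (state i) rest (fromℚ θ) (state-isState i) rest-isState (proj₁ θ<1ℝ) (proj₂ θ<1ℝ) eq)
      where
      rest : Fin size → ℝ
      rest = extend (peel i (s ∘ atom))
      rest-isState : IsState rest
      rest-isState = extend-isState {peel i (s ∘ atom)} (peel-isWeight {i} {s ∘ atom} (restrict-isWeight isState) s-dominates)
      eq : s ≐ (λ x → fromℚ θ * state i x + (1ℝ - fromℚ θ) * rest x)
      eq x = ≋⇒≈ (≋-trans (state≋extend isState x) (peel-decomposition i (s ∘ atom) x))

    pure⇒state : ∀ s → IsPureState s → ∃[ i ] state i ≐ s
    pure⇒state s isPure =
      let i , s-dominates = dominated (s ∘ atom) (restrict-isWeight (proj₁ isPure))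
      in i , pure-dominating i s isPure s-dominates

    state-injective : ∀ {i j} → state i ≐ state j → i ≡ j
    state-injective {i} {j} eq with i Finₚ.≟ j
    ... | yes i≡j = i≡j
    ... | no  i≢j with antichain i j i≢j
    ...   | a , vᵢ≡0 , vⱼ≢0 = contradiction (trans (sym vᵢ≡vⱼ) vᵢ≡0) vⱼ≢0
      where
      vᵢ≋vⱼ : fromℚ (v i a) ≋ fromℚ (v j a)
      vᵢ≋vⱼ = subst₂ _≋_ (extend-atom (fromℚ ∘ v i) a) (extend-atom (fromℚ ∘ v j) a) (≈⇒≋ (eq (atom a)))
      vᵢ≡vⱼ : v i a ≡ v j a
      vᵢ≡vⱼ = ℚₚ.≤-antisym (fromℚ-cancel-≲ (≋⇒≲ vᵢ≋vⱼ)) (fromℚ-cancel-≲ (≋⇒≳ vᵢ≋vⱼ))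

    #pureStates : HasExactly _≐_ k IsPureState
    #pureStates = state , (λ {i} {j} → state-injective {i} {j}) , state-isPure , pure⇒state

-- Checking a presentation

module Incidence {m : ℕ} (table : Vec (Vec (Fin (suc m) × Fin (suc m)) 3) (suc m)) where

  private
    Point = Fin (suc m)

  pencil : Point → Fin 3 → Point × Point
  pencil a i = Vec.lookup (Vec.lookup table a) i

  Block : Point → Point → Point → Set
  Block a b c = ∃[ i ] (pencil a i ≡ (b , c) ⊎ pencil a i ≡ (c , b))

  block? : ∀ a b c → Dec (Block a b c)
  block? a b c = Finₚ.any? λ i → (pencil a i ≟ (b , c)) ⊎-dec (pencil a i ≟ (c , b))
    where _≟_ = ≡-dec Finₚ._≟_ Finₚ._≟_

  orient : Fin 2 → Point × Point → Point × Point
  orient zero    p = p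
  orient (suc _) p = swap p

  -- Each point has six ordered pairs (b, c) with `Block a b c`. Quantifying over these instead of
  -- over all points keeps the triangle test at 6³ cases per point.
  side : Point → Fin 3 → Fin 2 → Point × Point
  side a i s = orient s (pencil a i)

  block⇒side : ∀ {a b c} → Block a b c → ∃[ i ] ∃[ s ] side a i s ≡ (b , c)
  block⇒side (i , inj₁ eq) = i , zero , eq
  block⇒side (i , inj₂ eq) = i , suc zero , cong swap eq

  Symmetric : Set
  Symmetric = ∀ a i s → a ≢ proj₁ (side a i s) × Block (proj₁ (side a i s)) a (proj₂ (side a i s))

  TriangleFree : Set
  TriangleFree = ∀ a i s j t k u →
    proj₁ (side (proj₁ (side a i s)) j t) ≡ proj₁ (side a k u) → proj₁ (side a k u) ≡ proj₂ (side a i s)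

  Disjoint : Set
  Disjoint = ∀ a i j s → proj₁ (pencil a i) ≡ proj₁ (side a j s) → i ≡ j

  IsConfiguration : Set
  IsConfiguration = Symmetric × TriangleFree × Disjoint

  isConfiguration? : Dec IsConfiguration
  isConfiguration? =
    (all? λ a → all? λ i → all? λ s →
      ¬? (a ≟ proj₁ (side a i s)) ×-dec block? (proj₁ (side a i s)) a (proj₂ (side a i s)))
    ×-dec
    (all? λ a → all? λ i → all? λ s → all? λ j → all? λ t → all? λ k → all? λ u →
      (proj₁ (side (proj₁ (side a i s)) j t) ≟ proj₁ (side a k u)) →-dec
      (proj₁ (side a k u) ≟ proj₂ (side a i s)))
    ×-dec
    (all? λ a → all? λ i → all? λ j → all? λ s →
      (proj₁ (pencil a i) ≟ proj₁ (side a j s)) →-dec (i ≟ j))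
    where open Finₚ using (all?; _≟_)

  configuration : IsConfiguration → Configuration
  configuration (symmetric , triangleFree , disjoint) = record
    { #points         = suc m
    ; origin          = zero
    ; pencil          = pencil
    ; block-flip      = flip
    ; block-irrefl    = irrefl
    ; triangle        = triangle
    ; pencil-disjoint = λ where
        a i j (inj₁ eq) → disjoint a i j zero eq
        a i j (inj₂ eq) → disjoint a i j (suc zero) eq
    }
    where
    flip : ∀ {a b c} → Block a b c → Block b a c
    flip {a} p with block⇒side p
    ... | i , s , eq = subst (λ (b , c) → Block b a c) eq (proj₂ (symmetric a i s))
    irrefl : ∀ {a c} → ¬ Block a a c
    irrefl {a} p with block⇒side p
    ... | i , s , eq = proj₁ (symmetric a i s) (cong proj₁ (sym eq))
    triangle : ∀ {a b c x y z} → Block a b x → Block b c y → Block a c z → c ≡ x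
    triangle {a} {b} {c} p q r with block⇒side p | block⇒side q | block⇒side r
    ... | i , s , refl | j , t , q≡ | k , u , r≡ =
      trans (sym (cong proj₁ r≡))
        (triangleFree a i s j t k u (trans (cong proj₁ q≡) (sym (cong proj₁ r≡))))

-- Transversals of the supports

module Transversals (excesses : List (List ℕ)) where

  _∈ᵇ_ : ℕ → List ℕ → Bool
  a ∈ᵇ Z = any (a ≡ᵇ_) Z

  -- Tests (sufficiently) that each set containing Z and meeting all of Ss includes
  -- an excess.
  transversalsCovered : List ℕ → List (List ℕ) → Bool
  transversalsCovered Z []       = any (all (_∈ᵇ Z)) excesses
  transversalsCovered Z (S ∷ Ss) =
    if any (_∈ᵇ S) Z then transversalsCovered Z Ss else all (λ a → transversalsCovered (a ∷ Z) Ss) S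

  ∈ᵇ⇒∈ : ∀ {a Z} → T (a ∈ᵇ Z) → a ∈ Z
  ∈ᵇ⇒∈ {a} {Z} t = Any.map (ℕₚ.≡ᵇ⇒≡ a _) (Anyₚ.any⁻ (a ≡ᵇ_) Z t)

  module _ {Big Small : ℕ → Set} (decide : ∀ a → Big a ⊎ Small a) where

    -- The Boolean search is replayed along the answers of `decide`: either all of S is big, or a
    -- small point of S joins Z and selects the branch. A set S that Z already meets contains a
    -- known small point and is skipped. At the end all of Z is small, and the passed test places an
    -- excess inside Z.
    big-or-small : ∀ Z Ss → T (transversalsCovered Z Ss) → All Small Z →
      Any (All Big) Ss ⊎ Any (All Small) excesses
    big-or-small Z [] t small = inj₂ (Any.map
      (λ {P} P⊆Z → All.map (λ a∈Z → All.lookup small (∈ᵇ⇒∈ a∈Z)) (Allₚ.all⁺ (_∈ᵇ Z) P P⊆Z))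
      (Anyₚ.any⁻ (all (_∈ᵇ Z)) excesses t))
    big-or-small Z (S ∷ Ss) t small with any (_∈ᵇ S) Z
    ... | true  = Sum.map₁ there (big-or-small Z Ss t small)
    ... | false = choose (All.decide decide S)
      where
      choose : All Big S ⊎ Any Small S → Any (All Big) (S ∷ Ss) ⊎ Any (All Small) excesses
      choose (inj₁ big) = inj₁ (here big)
      choose (inj₂ some) =
        let a , a∈S , small-a = find some
        in Sum.map₁ there (big-or-small (a ∷ Z) Ss
             (All.lookup (Allₚ.all⁺ (λ a → transversalsCovered (a ∷ Z) Ss) S t) a∈S) (small-a ∷ small))

-- Multiset differences and weighted sums

module Bags {A : Set} (_≟_ : DecidableEquality A) where

  remove : A → List A → List A
  remove y []       = []
  remove y (x ∷ xs) = if does (x ≟ y) then xs else x ∷ remove y xs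

  -- Truncated multiset difference: a surplus in the second list disappears, so only points with a
  -- positive net coefficient survive in an excess.
  infixl 6 _∖_
  _∖_ : List A → List A → List A
  xs ∖ []       = xs
  xs ∖ (y ∷ ys) = remove y xs ∖ ys

module Sums {A : Set} (_≟_ : DecidableEquality A) (w : A → ℝ) (0≲w : ∀ a → 0ℝ ≲ w a) where
  open Bags _≟_

  ∑ : List A → ℝ
  ∑ []       = 0ℝ
  ∑ (a ∷ as) = w a + ∑ as

  -- An equality if y occurs in xs; otherwise nothing is removed and w y ≥ 0 is a harmless surplus.
  -- Nonnegativity thus pays for the truncation in `_∖_`.
  ∑-remove : ∀ y xs → ∑ xs ≲ w y + ∑ (remove y xs)
  ∑-remove y [] = ≲-by-difference {0ℝ} {w y} (0≲w y) λ n →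
    solve 1 (λ y → (y :+ con 0ℚ) :- con 0ℚ := y :- con 0ℚ) refl (seq (w y) n)
  ∑-remove y (x ∷ xs) = byCases (x ≟ y)
    where
    byCases : (d : Dec (x ≡ y)) → ∑ (x ∷ xs) ≲ w y + ∑ (if does d then xs else x ∷ remove y xs)
    byCases (yes refl) = ≋⇒≲ (≋-pointwise λ _ → refl)
    byCases (no  _)    = ≲-by-difference {∑ xs} {w y + ∑ (remove y xs)} (∑-remove y xs) λ n →
      solve 4 (λ x y s r → (y :+ (x :+ r)) :- (x :+ s) := (y :+ r) :- s) refl
        (seq (w x) n) (seq (w y) n) (seq (∑ xs) n) (seq (∑ (remove y xs)) n)

  ∑-∖ : ∀ xs ys → ∑ xs ≲ ∑ ys + ∑ (xs ∖ ys)
  ∑-∖ xs []       = ≋⇒≲ (≋-pointwise λ n → sym (ℚₚ.+-identityˡ _))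
  ∑-∖ xs (y ∷ ys) = ≲-by-difference
    {∑ xs + ∑ (remove y xs)} {(w y + ∑ (remove y xs)) + (∑ ys + ∑ (remove y xs ∖ ys))}
    (+-mono-≲ {∑ xs} {w y + ∑ (remove y xs)} {∑ (remove y xs)} {∑ ys + ∑ (remove y xs ∖ ys)}
      (∑-remove y xs) (∑-∖ (remove y xs) ys))
    λ n → solve 5 (λ x y r s d → ((y :+ s) :+ d) :- x := ((y :+ r) :+ (s :+ d)) :- (x :+ r)) refl
      (seq (∑ xs) n) (seq (w y) n) (seq (∑ (remove y xs)) n) (seq (∑ ys) n) (seq (∑ (remove y xs ∖ ys)) n)

  ∑-small : ∀ {δ} xs → All (λ a → w a ≲ fromℚ δ) xs → ∑ xs ≲ fromℚ (ι (length xs) ℚ.* δ)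
  ∑-small {δ} [] [] = ≋⇒≲ (≋-pointwise λ _ → sym (ℚₚ.*-zeroˡ δ))
  ∑-small {δ} (x ∷ xs) (p ∷ ps) = ≲-by-difference
    {w x + ∑ xs} {fromℚ δ + fromℚ (ι (length xs) ℚ.* δ)}
    (+-mono-≲ {w x} {fromℚ δ} {∑ xs} {fromℚ (ι (length xs) ℚ.* δ)} p (∑-small xs ps))
    λ n → solve 4 (λ x s d i → (con 1ℚ :+ i) :* d :- (x :+ s) := (d :+ i :* d) :- (x :+ s)) refl
      (seq (w x) n) (seq (∑ xs) n) δ (ι (length xs))

-- What matters is 300 * 3θ < 1, where 300 bounds the excess of a certificate.
θ : ℚ
θ = 1/1+ 999

3θ : ℚ
3θ = θ ℚ.+ θ ℚ.+ θ

-- Three points on each line and three lines through each point give equally many points and lines,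
-- so one length `suc m` serves for both.
record Presentation : Set where
  field
    m k          : ℕ
    lines        : Vec (ℕ × ℕ × ℕ) (suc m)
    -- the denominator minus 1 and the numerators of the weights of the points
    vertices     : Vec (ℕ × Vec ℕ (suc m)) k
    -- line indices with positive and with negative coefficients, with multiplicity
    certificates : List (List ℕ × List ℕ)

module Presented (D : Presentation) where
  open Presentation D

  private
    Point = Fin (suc m)

  -- Reading raw numbers modulo `suc m` is total and spares range proofs. Line indices are read the
  -- same way, there being as many lines as points.
  point : ℕ → Point
  point j = j mod suc m

  line : Point → Point × Point × Point
  line j = let a , b , c = Vec.lookup lines j in point a , point b , point c

  others : Point → Point × Point × Point → Maybe (Point × Point)
  others a (x , y , z) =
    if does (a Finₚ.≟ x) then just (y , z) else
    if does (a Finₚ.≟ y) then just (x , z) else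
    if does (a Finₚ.≟ z) then just (x , y) else nothing

  first3 : {A : Set} → A → List A → Vec A 3
  first3 d []              = d ∷ d ∷ d ∷ []
  first3 d (x ∷ [])        = x ∷ d ∷ d ∷ []
  first3 d (x ∷ y ∷ [])    = x ∷ y ∷ d ∷ []
  first3 d (x ∷ y ∷ z ∷ _) = x ∷ y ∷ z ∷ []

  -- A point on fewer than three lines gets the padding (a , a), which violates
  -- Incidence.Symmetric.
  table : Vec (Vec (Point × Point) 3) (suc m)
  table = Vec.tabulate λ a → first3 (a , a) (mapMaybe (others a ∘ line) (allFin (suc m)))

  open Incidence table using (pencil; block?; IsConfiguration; isConfiguration?)

  numerator : Fin k → Point → ℕ
  numerator i a = Vec.lookup (proj₂ (Vec.lookup vertices i)) a

  denominator-1 : Fin k → ℕ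
  denominator-1 i = proj₁ (Vec.lookup vertices i)

  points : List ℕ → List ℕ
  points []       = []
  points (j ∷ js) = let a , b , c = Vec.lookup lines (point j) in a ∷ b ∷ c ∷ points js

  open Bags ℕₚ._≟_

  excess : List ℕ × List ℕ → List ℕ
  excess (ps , ns) = points ps ∖ points ns

  excesses : List (List ℕ)
  excesses = map excess certificates

  nonzero? : ∀ i a → Dec (numerator i (point a) ≢ 0)
  nonzero? i a = ¬? (numerator i (point a) ℕₚ.≟ 0)

  support : Fin k → List ℕ
  support i = filter (nonzero? i) (upTo (suc m))

  supports : List (List ℕ)
  supports = map support (allFin k)

  open Transversals excesses

  -- Makes `block-sum` apply to each listed line, so that a certificate may count every line as 1.
  LinesAreBlocks : Set
  LinesAreBlocks = ∀ j → let a , b , c = line j in Incidence.Block table a b c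

  VerticesAreWeights : Set
  VerticesAreWeights = ∀ i a j → let b , c = pencil a j in
    numerator i a +ⁿ numerator i b +ⁿ numerator i c ≡ suc (denominator-1 i)

  SupportsFormAntichain : Set
  SupportsFormAntichain = ∀ i j → i ≢ j → ∃[ a ] numerator i a ≡ 0 × numerator j a ≢ 0

  -- The sum of a weight over ps exceeds the sum over ns by at least 1, so its sum
  -- over the excess is at least 1 as well.
  IsCertificate : List ℕ × List ℕ → Set
  IsCertificate c@(ps , ns) = length ns <ⁿ length ps × length (excess c) ≤ⁿ 300

  Valid : Set
  Valid = suc m ≤ⁿ 19 × IsConfiguration × LinesAreBlocks × VerticesAreWeights
    × SupportsFormAntichain × All IsCertificate certificates × T (transversalsCovered [] supports)

  valid? : Dec Valid
  valid? =
    (suc m ℕₚ.≤? 19)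
    ×-dec isConfiguration?
    ×-dec (Finₚ.all? λ j → let a , b , c = line j in block? a b c)
    ×-dec (Finₚ.all? λ i → Finₚ.all? λ a → Finₚ.all? λ j → let b , c = pencil a j in
      numerator i a +ⁿ numerator i b +ⁿ numerator i c ℕₚ.≟ suc (denominator-1 i))
    ×-dec (Finₚ.all? λ i → Finₚ.all? λ j → ¬? (i Finₚ.≟ j) →-dec
      Finₚ.any? λ a → (numerator i a ℕₚ.≟ 0) ×-dec ¬? (numerator j a ℕₚ.≟ 0))
    ×-dec All.all? (λ (ps , ns) → (length ns ℕₚ.<? length ps) ×-dec (length (excess (ps , ns)) ℕₚ.≤? 300)) certificates
    ×-dec T? (transversalsCovered [] supports)

  module _
    (isConfiguration : IsConfiguration)
    (linesAreBlocks : LinesAreBlocks)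
    (verticesAreWeights : VerticesAreWeights)
    (supportsFormAntichain : SupportsFormAntichain)
    (certified : All IsCertificate certificates)
    (covered : T (transversalsCovered [] supports))
    where

    C : Configuration
    C = Incidence.configuration table isConfiguration

    open Configuration C using (Block)
    open Logic C
    open States C

    point-toℕ : ∀ a → point (toℕ a) ≡ a
    point-toℕ a = Finₚ.toℕ-injective (trans (Finₚ.toℕ-fromℕ< _) (m<n⇒m%n≡m (Finₚ.toℕ<n a)))

    v : Fin k → Fin (suc m) → ℚ
    v i a = ι (numerator i a) ℚ.* 1/1+ (denominator-1 i)

    numerator-sum : ∀ i {a b c} → Block a b c →
      numerator i a +ⁿ numerator i b +ⁿ numerator i c ≡ suc (denominator-1 i)
    numerator-sum i {a} (j , inj₁ eq) = subst
      (λ (b , c) → numerator i a +ⁿ numerator i b +ⁿ numerator i c ≡ suc (denominator-1 i)) eq (verticesAreWeights i a j)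
    numerator-sum i {a} {b} {c} (j , inj₂ eq) = trans
      (trans (ℕₚ.+-assoc (numerator i a) _ _) (trans (cong (numerator i a +ⁿ_) (ℕₚ.+-comm (numerator i b) _))
        (sym (ℕₚ.+-assoc (numerator i a) _ _))))
      (numerator-sum i {a} {c} {b} (j , inj₁ eq))

    v-sum : ∀ i {a b c} → Block a b c → v i a ℚ.+ v i b ℚ.+ v i c ≡ 1ℚ
    v-sum i {a} {b} {c} p = trans
      (solve 4 (λ x y z d → x :* d :+ y :* d :+ z :* d := (x :+ y :+ z) :* d) refl
        (ι (numerator i a)) (ι (numerator i b)) (ι (numerator i c)) (1/1+ (denominator-1 i)))
      (trans (cong (ℚ._* 1/1+ (denominator-1 i))
        (trans (cong (ℚ._+ ι (numerator i c)) (sym (ι-+ (numerator i a) (numerator i b))))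
          (trans (sym (ι-+ (numerator i a +ⁿ numerator i b) (numerator i c))) (cong ι (numerator-sum i p)))))
        (ι*1/≡1 (denominator-1 i)))

    0≤v : ∀ i a → 0ℚ ℚ.≤ v i a
    0≤v i a = subst (ℚ._≤ v i a) (ℚₚ.*-zeroˡ (1/1+ (denominator-1 i)))
      (ℚₚ.*-monoʳ-≤-nonNeg (1/1+ (denominator-1 i)) (0≤ι (numerator i a)))

    v-isWeight : ∀ i → IsWeight (fromℚ ∘ v i)
    v-isWeight i = weight (λ a → fromℚ-mono-≲ (0≤v i a)) (λ a b c p → ≋-pointwise λ _ → v-sum i p)

    v≡0 : ∀ i a → numerator i a ≡ 0 → v i a ≡ 0ℚ
    v≡0 i a eq = trans (cong (λ z → ι z ℚ.* 1/1+ (denominator-1 i)) eq) (ℚₚ.*-zeroˡ (1/1+ (denominator-1 i)))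

    v≢0 : ∀ i a → numerator i a ≢ 0 → v i a ≢ 0ℚ
    v≢0 i a ne = positive-≢0 (numerator i a) ne
      where
      positive-≢0 : ∀ p → p ≢ 0 → ι p ℚ.* 1/1+ (denominator-1 i) ≢ 0ℚ
      positive-≢0 zero    ne eq = contradiction refl ne
      positive-≢0 (suc p) ne eq = ℚₚ.<-irrefl (sym eq) (ℚₚ.positive⁻¹ _
        {{ℚₚ.pos*pos⇒pos (ι (suc p)) {{ℚₚ.pos+nonNeg⇒pos 1ℚ (ι p) {{nonNegative (0≤ι p)}}}} (1/1+ (denominator-1 i))}})

    v-antichain : ∀ i j → i ≢ j → ∃[ a ] v i a ≡ 0ℚ × v j a ≢ 0ℚ
    v-antichain i j i≢j =
      let a , i≡0 , j≢0 = supportsFormAntichain i j i≢j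
      in a , v≡0 i a i≡0 , v≢0 j a j≢0

    -- Every weight dominates a listed vertex

    module _ (w : Fin (suc m) → ℝ) (isWeight : IsWeight w) where
      open Sums ℕₚ._≟_ (w ∘ point) (0≲ isWeight ∘ point)

      ∑-points : ∀ js → ∑ (points js) ≋ fromℚ (ι (length js))
      ∑-points []       = ≋-pointwise λ _ → refl
      ∑-points (j ∷ js) =
        let a , b , c = line (point j)
        in ≋-by-difference {w a + w b + w c + ∑ (points js)} {1ℝ + fromℚ (ι (length js))}
             (+-cong {w a + w b + w c} {1ℝ} {∑ (points js)} {fromℚ (ι (length js))}
               (block-sum isWeight (linesAreBlocks (point j))) (∑-points js))
             λ n → solve 5 (λ a b c s l → (con 1ℚ :+ l) :- (a :+ (b :+ (c :+ s))) := (con 1ℚ :+ l) :- (a :+ b :+ c :+ s)) refl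
               (seq (w a) n) (seq (w b) n) (seq (w c) n) (seq (∑ (points js)) n) (ι (length js))

      -- With e the length of the excess, the number of positive lines is at most the number of
      -- negative lines plus e · 3θ. The former being larger by at least 1, this gives 1 ≤ e · 3θ ≤
      -- 300 · 3/1000, which is absurd.
      excess-not-small : ∀ c → IsCertificate c → ¬ All (λ a → w (point a) ≲ fromℚ 3θ) (excess c)
      excess-not-small (ps , ns) (ns<ps , e≤300) small = ℚₚ.<-irrefl refl (ℚₚ.≤-<-trans 1≤e*3θ
        (ℚₚ.≤-<-trans (ℚₚ.*-monoʳ-≤-nonNeg 3θ (ι-mono e≤300)) (from-yes (ι 300 ℚ.* 3θ ℚₚ.<? 1ℚ))))
        where
        e : ℕ
        e = length (points ps ∖ points ns)
        bound : fromℚ (ι (length ps)) ≲ fromℚ (ι (length ns) ℚ.+ ι e ℚ.* 3θ)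
        bound = ≲-trans {y = ∑ (points ps)} (≋⇒≳ (∑-points ps))
          (≲-trans {y = ∑ (points ns) + ∑ (points ps ∖ points ns)} (∑-∖ (points ps) (points ns))
            (≲-by-difference {∑ (points ns) + ∑ (points ps ∖ points ns)} {fromℚ (ι (length ns)) + fromℚ (ι e ℚ.* 3θ)}
              (+-mono-≲ {∑ (points ns)} {fromℚ (ι (length ns))} {∑ (points ps ∖ points ns)} {fromℚ (ι e ℚ.* 3θ)}
                (≋⇒≲ (∑-points ns)) (∑-small (points ps ∖ points ns) small))
              λ _ → refl))
        1≤e*3θ : 1ℚ ℚ.≤ ι e ℚ.* 3θ
        1≤e*3θ = ≤ℚ-by-difference (ℚₚ.≤-trans (ι-mono ns<ps) (fromℚ-cancel-≲ bound))
          (solve 2 (λ l x → x :- con 1ℚ := (l :+ x) :- (con 1ℚ :+ l)) refl (ι (length ns)) (ι e ℚ.* 3θ))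

      Big Small : ℕ → Set
      Big a   = fromℚ θ ≲ w (point a)
      Small a = w (point a) ≲ fromℚ 3θ

      -- Comparison with 2θ up to tolerance θ yields the bounds θ and 3θ; this is the origin of 3θ.
      big⊎small : ∀ a → Big a ⊎ Small a
      big⊎small a = Sum.map₁ (≲-trans (fromℚ-mono-≲ (ℚₚ.≤-reflexive refl)))
        (≲-or-≳ (θ ℚ.+ θ) θ (ℚₚ.positive⁻¹ θ) (w (point a)))

      no-small-excess : ¬ Any (All Small) excesses
      no-small-excess c = Allₚ.All¬⇒¬Any {P = All Small ∘ excess}
        (All.map {P = IsCertificate} (λ {c} → excess-not-small c) certified) (Anyₚ.map⁻ c)

      big-support : Any (All Big) supports ⊎ Any (All Small) excesses → ∃[ i ] All Big (support i)
      big-support (inj₁ big) = Any.satisfied (Anyₚ.map⁻ big)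
      big-support (inj₂ c)   = contradiction c no-small-excess

      dominated : ∃[ i ] (∀ a → v i a ≡ 0ℚ ⊎ fromℚ θ ≲ w a)
      dominated = i , λ a → byNumerator a (numerator i a ℕₚ.≟ 0)
        where
        found = big-support (big-or-small {Big} {Small} big⊎small [] supports covered [])
        i     = proj₁ found
        byNumerator : ∀ a → Dec (numerator i a ≡ 0) → v i a ≡ 0ℚ ⊎ fromℚ θ ≲ w a
        byNumerator a (yes ≡0) = inj₁ (v≡0 i a ≡0)
        byNumerator a (no  ≢0) = inj₂ (subst (λ b → fromℚ θ ≲ w b) (point-toℕ a)
          (All.lookup (proj₂ found) (∈-filter⁺ (nonzero? i) (∈-upTo⁺ (Finₚ.toℕ<n a))
            (subst (λ b → numerator i b ≢ 0) (sym (point-toℕ a)) ≢0))))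

    realised : suc m ≤ⁿ 19 → Σ[ L ∈ FiniteOMP ]
      ( FiniteOMP.IsHomogeneous L 3 3
      × (∃[ n ] (n ≤ⁿ 19 × HasExactly _≡_ n (FiniteOMP.IsAtom L)))
      × HasExactly _≐_ k (FiniteOMP.IsPureState L) )
    realised n≤19 = L , isHomogeneous , (suc m , n≤19 , #atoms)
      , Vertices.#pureStates θ (ℚₚ.positive⁻¹ θ) (from-yes (θ ℚₚ.<? 1ℚ)) v v-isWeight dominated v-antichain

realisation : ∀ D → Presented.Valid D → Σ[ L ∈ FiniteOMP ]
  ( FiniteOMP.IsHomogeneous L 3 3
  × (∃[ n ] (n ≤ⁿ 19 × HasExactly _≡_ n (FiniteOMP.IsAtom L)))
  × HasExactly _≐_ (Presentation.k D) (FiniteOMP.IsPureState L) )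
realisation D (n≤19 , isConfiguration , linesAreBlocks , verticesAreWeights , antichain , certified , covered) =
  Presented.realised D isConfiguration linesAreBlocks verticesAreWeights antichain certified covered n≤19

-- The configurations, with a certificate for each minimal transversal of the
-- supports of the vertices

presentation1 : Presentation
presentation1 = record
  { m = 18
  ; k = 1
  ; lines =
      (0 , 1 , 2) ∷ (0 , 3 , 4) ∷ (0 , 5 , 6) ∷ (1 , 7 , 8) ∷ (1 , 9 , 10) ∷ (2 , 11 , 12) ∷
      (2 , 13 , 14) ∷ (3 , 8 , 18) ∷ (3 , 9 , 13) ∷ (4 , 7 , 17) ∷ (4 , 10 , 15) ∷ (5 , 9 , 12) ∷
      (5 , 14 , 15) ∷ (6 , 11 , 17) ∷ (6 , 13 , 16) ∷ (7 , 12 , 16) ∷ (8 , 11 , 15) ∷ (10 , 16 , 18) ∷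
      (14 , 17 , 18) ∷ []
  -- The constant 1/3 is a weight on every configuration of three-point lines, so a unique state
  -- must be this one. Its support is everything, so the minimal transversals are the 19 single
  -- points, with one certificate each.
  ; vertices =
      (2 , 1 ∷ 1 ∷ 1 ∷ 1 ∷ 1 ∷ 1 ∷ 1 ∷ 1 ∷ 1 ∷ 1 ∷ 1 ∷ 1 ∷ 1 ∷ 1 ∷ 1 ∷ 1 ∷ 1 ∷ 1 ∷ 1 ∷ []) ∷
      []
  ; certificates =
      (1 ∷ 2 ∷ 2 ∷ 2 ∷ 8 ∷ 15 ∷ 16 ∷ 16 ∷ 18 ∷ 18 ∷ [] , 7 ∷ 7 ∷ 9 ∷ 11 ∷ 12 ∷ 12 ∷ 13 ∷ 13 ∷ 14 ∷ []) ∷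
      (0 ∷ 1 ∷ 3 ∷ 3 ∷ 3 ∷ 5 ∷ 5 ∷ 12 ∷ 12 ∷ 14 ∷ 14 ∷ 18 ∷ [] , 2 ∷ 2 ∷ 6 ∷ 6 ∷ 6 ∷ 7 ∷ 9 ∷ 15 ∷ 15 ∷ 16 ∷ 16 ∷ []) ∷
      (0 ∷ 0 ∷ 4 ∷ 4 ∷ 6 ∷ 6 ∷ 7 ∷ 7 ∷ 7 ∷ 7 ∷ 9 ∷ 9 ∷ 9 ∷ 12 ∷ 15 ∷ [] , 1 ∷ 1 ∷ 3 ∷ 3 ∷ 3 ∷ 3 ∷ 8 ∷ 8 ∷ 10 ∷ 11 ∷ 17 ∷ 18 ∷ 18 ∷ 18 ∷ []) ∷
      (1 ∷ 7 ∷ 7 ∷ 8 ∷ 12 ∷ 12 ∷ 13 ∷ 13 ∷ 15 ∷ [] , 2 ∷ 9 ∷ 11 ∷ 14 ∷ 16 ∷ 16 ∷ 18 ∷ 18 ∷ []) ∷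
      (1 ∷ 1 ∷ 1 ∷ 4 ∷ 4 ∷ 5 ∷ 5 ∷ 5 ∷ 9 ∷ 9 ∷ 9 ∷ 12 ∷ 14 ∷ 14 ∷ 14 ∷ 14 ∷ [] , 0 ∷ 0 ∷ 2 ∷ 6 ∷ 8 ∷ 8 ∷ 8 ∷ 10 ∷ 13 ∷ 13 ∷ 13 ∷ 15 ∷ 15 ∷ 15 ∷ 17 ∷ []) ∷
      (1 ∷ 3 ∷ 3 ∷ 3 ∷ 11 ∷ 11 ∷ 11 ∷ 12 ∷ 12 ∷ 12 ∷ 13 ∷ 13 ∷ 17 ∷ 17 ∷ 17 ∷ 17 ∷ [] , 2 ∷ 4 ∷ 4 ∷ 4 ∷ 7 ∷ 10 ∷ 14 ∷ 15 ∷ 15 ∷ 15 ∷ 16 ∷ 16 ∷ 18 ∷ 18 ∷ 18 ∷ []) ∷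
      (2 ∷ 2 ∷ 2 ∷ 2 ∷ 4 ∷ 4 ∷ 5 ∷ 5 ∷ 5 ∷ 5 ∷ 7 ∷ 7 ∷ 7 ∷ 7 ∷ 10 ∷ 10 ∷ 10 ∷ 12 ∷ 14 ∷ 14 ∷ 14 ∷ 14 ∷ 15 ∷ 18 ∷ [] , 0 ∷ 0 ∷ 1 ∷ 1 ∷ 6 ∷ 6 ∷ 8 ∷ 8 ∷ 9 ∷ 11 ∷ 11 ∷ 11 ∷ 11 ∷ 11 ∷ 16 ∷ 16 ∷ 16 ∷ 16 ∷ 17 ∷ 17 ∷ 17 ∷ 17 ∷ 17 ∷ []) ∷
      (2 ∷ 2 ∷ 2 ∷ 2 ∷ 3 ∷ 3 ∷ 5 ∷ 5 ∷ 5 ∷ 8 ∷ 8 ∷ 8 ∷ 9 ∷ 9 ∷ 12 ∷ 15 ∷ 15 ∷ [] , 0 ∷ 0 ∷ 1 ∷ 1 ∷ 6 ∷ 7 ∷ 11 ∷ 11 ∷ 11 ∷ 11 ∷ 11 ∷ 13 ∷ 13 ∷ 14 ∷ 14 ∷ 16 ∷ []) ∷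
      (1 ∷ 6 ∷ 6 ∷ 6 ∷ 6 ∷ 7 ∷ 7 ∷ 11 ∷ 11 ∷ 11 ∷ 13 ∷ 13 ∷ 15 ∷ 16 ∷ 16 ∷ [] , 2 ∷ 5 ∷ 5 ∷ 5 ∷ 5 ∷ 8 ∷ 8 ∷ 8 ∷ 9 ∷ 12 ∷ 12 ∷ 14 ∷ 18 ∷ 18 ∷ []) ∷
      (2 ∷ 2 ∷ 2 ∷ 2 ∷ 4 ∷ 4 ∷ 4 ∷ 4 ∷ 4 ∷ 4 ∷ 4 ∷ 4 ∷ 4 ∷ 4 ∷ 5 ∷ 5 ∷ 5 ∷ 5 ∷ 7 ∷ 7 ∷ 7 ∷ 7 ∷ 9 ∷ 9 ∷ 9 ∷ 9 ∷ 9 ∷ 9 ∷ 9 ∷ 12 ∷ 14 ∷ 14 ∷ 14 ∷ 14 ∷ 15 ∷ 16 ∷ 16 ∷ 16 ∷ 16 ∷ 18 ∷ [] , 0 ∷ 0 ∷ 1 ∷ 1 ∷ 3 ∷ 3 ∷ 3 ∷ 3 ∷ 3 ∷ 3 ∷ 3 ∷ 3 ∷ 6 ∷ 6 ∷ 8 ∷ 8 ∷ 10 ∷ 10 ∷ 10 ∷ 10 ∷ 10 ∷ 11 ∷ 11 ∷ 11 ∷ 11 ∷ 11 ∷ 13 ∷ 13 ∷ 13 ∷ 13 ∷ 13 ∷ 13 ∷ 13 ∷ 13 ∷ 17 ∷ 17 ∷ 17 ∷ 17 ∷ 17 ∷ []) ∷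
      (1 ∷ 2 ∷ 2 ∷ 2 ∷ 3 ∷ 3 ∷ 3 ∷ 3 ∷ 6 ∷ 6 ∷ 6 ∷ 6 ∷ 8 ∷ 10 ∷ 10 ∷ 10 ∷ 10 ∷ 13 ∷ 13 ∷ 15 ∷ 17 ∷ 17 ∷ 17 ∷ 17 ∷ [] , 0 ∷ 0 ∷ 0 ∷ 0 ∷ 7 ∷ 7 ∷ 9 ∷ 9 ∷ 9 ∷ 9 ∷ 9 ∷ 11 ∷ 12 ∷ 12 ∷ 14 ∷ 14 ∷ 14 ∷ 14 ∷ 14 ∷ 16 ∷ 16 ∷ 18 ∷ 18 ∷ []) ∷
      (1 ∷ 1 ∷ 3 ∷ 3 ∷ 5 ∷ 5 ∷ 5 ∷ 8 ∷ 12 ∷ 16 ∷ 17 ∷ 17 ∷ [] , 0 ∷ 0 ∷ 6 ∷ 7 ∷ 7 ∷ 7 ∷ 10 ∷ 10 ∷ 11 ∷ 15 ∷ 15 ∷ []) ∷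
      (1 ∷ 3 ∷ 3 ∷ 3 ∷ 5 ∷ 5 ∷ 10 ∷ 10 ∷ 10 ∷ 10 ∷ 11 ∷ 11 ∷ 15 ∷ 15 ∷ 18 ∷ 18 ∷ 18 ∷ [] , 0 ∷ 4 ∷ 4 ∷ 6 ∷ 7 ∷ 9 ∷ 9 ∷ 9 ∷ 9 ∷ 9 ∷ 12 ∷ 12 ∷ 16 ∷ 16 ∷ 17 ∷ 17 ∷ []) ∷
      (1 ∷ 3 ∷ 3 ∷ 3 ∷ 3 ∷ 3 ∷ 3 ∷ 3 ∷ 3 ∷ 8 ∷ 8 ∷ 8 ∷ 8 ∷ 8 ∷ 10 ∷ 10 ∷ 10 ∷ 10 ∷ 11 ∷ 11 ∷ 11 ∷ 13 ∷ 13 ∷ 17 ∷ 17 ∷ 17 ∷ 17 ∷ 18 ∷ 18 ∷ [] , 2 ∷ 4 ∷ 4 ∷ 4 ∷ 4 ∷ 4 ∷ 4 ∷ 4 ∷ 4 ∷ 7 ∷ 7 ∷ 7 ∷ 7 ∷ 7 ∷ 7 ∷ 9 ∷ 9 ∷ 9 ∷ 9 ∷ 9 ∷ 12 ∷ 12 ∷ 14 ∷ 15 ∷ 15 ∷ 15 ∷ 16 ∷ 16 ∷ []) ∷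
      (1 ∷ 1 ∷ 4 ∷ 4 ∷ 6 ∷ 6 ∷ 12 ∷ 15 ∷ 18 ∷ [] , 0 ∷ 0 ∷ 8 ∷ 8 ∷ 9 ∷ 10 ∷ 11 ∷ 17 ∷ []) ∷
      (0 ∷ 0 ∷ 8 ∷ 8 ∷ 10 ∷ 10 ∷ 10 ∷ 12 ∷ 15 ∷ 18 ∷ [] , 1 ∷ 1 ∷ 4 ∷ 4 ∷ 6 ∷ 6 ∷ 9 ∷ 11 ∷ 17 ∷ []) ∷
      (0 ∷ 1 ∷ 4 ∷ 6 ∷ 7 ∷ 9 ∷ 11 ∷ 12 ∷ 13 ∷ 14 ∷ 15 ∷ 16 ∷ 17 ∷ [] , 2 ∷ 2 ∷ 3 ∷ 3 ∷ 5 ∷ 5 ∷ 8 ∷ 8 ∷ 10 ∷ 10 ∷ 18 ∷ 18 ∷ []) ∷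
      (0 ∷ 0 ∷ 0 ∷ 0 ∷ 1 ∷ 3 ∷ 3 ∷ 3 ∷ 3 ∷ 6 ∷ 6 ∷ 6 ∷ 6 ∷ 8 ∷ 10 ∷ 10 ∷ 10 ∷ 10 ∷ 11 ∷ 11 ∷ 11 ∷ 11 ∷ 11 ∷ 11 ∷ 11 ∷ 13 ∷ 13 ∷ 13 ∷ 13 ∷ 13 ∷ 13 ∷ 13 ∷ 13 ∷ 13 ∷ 13 ∷ 15 ∷ 17 ∷ 17 ∷ 17 ∷ 17 ∷ [] , 2 ∷ 2 ∷ 2 ∷ 2 ∷ 2 ∷ 4 ∷ 4 ∷ 4 ∷ 4 ∷ 4 ∷ 4 ∷ 4 ∷ 4 ∷ 5 ∷ 5 ∷ 5 ∷ 5 ∷ 5 ∷ 5 ∷ 5 ∷ 5 ∷ 7 ∷ 7 ∷ 9 ∷ 9 ∷ 9 ∷ 9 ∷ 9 ∷ 12 ∷ 12 ∷ 14 ∷ 14 ∷ 14 ∷ 14 ∷ 14 ∷ 16 ∷ 16 ∷ 18 ∷ 18 ∷ []) ∷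
      (2 ∷ 2 ∷ 2 ∷ 2 ∷ 4 ∷ 4 ∷ 5 ∷ 5 ∷ 5 ∷ 5 ∷ 5 ∷ 5 ∷ 5 ∷ 5 ∷ 8 ∷ 8 ∷ 9 ∷ 9 ∷ 9 ∷ 12 ∷ 14 ∷ 14 ∷ 14 ∷ 14 ∷ 18 ∷ 18 ∷ 18 ∷ 18 ∷ 18 ∷ [] , 0 ∷ 0 ∷ 1 ∷ 1 ∷ 6 ∷ 6 ∷ 6 ∷ 6 ∷ 6 ∷ 6 ∷ 10 ∷ 11 ∷ 11 ∷ 11 ∷ 11 ∷ 11 ∷ 13 ∷ 13 ∷ 13 ∷ 13 ∷ 13 ∷ 13 ∷ 13 ∷ 13 ∷ 15 ∷ 15 ∷ 15 ∷ 17 ∷ []) ∷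
      []
  }

presentation2 : Presentation
presentation2 = record
  { m = 16
  ; k = 2
  ; lines =
      (0 , 1 , 2) ∷ (0 , 3 , 4) ∷ (0 , 5 , 6) ∷ (1 , 7 , 8) ∷ (1 , 9 , 10) ∷ (2 , 11 , 12) ∷
      (2 , 13 , 14) ∷ (3 , 7 , 13) ∷ (3 , 10 , 12) ∷ (4 , 8 , 11) ∷ (4 , 14 , 16) ∷ (5 , 7 , 16) ∷
      (5 , 9 , 11) ∷ (6 , 8 , 15) ∷ (6 , 10 , 14) ∷ (9 , 13 , 15) ∷ (12 , 15 , 16) ∷ []
  -- A segment with the constant weight 1/3 as midpoint: the numerators add up to 2 at each point.
  -- Minimal transversals are the 9 points common to both supports and the 4 · 4 pairs with one
  -- point from each difference.
  ; vertices =
      (2 , 2 ∷ 0 ∷ 1 ∷ 1 ∷ 0 ∷ 0 ∷ 1 ∷ 1 ∷ 2 ∷ 2 ∷ 1 ∷ 1 ∷ 1 ∷ 1 ∷ 1 ∷ 0 ∷ 2 ∷ []) ∷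
      (2 , 0 ∷ 2 ∷ 1 ∷ 1 ∷ 2 ∷ 2 ∷ 1 ∷ 1 ∷ 0 ∷ 0 ∷ 1 ∷ 1 ∷ 1 ∷ 1 ∷ 1 ∷ 2 ∷ 0 ∷ []) ∷
      []
  ; certificates =
      (1 ∷ 4 ∷ 5 ∷ 5 ∷ 6 ∷ 11 ∷ 11 ∷ 13 ∷ 13 ∷ [] , 2 ∷ 3 ∷ 7 ∷ 9 ∷ 12 ∷ 14 ∷ 16 ∷ 16 ∷ []) ∷
      (0 ∷ 7 ∷ 7 ∷ 8 ∷ 10 ∷ 12 ∷ 12 ∷ 13 ∷ 13 ∷ [] , 2 ∷ 3 ∷ 5 ∷ 9 ∷ 11 ∷ 14 ∷ 15 ∷ 15 ∷ []) ∷
      (2 ∷ 2 ∷ 4 ∷ 4 ∷ 4 ∷ 5 ∷ 5 ∷ 7 ∷ 7 ∷ 10 ∷ 13 ∷ 13 ∷ [] , 0 ∷ 0 ∷ 3 ∷ 8 ∷ 8 ∷ 9 ∷ 11 ∷ 12 ∷ 14 ∷ 15 ∷ 15 ∷ []) ∷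
      (1 ∷ 3 ∷ 3 ∷ 5 ∷ 5 ∷ 11 ∷ 11 ∷ 14 ∷ 14 ∷ 15 ∷ 15 ∷ 15 ∷ [] , 2 ∷ 4 ∷ 4 ∷ 6 ∷ 6 ∷ 7 ∷ 9 ∷ 12 ∷ 13 ∷ 16 ∷ 16 ∷ []) ∷
      (0 ∷ 8 ∷ 9 ∷ 9 ∷ 11 ∷ 11 ∷ 14 ∷ 14 ∷ 15 ∷ [] , 2 ∷ 3 ∷ 5 ∷ 7 ∷ 10 ∷ 10 ∷ 12 ∷ 13 ∷ []) ∷
      (0 ∷ 0 ∷ 0 ∷ 7 ∷ 7 ∷ 9 ∷ 9 ∷ 12 ∷ 12 ∷ 14 ∷ 14 ∷ 16 ∷ [] , 1 ∷ 1 ∷ 2 ∷ 3 ∷ 4 ∷ 4 ∷ 5 ∷ 6 ∷ 6 ∷ 11 ∷ 13 ∷ []) ∷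
      (2 ∷ 2 ∷ 3 ∷ 3 ∷ 5 ∷ 5 ∷ 8 ∷ 10 ∷ 15 ∷ [] , 0 ∷ 0 ∷ 7 ∷ 9 ∷ 11 ∷ 12 ∷ 13 ∷ 14 ∷ []) ∷
      (2 ∷ 2 ∷ 4 ∷ 6 ∷ 7 ∷ 7 ∷ 9 ∷ 9 ∷ 16 ∷ [] , 1 ∷ 1 ∷ 3 ∷ 5 ∷ 11 ∷ 12 ∷ 13 ∷ 14 ∷ []) ∷
      (1 ∷ 3 ∷ 3 ∷ 6 ∷ 12 ∷ 12 ∷ 14 ∷ 14 ∷ 16 ∷ [] , 2 ∷ 4 ∷ 4 ∷ 5 ∷ 7 ∷ 9 ∷ 11 ∷ 13 ∷ []) ∷
      (0 ∷ 2 ∷ 3 ∷ 16 ∷ [] , 5 ∷ 11 ∷ 13 ∷ []) ∷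
      (1 ∷ 2 ∷ 9 ∷ 15 ∷ [] , 7 ∷ 12 ∷ 13 ∷ []) ∷
      (1 ∷ 2 ∷ 2 ∷ 3 ∷ 6 ∷ 6 ∷ 8 ∷ 9 ∷ 11 ∷ 12 ∷ 16 ∷ [] , 4 ∷ 5 ∷ 5 ∷ 7 ∷ 7 ∷ 10 ∷ 10 ∷ 13 ∷ 13 ∷ []) ∷
      (0 ∷ 0 ∷ 0 ∷ 1 ∷ 1 ∷ 3 ∷ 9 ∷ 11 ∷ 12 ∷ 14 ∷ 14 ∷ 14 ∷ 14 ∷ 15 ∷ 15 ∷ 15 ∷ 16 ∷ 16 ∷ [] , 2 ∷ 2 ∷ 4 ∷ 4 ∷ 4 ∷ 4 ∷ 5 ∷ 5 ∷ 6 ∷ 7 ∷ 7 ∷ 10 ∷ 10 ∷ 10 ∷ 13 ∷ 13 ∷ []) ∷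
      (2 ∷ 3 ∷ 3 ∷ 4 ∷ 6 ∷ 6 ∷ 8 ∷ 9 ∷ 12 ∷ 13 ∷ 16 ∷ [] , 1 ∷ 5 ∷ 5 ∷ 11 ∷ 11 ∷ 14 ∷ 14 ∷ 15 ∷ 15 ∷ []) ∷
      (3 ∷ 4 ∷ 10 ∷ 12 ∷ [] , 9 ∷ 11 ∷ 14 ∷ []) ∷
      (0 ∷ 0 ∷ 2 ∷ 4 ∷ 4 ∷ 4 ∷ 7 ∷ 7 ∷ 7 ∷ 7 ∷ 9 ∷ 10 ∷ 10 ∷ 12 ∷ 13 ∷ 16 ∷ 16 ∷ 16 ∷ [] , 1 ∷ 1 ∷ 1 ∷ 3 ∷ 3 ∷ 5 ∷ 5 ∷ 8 ∷ 11 ∷ 11 ∷ 14 ∷ 14 ∷ 15 ∷ 15 ∷ 15 ∷ 15 ∷ []) ∷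
      (1 ∷ 2 ∷ 3 ∷ 4 ∷ 6 ∷ 6 ∷ 8 ∷ 9 ∷ 9 ∷ 11 ∷ 13 ∷ [] , 0 ∷ 0 ∷ 7 ∷ 7 ∷ 12 ∷ 12 ∷ 14 ∷ 14 ∷ 16 ∷ []) ∷
      (1 ∷ 1 ∷ 1 ∷ 2 ∷ 3 ∷ 4 ∷ 4 ∷ 4 ∷ 5 ∷ 5 ∷ 5 ∷ 5 ∷ 10 ∷ 10 ∷ 11 ∷ 13 ∷ 15 ∷ 15 ∷ [] , 0 ∷ 0 ∷ 0 ∷ 0 ∷ 7 ∷ 7 ∷ 8 ∷ 9 ∷ 9 ∷ 12 ∷ 12 ∷ 14 ∷ 14 ∷ 16 ∷ 16 ∷ 16 ∷ []) ∷
      (4 ∷ 9 ∷ 10 ∷ 11 ∷ [] , 3 ∷ 12 ∷ 14 ∷ []) ∷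
      (2 ∷ 3 ∷ 6 ∷ 6 ∷ 6 ∷ 8 ∷ 8 ∷ 9 ∷ 11 ∷ 12 ∷ 13 ∷ [] , 0 ∷ 5 ∷ 5 ∷ 7 ∷ 7 ∷ 10 ∷ 14 ∷ 14 ∷ 15 ∷ []) ∷
      (1 ∷ 2 ∷ 3 ∷ 4 ∷ 6 ∷ 6 ∷ 8 ∷ 11 ∷ 12 ∷ 12 ∷ 13 ∷ [] , 0 ∷ 0 ∷ 7 ∷ 7 ∷ 9 ∷ 9 ∷ 14 ∷ 14 ∷ 16 ∷ []) ∷
      (0 ∷ 2 ∷ 6 ∷ 8 ∷ 8 ∷ 9 ∷ 10 ∷ 11 ∷ 11 ∷ 12 ∷ 13 ∷ [] , 1 ∷ 1 ∷ 3 ∷ 3 ∷ 5 ∷ 5 ∷ 14 ∷ 14 ∷ 15 ∷ []) ∷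
      (0 ∷ 3 ∷ 6 ∷ 8 ∷ 8 ∷ 9 ∷ 11 ∷ 12 ∷ 13 ∷ 13 ∷ 15 ∷ [] , 2 ∷ 2 ∷ 4 ∷ 4 ∷ 5 ∷ 5 ∷ 7 ∷ 7 ∷ 10 ∷ []) ∷
      (1 ∷ 12 ∷ 13 ∷ 15 ∷ [] , 2 ∷ 7 ∷ 9 ∷ []) ∷
      (0 ∷ 11 ∷ 13 ∷ 16 ∷ [] , 2 ∷ 3 ∷ 5 ∷ []) ∷
      []
  }

presentation3 : Presentation
presentation3 = record
  { m = 17
  ; k = 3
  ; lines =
      (0 , 1 , 2) ∷ (0 , 3 , 4) ∷ (0 , 5 , 6) ∷ (1 , 7 , 8) ∷ (1 , 9 , 10) ∷ (2 , 11 , 12) ∷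
      (2 , 13 , 14) ∷ (3 , 8 , 17) ∷ (3 , 13 , 16) ∷ (4 , 7 , 11) ∷ (4 , 9 , 15) ∷ (5 , 8 , 12) ∷
      (5 , 9 , 13) ∷ (6 , 7 , 14) ∷ (6 , 10 , 16) ∷ (10 , 11 , 17) ∷ (12 , 15 , 16) ∷ (14 , 15 , 17) ∷ []
  -- Two-valued states whose supports partition the points: the classes of a 3-colouring in which
  -- every line shows all three colours. With six points per class there are 6³ = 216 minimal
  -- transversals.
  ; vertices =
      (0 , 0 ∷ 1 ∷ 0 ∷ 0 ∷ 1 ∷ 0 ∷ 1 ∷ 0 ∷ 0 ∷ 0 ∷ 0 ∷ 0 ∷ 1 ∷ 1 ∷ 0 ∷ 0 ∷ 0 ∷ 1 ∷ []) ∷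
      (0 , 1 ∷ 0 ∷ 0 ∷ 0 ∷ 0 ∷ 0 ∷ 0 ∷ 0 ∷ 1 ∷ 1 ∷ 0 ∷ 1 ∷ 0 ∷ 0 ∷ 1 ∷ 0 ∷ 1 ∷ 0 ∷ []) ∷
      (0 , 0 ∷ 0 ∷ 1 ∷ 1 ∷ 0 ∷ 1 ∷ 0 ∷ 1 ∷ 0 ∷ 0 ∷ 1 ∷ 0 ∷ 0 ∷ 0 ∷ 0 ∷ 1 ∷ 0 ∷ 0 ∷ []) ∷
      []
  ; certificates =
      -- A line on its own is a certificate: its three points cannot all be small.
      (0 ∷ [] , []) ∷
      (1 ∷ 1 ∷ 2 ∷ 3 ∷ 4 ∷ 16 ∷ [] , 9 ∷ 10 ∷ 11 ∷ 14 ∷ []) ∷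
      (0 ∷ 0 ∷ 1 ∷ 11 ∷ 12 ∷ 17 ∷ [] , 5 ∷ 6 ∷ 7 ∷ 10 ∷ []) ∷
      (0 ∷ 0 ∷ 4 ∷ 9 ∷ 13 ∷ 16 ∷ [] , 5 ∷ 6 ∷ 10 ∷ 14 ∷ []) ∷
      (1 ∷ 2 ∷ 3 ∷ 4 ∷ 4 ∷ 17 ∷ [] , 7 ∷ 10 ∷ 12 ∷ 13 ∷ []) ∷
      (1 ∷ 2 ∷ 2 ∷ 3 ∷ 3 ∷ 4 ∷ 16 ∷ 17 ∷ [] , 7 ∷ 9 ∷ 11 ∷ 12 ∷ 13 ∷ 14 ∷ []) ∷
      (0 ∷ 1 ∷ 1 ∷ 6 ∷ 6 ∷ 10 ∷ 14 ∷ [] , 4 ∷ 8 ∷ 8 ∷ 13 ∷ 17 ∷ []) ∷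
      (0 ∷ 2 ∷ 5 ∷ 6 ∷ 7 ∷ 10 ∷ 14 ∷ [] , 4 ∷ 8 ∷ 9 ∷ 11 ∷ 17 ∷ []) ∷
      (0 ∷ 6 ∷ 7 ∷ 16 ∷ [] , 3 ∷ 8 ∷ 17 ∷ []) ∷
      (0 ∷ 6 ∷ 10 ∷ 15 ∷ [] , 4 ∷ 9 ∷ 17 ∷ []) ∷
      (0 ∷ 0 ∷ 7 ∷ 12 ∷ 14 ∷ [] , 2 ∷ 3 ∷ 4 ∷ 8 ∷ []) ∷
      (1 ∷ [] , []) ∷
      (1 ∷ 1 ∷ 2 ∷ 5 ∷ 7 ∷ 13 ∷ 13 ∷ [] , 6 ∷ 9 ∷ 9 ∷ 11 ∷ 17 ∷ []) ∷
      (1 ∷ 1 ∷ 1 ∷ 4 ∷ 5 ∷ 5 ∷ 8 ∷ 13 ∷ [] , 0 ∷ 6 ∷ 9 ∷ 9 ∷ 10 ∷ 14 ∷ []) ∷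
      (1 ∷ 8 ∷ 13 ∷ 15 ∷ [] , 9 ∷ 14 ∷ 17 ∷ []) ∷
      (0 ∷ 1 ∷ 1 ∷ 7 ∷ 7 ∷ 12 ∷ 13 ∷ 15 ∷ 16 ∷ [] , 3 ∷ 6 ∷ 9 ∷ 10 ∷ 11 ∷ 14 ∷ []) ∷
      (1 ∷ 1 ∷ 2 ∷ 6 ∷ 9 ∷ 11 ∷ [] , 5 ∷ 7 ∷ 8 ∷ 13 ∷ []) ∷
      (1 ∷ 6 ∷ 9 ∷ 16 ∷ [] , 5 ∷ 8 ∷ 17 ∷ []) ∷
      (1 ∷ 1 ∷ 1 ∷ 6 ∷ 9 ∷ 11 ∷ 14 ∷ 14 ∷ [] , 2 ∷ 5 ∷ 7 ∷ 8 ∷ 8 ∷ 13 ∷ []) ∷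
      (1 ∷ 1 ∷ 2 ∷ 3 ∷ 6 ∷ 10 ∷ 10 ∷ 15 ∷ 16 ∷ [] , 4 ∷ 5 ∷ 7 ∷ 8 ∷ 12 ∷ 13 ∷ []) ∷
      (2 ∷ [] , []) ∷
      (0 ∷ 1 ∷ 11 ∷ 11 ∷ 12 ∷ 17 ∷ [] , 3 ∷ 6 ∷ 7 ∷ 10 ∷ []) ∷
      (1 ∷ 2 ∷ 2 ∷ 6 ∷ 9 ∷ 11 ∷ 12 ∷ 12 ∷ 17 ∷ [] , 5 ∷ 7 ∷ 10 ∷ 10 ∷ 13 ∷ 13 ∷ []) ∷
      (0 ∷ 0 ∷ 1 ∷ 11 ∷ 12 ∷ 12 ∷ 15 ∷ 17 ∷ [] , 3 ∷ 4 ∷ 5 ∷ 6 ∷ 8 ∷ 10 ∷ []) ∷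
      (2 ∷ 7 ∷ 13 ∷ 16 ∷ [] , 8 ∷ 11 ∷ 17 ∷ []) ∷
      (2 ∷ 10 ∷ 13 ∷ 15 ∷ [] , 9 ∷ 12 ∷ 17 ∷ []) ∷
      (2 ∷ 2 ∷ 3 ∷ 5 ∷ 10 ∷ [] , 0 ∷ 9 ∷ 11 ∷ 12 ∷ []) ∷
      (1 ∷ 1 ∷ 3 ∷ 12 ∷ 12 ∷ 13 ∷ 15 ∷ 16 ∷ 16 ∷ [] , 2 ∷ 4 ∷ 8 ∷ 8 ∷ 9 ∷ 10 ∷ 11 ∷ 17 ∷ []) ∷
      (1 ∷ 3 ∷ 6 ∷ 12 ∷ 13 ∷ 15 ∷ 15 ∷ 16 ∷ 16 ∷ [] , 4 ∷ 5 ∷ 8 ∷ 9 ∷ 11 ∷ 14 ∷ 17 ∷ 17 ∷ []) ∷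
      (0 ∷ 1 ∷ 7 ∷ 12 ∷ 12 ∷ 13 ∷ 15 ∷ 16 ∷ 16 ∷ [] , 2 ∷ 4 ∷ 5 ∷ 8 ∷ 8 ∷ 10 ∷ 11 ∷ 17 ∷ []) ∷
      (1 ∷ 1 ∷ 4 ∷ 6 ∷ 15 ∷ 16 ∷ 16 ∷ [] , 0 ∷ 8 ∷ 8 ∷ 9 ∷ 10 ∷ 17 ∷ []) ∷
      (1 ∷ 3 ∷ 6 ∷ 10 ∷ 13 ∷ 15 ∷ 15 ∷ 15 ∷ 16 ∷ [] , 4 ∷ 5 ∷ 7 ∷ 9 ∷ 9 ∷ 14 ∷ 17 ∷ 17 ∷ []) ∷
      (1 ∷ 6 ∷ 15 ∷ 15 ∷ 16 ∷ [] , 5 ∷ 8 ∷ 9 ∷ 17 ∷ []) ∷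
      (1 ∷ 13 ∷ 15 ∷ 16 ∷ 16 ∷ [] , 8 ∷ 9 ∷ 14 ∷ 17 ∷ []) ∷
      (1 ∷ 2 ∷ 3 ∷ 3 ∷ 6 ∷ 10 ∷ 15 ∷ 15 ∷ 16 ∷ [] , 0 ∷ 4 ∷ 7 ∷ 9 ∷ 9 ∷ 11 ∷ 14 ∷ 17 ∷ []) ∷
      (0 ∷ 10 ∷ 15 ∷ 17 ∷ [] , 4 ∷ 6 ∷ 9 ∷ []) ∷
      (0 ∷ 3 ∷ 5 ∷ 6 ∷ 7 ∷ 10 ∷ 14 ∷ [] , 1 ∷ 12 ∷ 13 ∷ 15 ∷ 16 ∷ []) ∷
      (0 ∷ 4 ∷ 4 ∷ 5 ∷ 5 ∷ 7 ∷ 10 ∷ [] , 1 ∷ 11 ∷ 15 ∷ 15 ∷ 16 ∷ []) ∷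
      (0 ∷ 5 ∷ 8 ∷ 10 ∷ [] , 1 ∷ 12 ∷ 16 ∷ []) ∷
      (0 ∷ 5 ∷ 14 ∷ 17 ∷ [] , 2 ∷ 15 ∷ 16 ∷ []) ∷
      (0 ∷ 0 ∷ 7 ∷ 9 ∷ 14 ∷ [] , 1 ∷ 2 ∷ 3 ∷ 15 ∷ []) ∷
      (3 ∷ 8 ∷ 10 ∷ 11 ∷ [] , 9 ∷ 12 ∷ 16 ∷ []) ∷
      (4 ∷ 4 ∷ 4 ∷ 5 ∷ 7 ∷ 7 ∷ 12 ∷ 13 ∷ [] , 3 ∷ 6 ∷ 11 ∷ 14 ∷ 15 ∷ 15 ∷ []) ∷
      (2 ∷ 2 ∷ 4 ∷ 4 ∷ 5 ∷ 8 ∷ 8 ∷ 9 ∷ 17 ∷ [] , 0 ∷ 1 ∷ 12 ∷ 12 ∷ 13 ∷ 14 ∷ 15 ∷ 16 ∷ []) ∷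
      (4 ∷ 5 ∷ 8 ∷ 8 ∷ 11 ∷ 17 ∷ 17 ∷ [] , 6 ∷ 7 ∷ 12 ∷ 15 ∷ 16 ∷ 16 ∷ []) ∷
      (4 ∷ 5 ∷ 8 ∷ 8 ∷ 17 ∷ [] , 6 ∷ 12 ∷ 15 ∷ 16 ∷ []) ∷
      (3 ∷ 11 ∷ 14 ∷ 17 ∷ [] , 13 ∷ 15 ∷ 16 ∷ []) ∷
      (4 ∷ 5 ∷ 12 ∷ 17 ∷ [] , 6 ∷ 15 ∷ 16 ∷ []) ∷
      (2 ∷ 4 ∷ 5 ∷ 8 ∷ 8 ∷ 9 ∷ 11 ∷ 17 ∷ 17 ∷ [] , 1 ∷ 6 ∷ 7 ∷ 12 ∷ 13 ∷ 15 ∷ 16 ∷ 16 ∷ []) ∷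
      (4 ∷ 5 ∷ 8 ∷ 9 ∷ 11 ∷ 14 ∷ 17 ∷ 17 ∷ 17 ∷ [] , 6 ∷ 7 ∷ 10 ∷ 13 ∷ 15 ∷ 15 ∷ 16 ∷ 16 ∷ []) ∷
      (0 ∷ 4 ∷ 8 ∷ 9 ∷ 9 ∷ 11 ∷ 14 ∷ 17 ∷ 17 ∷ [] , 1 ∷ 3 ∷ 6 ∷ 10 ∷ 13 ∷ 15 ∷ 15 ∷ 16 ∷ []) ∷
      (3 ∷ [] , []) ∷
      (3 ∷ 4 ∷ 4 ∷ 5 ∷ 12 ∷ 13 ∷ [] , 6 ∷ 11 ∷ 14 ∷ 15 ∷ []) ∷
      (0 ∷ 3 ∷ 3 ∷ 9 ∷ 9 ∷ 12 ∷ 13 ∷ 15 ∷ 16 ∷ [] , 1 ∷ 6 ∷ 7 ∷ 10 ∷ 11 ∷ 14 ∷ []) ∷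
      (0 ∷ 4 ∷ 9 ∷ 13 ∷ 13 ∷ 16 ∷ [] , 2 ∷ 5 ∷ 10 ∷ 14 ∷ []) ∷
      (0 ∷ 0 ∷ 4 ∷ 8 ∷ 9 ∷ 9 ∷ 13 ∷ 16 ∷ [] , 1 ∷ 2 ∷ 5 ∷ 6 ∷ 10 ∷ 15 ∷ []) ∷
      (3 ∷ 4 ∷ 4 ∷ 6 ∷ 11 ∷ 11 ∷ 14 ∷ [] , 5 ∷ 12 ∷ 12 ∷ 13 ∷ 16 ∷ []) ∷
      (2 ∷ 3 ∷ 3 ∷ 6 ∷ 10 ∷ [] , 0 ∷ 9 ∷ 12 ∷ 13 ∷ []) ∷
      (4 ∷ [] , []) ∷
      (0 ∷ 4 ∷ 4 ∷ 7 ∷ 10 ∷ 10 ∷ 12 ∷ 13 ∷ 16 ∷ [] , 1 ∷ 6 ∷ 9 ∷ 11 ∷ 14 ∷ 15 ∷ []) ∷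
      (4 ∷ 8 ∷ 11 ∷ 15 ∷ [] , 7 ∷ 12 ∷ 16 ∷ []) ∷
      (1 ∷ 4 ∷ 4 ∷ 4 ∷ 6 ∷ 6 ∷ 11 ∷ 15 ∷ [] , 0 ∷ 5 ∷ 7 ∷ 10 ∷ 12 ∷ 12 ∷ []) ∷
      (0 ∷ 4 ∷ 4 ∷ 8 ∷ 9 ∷ 11 ∷ 14 ∷ 14 ∷ 17 ∷ [] , 2 ∷ 5 ∷ 7 ∷ 10 ∷ 12 ∷ 13 ∷ []) ∷
      (2 ∷ 2 ∷ 3 ∷ 4 ∷ 5 ∷ 8 ∷ 8 ∷ 10 ∷ 17 ∷ [] , 0 ∷ 1 ∷ 7 ∷ 12 ∷ 12 ∷ 13 ∷ 14 ∷ 16 ∷ []) ∷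
      (4 ∷ 8 ∷ 11 ∷ 17 ∷ 17 ∷ [] , 7 ∷ 12 ∷ 15 ∷ 16 ∷ []) ∷
      (0 ∷ 8 ∷ 10 ∷ 16 ∷ [] , 1 ∷ 5 ∷ 12 ∷ []) ∷
      (3 ∷ 6 ∷ 6 ∷ 7 ∷ 10 ∷ 10 ∷ 11 ∷ 14 ∷ [] , 4 ∷ 8 ∷ 12 ∷ 13 ∷ 16 ∷ 17 ∷ []) ∷
      (0 ∷ 7 ∷ 10 ∷ 12 ∷ 13 ∷ [] , 2 ∷ 3 ∷ 8 ∷ 17 ∷ []) ∷
      (5 ∷ 5 ∷ 6 ∷ 9 ∷ 10 ∷ 10 ∷ 14 ∷ [] , 4 ∷ 12 ∷ 13 ∷ 16 ∷ 16 ∷ []) ∷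
      (0 ∷ 9 ∷ 11 ∷ 14 ∷ 17 ∷ [] , 2 ∷ 3 ∷ 15 ∷ 16 ∷ []) ∷
      (0 ∷ 0 ∷ 7 ∷ 9 ∷ 9 ∷ 11 ∷ 14 ∷ [] , 1 ∷ 2 ∷ 3 ∷ 3 ∷ 5 ∷ 15 ∷ []) ∷
      (2 ∷ 6 ∷ 7 ∷ 10 ∷ [] , 1 ∷ 12 ∷ 17 ∷ []) ∷
      (0 ∷ 7 ∷ 10 ∷ 13 ∷ [] , 1 ∷ 3 ∷ 17 ∷ []) ∷
      (0 ∷ 5 ∷ 5 ∷ 5 ∷ 7 ∷ 10 ∷ 14 ∷ 14 ∷ [] , 1 ∷ 4 ∷ 11 ∷ 15 ∷ 16 ∷ 16 ∷ []) ∷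
      (5 ∷ 14 ∷ 17 ∷ [] , 15 ∷ 16 ∷ []) ∷
      (0 ∷ 7 ∷ 9 ∷ 14 ∷ [] , 1 ∷ 3 ∷ 15 ∷ []) ∷
      (6 ∷ 7 ∷ 16 ∷ [] , 8 ∷ 17 ∷ []) ∷
      (3 ∷ 6 ∷ 6 ∷ 6 ∷ 7 ∷ 7 ∷ 10 ∷ 14 ∷ [] , 1 ∷ 4 ∷ 8 ∷ 13 ∷ 17 ∷ 17 ∷ []) ∷
      (0 ∷ 7 ∷ 12 ∷ 14 ∷ [] , 2 ∷ 4 ∷ 8 ∷ []) ∷
      (0 ∷ 7 ∷ 12 ∷ 13 ∷ 16 ∷ [] , 2 ∷ 3 ∷ 8 ∷ 17 ∷ []) ∷
      (5 ∷ 6 ∷ 6 ∷ 7 ∷ 10 ∷ 10 ∷ 12 ∷ [] , 1 ∷ 9 ∷ 11 ∷ 17 ∷ 17 ∷ []) ∷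
      (0 ∷ 0 ∷ 7 ∷ 12 ∷ 12 ∷ 13 ∷ 14 ∷ [] , 2 ∷ 2 ∷ 3 ∷ 4 ∷ 6 ∷ 8 ∷ []) ∷
      (5 ∷ [] , []) ∷
      (3 ∷ 5 ∷ 5 ∷ 6 ∷ 12 ∷ 14 ∷ [] , 4 ∷ 11 ∷ 13 ∷ 16 ∷ []) ∷
      (2 ∷ 5 ∷ 5 ∷ 7 ∷ 9 ∷ 17 ∷ [] , 1 ∷ 11 ∷ 13 ∷ 16 ∷ []) ∷
      (0 ∷ 11 ∷ 13 ∷ [] , 2 ∷ 3 ∷ []) ∷
      (0 ∷ 11 ∷ 13 ∷ 16 ∷ [] , 2 ∷ 3 ∷ 17 ∷ []) ∷
      (6 ∷ [] , []) ∷
      (3 ∷ 6 ∷ 6 ∷ 12 ∷ 14 ∷ 16 ∷ [] , 4 ∷ 11 ∷ 13 ∷ 17 ∷ []) ∷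
      (0 ∷ 6 ∷ 7 ∷ 13 ∷ [] , 2 ∷ 3 ∷ 8 ∷ []) ∷
      (0 ∷ 0 ∷ 0 ∷ 7 ∷ 12 ∷ 12 ∷ 13 ∷ 14 ∷ 14 ∷ [] , 2 ∷ 2 ∷ 2 ∷ 3 ∷ 4 ∷ 4 ∷ 6 ∷ 8 ∷ []) ∷
      (8 ∷ 10 ∷ 11 ∷ [] , 12 ∷ 16 ∷ []) ∷
      (4 ∷ 7 ∷ 9 ∷ [] , 3 ∷ 15 ∷ []) ∷
      (8 ∷ 9 ∷ 10 ∷ 11 ∷ [] , 3 ∷ 12 ∷ 16 ∷ []) ∷
      (4 ∷ 8 ∷ 9 ∷ 11 ∷ 17 ∷ [] , 3 ∷ 12 ∷ 15 ∷ 16 ∷ []) ∷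
      (4 ∷ 7 ∷ 8 ∷ 9 ∷ [] , 3 ∷ 12 ∷ 15 ∷ []) ∷
      (2 ∷ 3 ∷ 5 ∷ 8 ∷ 10 ∷ [] , 0 ∷ 9 ∷ 12 ∷ 16 ∷ []) ∷
      (5 ∷ 8 ∷ 10 ∷ 13 ∷ [] , 6 ∷ 9 ∷ 16 ∷ []) ∷
      (2 ∷ 2 ∷ 3 ∷ 5 ∷ 5 ∷ 8 ∷ 10 ∷ [] , 0 ∷ 0 ∷ 9 ∷ 11 ∷ 12 ∷ 16 ∷ []) ∷
      (2 ∷ 4 ∷ 5 ∷ 8 ∷ 17 ∷ [] , 0 ∷ 12 ∷ 15 ∷ 16 ∷ []) ∷
      (5 ∷ 7 ∷ 7 ∷ 8 ∷ 13 ∷ 14 ∷ 14 ∷ [] , 3 ∷ 6 ∷ 11 ∷ 15 ∷ 15 ∷ []) ∷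
      (1 ∷ 3 ∷ 5 ∷ [] , 0 ∷ 9 ∷ []) ∷
      (1 ∷ 3 ∷ 5 ∷ 8 ∷ [] , 0 ∷ 9 ∷ 16 ∷ []) ∷
      (7 ∷ [] , []) ∷
      (1 ∷ 4 ∷ 4 ∷ 5 ∷ 5 ∷ 7 ∷ 8 ∷ 13 ∷ [] , 0 ∷ 3 ∷ 6 ∷ 9 ∷ 14 ∷ 15 ∷ []) ∷
      (4 ∷ 5 ∷ 7 ∷ 8 ∷ 10 ∷ 12 ∷ 13 ∷ [] , 0 ∷ 9 ∷ 11 ∷ 14 ∷ 17 ∷ []) ∷
      (4 ∷ 4 ∷ 5 ∷ 7 ∷ 7 ∷ 7 ∷ 12 ∷ 13 ∷ [] , 3 ∷ 3 ∷ 6 ∷ 11 ∷ 14 ∷ 15 ∷ []) ∷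
      (2 ∷ 4 ∷ 5 ∷ 8 ∷ [] , 0 ∷ 12 ∷ 14 ∷ []) ∷
      (2 ∷ 4 ∷ 5 ∷ 8 ∷ 8 ∷ [] , 0 ∷ 12 ∷ 14 ∷ 16 ∷ []) ∷
      (5 ∷ 8 ∷ 17 ∷ [] , 6 ∷ 16 ∷ []) ∷
      (1 ∷ 4 ∷ 5 ∷ 17 ∷ [] , 0 ∷ 10 ∷ 15 ∷ []) ∷
      (1 ∷ 4 ∷ 5 ∷ 7 ∷ 8 ∷ 13 ∷ 16 ∷ [] , 2 ∷ 3 ∷ 6 ∷ 10 ∷ 15 ∷ []) ∷
      (1 ∷ 1 ∷ 4 ∷ 6 ∷ 6 ∷ 8 ∷ 13 ∷ [] , 0 ∷ 0 ∷ 9 ∷ 10 ∷ 14 ∷ []) ∷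
      (8 ∷ [] , []) ∷
      (1 ∷ 4 ∷ 7 ∷ 7 ∷ 13 ∷ 13 ∷ 17 ∷ [] , 2 ∷ 3 ∷ 3 ∷ 10 ∷ 14 ∷ []) ∷
      (0 ∷ 7 ∷ 8 ∷ 13 ∷ [] , 2 ∷ 3 ∷ 6 ∷ []) ∷
      (3 ∷ 10 ∷ 11 ∷ 14 ∷ [] , 4 ∷ 13 ∷ 16 ∷ []) ∷
      (4 ∷ 7 ∷ 9 ∷ 12 ∷ [] , 3 ∷ 8 ∷ 15 ∷ []) ∷
      (9 ∷ 9 ∷ 11 ∷ 14 ∷ 17 ∷ [] , 3 ∷ 13 ∷ 15 ∷ 16 ∷ []) ∷
      (4 ∷ 6 ∷ 9 ∷ 9 ∷ 11 ∷ 11 ∷ 17 ∷ [] , 3 ∷ 3 ∷ 5 ∷ 12 ∷ 15 ∷ 16 ∷ []) ∷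
      (0 ∷ 4 ∷ 7 ∷ 9 ∷ 9 ∷ 9 ∷ 11 ∷ 14 ∷ 17 ∷ [] , 1 ∷ 3 ∷ 3 ∷ 5 ∷ 10 ∷ 13 ∷ 15 ∷ 15 ∷ []) ∷
      (3 ∷ 6 ∷ 7 ∷ 9 ∷ 10 ∷ 11 ∷ 14 ∷ [] , 2 ∷ 4 ∷ 5 ∷ 8 ∷ 17 ∷ []) ∷
      (1 ∷ 9 ∷ 12 ∷ 14 ∷ [] , 2 ∷ 8 ∷ 15 ∷ []) ∷
      (9 ∷ [] , []) ∷
      (1 ∷ 1 ∷ 6 ∷ 9 ∷ 11 ∷ 13 ∷ 13 ∷ [] , 2 ∷ 2 ∷ 5 ∷ 7 ∷ 8 ∷ []) ∷
      (0 ∷ 9 ∷ 9 ∷ 11 ∷ 14 ∷ [] , 2 ∷ 3 ∷ 5 ∷ 15 ∷ []) ∷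
      (6 ∷ 10 ∷ 11 ∷ 15 ∷ [] , 5 ∷ 12 ∷ 17 ∷ []) ∷
      (3 ∷ 6 ∷ 10 ∷ 10 ∷ 10 ∷ 11 ∷ 11 ∷ 14 ∷ [] , 4 ∷ 5 ∷ 12 ∷ 12 ∷ 13 ∷ 16 ∷ []) ∷
      (1 ∷ 12 ∷ 14 ∷ [] , 2 ∷ 8 ∷ []) ∷
      (10 ∷ [] , []) ∷
      (1 ∷ 4 ∷ 6 ∷ 9 ∷ 11 ∷ 14 ∷ 15 ∷ [] , 0 ∷ 7 ∷ 12 ∷ 13 ∷ 16 ∷ []) ∷
      (1 ∷ 1 ∷ 4 ∷ 6 ∷ 6 ∷ 11 ∷ 14 ∷ 15 ∷ [] , 0 ∷ 2 ∷ 5 ∷ 7 ∷ 8 ∷ 12 ∷ []) ∷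
      (1 ∷ 1 ∷ 6 ∷ 11 ∷ 14 ∷ 14 ∷ 14 ∷ 15 ∷ [] , 2 ∷ 2 ∷ 5 ∷ 7 ∷ 8 ∷ 13 ∷ []) ∷
      (2 ∷ 6 ∷ 9 ∷ 10 ∷ [] , 0 ∷ 12 ∷ 13 ∷ []) ∷
      (1 ∷ 6 ∷ 6 ∷ 10 ∷ 10 ∷ 11 ∷ 17 ∷ [] , 0 ∷ 5 ∷ 7 ∷ 12 ∷ 12 ∷ []) ∷
      (3 ∷ 8 ∷ 10 ∷ 10 ∷ 14 ∷ 17 ∷ [] , 4 ∷ 7 ∷ 12 ∷ 13 ∷ []) ∷
      (2 ∷ 7 ∷ 10 ∷ 11 ∷ 11 ∷ 14 ∷ 14 ∷ [] , 1 ∷ 4 ∷ 15 ∷ 16 ∷ 16 ∷ []) ∷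
      (2 ∷ 4 ∷ 5 ∷ 7 ∷ 10 ∷ 12 ∷ 13 ∷ [] , 1 ∷ 3 ∷ 6 ∷ 15 ∷ 16 ∷ []) ∷
      (2 ∷ 2 ∷ 5 ∷ 8 ∷ 10 ∷ [] , 0 ∷ 1 ∷ 12 ∷ 16 ∷ []) ∷
      (2 ∷ 5 ∷ 14 ∷ 17 ∷ [] , 0 ∷ 15 ∷ 16 ∷ []) ∷
      (2 ∷ 7 ∷ 9 ∷ 14 ∷ [] , 1 ∷ 3 ∷ 15 ∷ []) ∷
      (11 ∷ [] , []) ∷
      (2 ∷ 6 ∷ 8 ∷ 9 ∷ 11 ∷ 11 ∷ [] , 1 ∷ 5 ∷ 13 ∷ 16 ∷ []) ∷
      (2 ∷ 6 ∷ 7 ∷ 7 ∷ 9 ∷ 11 ∷ [] , 1 ∷ 5 ∷ 8 ∷ 13 ∷ []) ∷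
      (4 ∷ 4 ∷ 5 ∷ 11 ∷ 11 ∷ 12 ∷ 13 ∷ [] , 3 ∷ 3 ∷ 6 ∷ 14 ∷ 15 ∷ []) ∷
      (12 ∷ [] , []) ∷
      (0 ∷ 7 ∷ 12 ∷ 12 ∷ 13 ∷ [] , 2 ∷ 3 ∷ 6 ∷ 8 ∷ []) ∷
      (2 ∷ 4 ∷ 5 ∷ 5 ∷ 8 ∷ 9 ∷ 11 ∷ 11 ∷ 17 ∷ [] , 0 ∷ 3 ∷ 6 ∷ 7 ∷ 10 ∷ 14 ∷ []) ∷
      (2 ∷ 2 ∷ 6 ∷ 8 ∷ 8 ∷ 9 ∷ 11 ∷ 15 ∷ [] , 0 ∷ 1 ∷ 7 ∷ 13 ∷ 14 ∷ 16 ∷ []) ∷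
      (2 ∷ 7 ∷ 9 ∷ 15 ∷ [] , 1 ∷ 3 ∷ 14 ∷ []) ∷
      (4 ∷ 9 ∷ 11 ∷ 17 ∷ [] , 3 ∷ 10 ∷ 15 ∷ []) ∷
      (4 ∷ 9 ∷ 11 ∷ 16 ∷ [] , 3 ∷ 10 ∷ 15 ∷ []) ∷
      (2 ∷ 6 ∷ 6 ∷ 8 ∷ 11 ∷ 15 ∷ [] , 0 ∷ 5 ∷ 7 ∷ 14 ∷ []) ∷
      (2 ∷ 6 ∷ 8 ∷ 9 ∷ 12 ∷ 16 ∷ [] , 1 ∷ 5 ∷ 10 ∷ 13 ∷ []) ∷
      (4 ∷ 9 ∷ 11 ∷ 17 ∷ 17 ∷ [] , 3 ∷ 10 ∷ 15 ∷ 16 ∷ []) ∷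
      (0 ∷ 0 ∷ 7 ∷ 9 ∷ 9 ∷ 11 ∷ 12 ∷ 14 ∷ 17 ∷ [] , 1 ∷ 2 ∷ 3 ∷ 3 ∷ 5 ∷ 6 ∷ 10 ∷ 15 ∷ []) ∷
      (3 ∷ 7 ∷ 7 ∷ 10 ∷ 13 ∷ 13 ∷ 14 ∷ [] , 1 ∷ 4 ∷ 8 ∷ 17 ∷ 17 ∷ []) ∷
      (5 ∷ 7 ∷ 10 ∷ 10 ∷ 12 ∷ 13 ∷ 13 ∷ 13 ∷ [] , 1 ∷ 6 ∷ 9 ∷ 11 ∷ 17 ∷ 17 ∷ []) ∷
      (2 ∷ 3 ∷ 5 ∷ [] , 0 ∷ 11 ∷ []) ∷
      (13 ∷ [] , []) ∷
      (3 ∷ 5 ∷ 12 ∷ 13 ∷ 14 ∷ 14 ∷ [] , 4 ∷ 6 ∷ 11 ∷ 15 ∷ []) ∷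
      (2 ∷ 3 ∷ 6 ∷ 10 ∷ 15 ∷ [] , 0 ∷ 9 ∷ 12 ∷ 17 ∷ []) ∷
      (2 ∷ 2 ∷ 3 ∷ 3 ∷ 5 ∷ 6 ∷ 10 ∷ [] , 0 ∷ 0 ∷ 9 ∷ 11 ∷ 12 ∷ 13 ∷ []) ∷
      (10 ∷ 13 ∷ 15 ∷ [] , 9 ∷ 17 ∷ []) ∷
      (5 ∷ 7 ∷ 10 ∷ 10 ∷ 10 ∷ 12 ∷ 13 ∷ 13 ∷ [] , 1 ∷ 6 ∷ 9 ∷ 9 ∷ 11 ∷ 17 ∷ []) ∷
      (2 ∷ 4 ∷ 5 ∷ 14 ∷ [] , 0 ∷ 12 ∷ 16 ∷ []) ∷
      (2 ∷ 4 ∷ 6 ∷ [] , 0 ∷ 12 ∷ []) ∷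
      (14 ∷ [] , []) ∷
      (2 ∷ 2 ∷ 3 ∷ 3 ∷ 5 ∷ 5 ∷ 8 ∷ 10 ∷ 17 ∷ [] , 0 ∷ 0 ∷ 7 ∷ 9 ∷ 11 ∷ 12 ∷ 13 ∷ 16 ∷ []) ∷
      (2 ∷ 4 ∷ 6 ∷ 17 ∷ [] , 0 ∷ 12 ∷ 15 ∷ []) ∷
      (0 ∷ 8 ∷ 10 ∷ 14 ∷ 14 ∷ 17 ∷ [] , 1 ∷ 4 ∷ 6 ∷ 15 ∷ []) ∷
      (3 ∷ 6 ∷ 7 ∷ 16 ∷ [] , 0 ∷ 8 ∷ 17 ∷ []) ∷
      (3 ∷ 3 ∷ 6 ∷ 10 ∷ 15 ∷ [] , 0 ∷ 4 ∷ 9 ∷ 17 ∷ []) ∷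
      (3 ∷ 7 ∷ 12 ∷ 14 ∷ [] , 2 ∷ 4 ∷ 8 ∷ []) ∷
      (1 ∷ 12 ∷ 13 ∷ 13 ∷ 15 ∷ 16 ∷ 16 ∷ [] , 2 ∷ 8 ∷ 9 ∷ 14 ∷ 17 ∷ 17 ∷ []) ∷
      (7 ∷ 12 ∷ 12 ∷ 13 ∷ 16 ∷ [] , 2 ∷ 8 ∷ 11 ∷ 17 ∷ []) ∷
      (0 ∷ 1 ∷ 7 ∷ 12 ∷ 12 ∷ 12 ∷ 13 ∷ 14 ∷ 16 ∷ [] , 2 ∷ 2 ∷ 4 ∷ 6 ∷ 8 ∷ 8 ∷ 10 ∷ 11 ∷ []) ∷
      (3 ∷ 5 ∷ 5 ∷ 8 ∷ 13 ∷ 15 ∷ [] , 0 ∷ 6 ∷ 7 ∷ 14 ∷ []) ∷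
      (3 ∷ 3 ∷ 5 ∷ 8 ∷ 12 ∷ 13 ∷ 15 ∷ 15 ∷ [] , 0 ∷ 4 ∷ 7 ∷ 11 ∷ 14 ∷ 17 ∷ []) ∷
      (2 ∷ 5 ∷ 7 ∷ 8 ∷ 9 ∷ 9 ∷ 13 ∷ 15 ∷ 15 ∷ [] , 1 ∷ 1 ∷ 6 ∷ 11 ∷ 14 ∷ 14 ∷ []) ∷
      (1 ∷ 4 ∷ 11 ∷ 11 ∷ 13 ∷ 13 ∷ 13 ∷ 17 ∷ [] , 2 ∷ 2 ∷ 3 ∷ 7 ∷ 10 ∷ 14 ∷ []) ∷
      (1 ∷ 12 ∷ 13 ∷ 16 ∷ 16 ∷ [] , 2 ∷ 8 ∷ 10 ∷ 17 ∷ []) ∷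
      (1 ∷ 3 ∷ 6 ∷ 6 ∷ 12 ∷ 13 ∷ 13 ∷ 15 ∷ 16 ∷ [] , 0 ∷ 2 ∷ 5 ∷ 7 ∷ 10 ∷ 14 ∷ []) ∷
      (3 ∷ 6 ∷ 9 ∷ 12 ∷ 12 ∷ 14 ∷ 16 ∷ 16 ∷ [] , 2 ∷ 4 ∷ 5 ∷ 10 ∷ 11 ∷ 17 ∷ []) ∷
      (1 ∷ 12 ∷ 13 ∷ 17 ∷ [] , 2 ∷ 8 ∷ 10 ∷ []) ∷
      (0 ∷ 0 ∷ 7 ∷ 9 ∷ 12 ∷ 12 ∷ 13 ∷ 14 ∷ 16 ∷ [] , 2 ∷ 2 ∷ 3 ∷ 4 ∷ 5 ∷ 6 ∷ 8 ∷ 10 ∷ []) ∷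
      (1 ∷ 3 ∷ 5 ∷ 11 ∷ 14 ∷ [] , 0 ∷ 2 ∷ 8 ∷ 9 ∷ []) ∷
      (1 ∷ 3 ∷ 3 ∷ 6 ∷ 10 ∷ 15 ∷ 15 ∷ [] , 0 ∷ 4 ∷ 7 ∷ 9 ∷ 9 ∷ 17 ∷ []) ∷
      (6 ∷ 7 ∷ 7 ∷ 11 ∷ 14 ∷ 14 ∷ 15 ∷ [] , 2 ∷ 5 ∷ 8 ∷ 8 ∷ 13 ∷ []) ∷
      (3 ∷ 5 ∷ 10 ∷ 11 ∷ [] , 0 ∷ 9 ∷ 12 ∷ []) ∷
      (2 ∷ 3 ∷ 3 ∷ 6 ∷ 8 ∷ 10 ∷ 10 ∷ 15 ∷ 15 ∷ [] , 0 ∷ 4 ∷ 7 ∷ 9 ∷ 9 ∷ 12 ∷ 14 ∷ 17 ∷ []) ∷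
      (0 ∷ 7 ∷ 7 ∷ 10 ∷ 15 ∷ 16 ∷ [] , 1 ∷ 4 ∷ 5 ∷ 8 ∷ []) ∷
      (1 ∷ 4 ∷ 6 ∷ 15 ∷ 16 ∷ [] , 0 ∷ 8 ∷ 9 ∷ 17 ∷ []) ∷
      (10 ∷ 12 ∷ 13 ∷ 15 ∷ [] , 2 ∷ 9 ∷ 17 ∷ []) ∷
      (1 ∷ 12 ∷ 14 ∷ 15 ∷ [] , 2 ∷ 8 ∷ 9 ∷ []) ∷
      (4 ∷ 5 ∷ 5 ∷ 10 ∷ 10 ∷ 13 ∷ 16 ∷ [] , 0 ∷ 6 ∷ 9 ∷ 9 ∷ 14 ∷ []) ∷
      (3 ∷ 5 ∷ 10 ∷ 12 ∷ [] , 0 ∷ 9 ∷ 11 ∷ []) ∷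
      (5 ∷ 7 ∷ 10 ∷ 10 ∷ 12 ∷ 17 ∷ [] , 1 ∷ 6 ∷ 9 ∷ 11 ∷ []) ∷
      (1 ∷ 4 ∷ 4 ∷ 5 ∷ 5 ∷ 11 ∷ 15 ∷ [] , 0 ∷ 0 ∷ 7 ∷ 10 ∷ 12 ∷ []) ∷
      (1 ∷ 3 ∷ 6 ∷ 15 ∷ 15 ∷ [] , 0 ∷ 7 ∷ 9 ∷ 17 ∷ []) ∷
      (15 ∷ [] , []) ∷
      (1 ∷ 4 ∷ 4 ∷ 6 ∷ 11 ∷ 11 ∷ 13 ∷ 17 ∷ [] , 0 ∷ 2 ∷ 3 ∷ 7 ∷ 10 ∷ 12 ∷ []) ∷
      (1 ∷ 4 ∷ 11 ∷ 11 ∷ 14 ∷ 14 ∷ 16 ∷ [] , 2 ∷ 2 ∷ 3 ∷ 7 ∷ 10 ∷ []) ∷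
      (1 ∷ 4 ∷ 4 ∷ 6 ∷ 6 ∷ 6 ∷ 11 ∷ 15 ∷ [] , 0 ∷ 0 ∷ 5 ∷ 7 ∷ 10 ∷ 12 ∷ []) ∷
      (6 ∷ 9 ∷ 12 ∷ 14 ∷ 14 ∷ 16 ∷ [] , 2 ∷ 5 ∷ 10 ∷ 13 ∷ []) ∷
      (1 ∷ 4 ∷ 6 ∷ 11 ∷ 14 ∷ 15 ∷ 17 ∷ [] , 2 ∷ 3 ∷ 5 ∷ 8 ∷ 10 ∷ []) ∷
      (0 ∷ 11 ∷ 14 ∷ 15 ∷ [] , 2 ∷ 3 ∷ 5 ∷ []) ∷
      (2 ∷ 4 ∷ 5 ∷ 16 ∷ [] , 0 ∷ 12 ∷ 14 ∷ []) ∷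
      (2 ∷ 2 ∷ 3 ∷ 3 ∷ 5 ∷ 6 ∷ 8 ∷ 10 ∷ 15 ∷ [] , 0 ∷ 0 ∷ 7 ∷ 9 ∷ 11 ∷ 12 ∷ 13 ∷ 14 ∷ []) ∷
      (2 ∷ 5 ∷ 7 ∷ 9 ∷ 17 ∷ 17 ∷ [] , 1 ∷ 6 ∷ 11 ∷ 13 ∷ []) ∷
      (1 ∷ 4 ∷ 6 ∷ 11 ∷ 13 ∷ 16 ∷ 17 ∷ [] , 0 ∷ 7 ∷ 9 ∷ 12 ∷ 14 ∷ []) ∷
      (16 ∷ [] , []) ∷
      (1 ∷ 3 ∷ 6 ∷ 17 ∷ [] , 0 ∷ 7 ∷ 9 ∷ []) ∷
      (0 ∷ 3 ∷ 6 ∷ 8 ∷ 8 ∷ 8 ∷ 10 ∷ 10 ∷ 14 ∷ 15 ∷ 16 ∷ 16 ∷ [] , 1 ∷ 1 ∷ 4 ∷ 4 ∷ 5 ∷ 5 ∷ 7 ∷ 13 ∷ []) ∷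
      (17 ∷ [] , []) ∷
      (2 ∷ 3 ∷ 7 ∷ 10 ∷ 14 ∷ 16 ∷ 16 ∷ 17 ∷ 17 ∷ [] , 1 ∷ 4 ∷ 11 ∷ 11 ∷ 13 ∷ 13 ∷ []) ∷
      []
  }

presentation4 : Presentation
presentation4 = record
  { m = 18
  ; k = 4
  ; lines =
      (0 , 1 , 2) ∷ (0 , 3 , 4) ∷ (0 , 5 , 6) ∷ (1 , 7 , 8) ∷ (1 , 9 , 10) ∷ (2 , 11 , 12) ∷
      (2 , 13 , 14) ∷ (3 , 7 , 11) ∷ (3 , 15 , 17) ∷ (4 , 9 , 13) ∷ (4 , 16 , 18) ∷ (5 , 9 , 11) ∷
      (5 , 16 , 17) ∷ (6 , 10 , 12) ∷ (6 , 15 , 18) ∷ (7 , 14 , 18) ∷ (8 , 12 , 16) ∷ (8 , 13 , 15) ∷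
      (10 , 14 , 17) ∷ []
  -- A parallelogram centred at the constant weight 1/3: the first and fourth vertices, as well as
  -- the second and third, add up to 2/3 at each point.
  ; vertices =
      (5 , 2 ∷ 4 ∷ 0 ∷ 3 ∷ 1 ∷ 2 ∷ 2 ∷ 0 ∷ 2 ∷ 1 ∷ 1 ∷ 3 ∷ 3 ∷ 4 ∷ 2 ∷ 0 ∷ 1 ∷ 3 ∷ 4 ∷ []) ∷
      (5 , 2 ∷ 0 ∷ 4 ∷ 3 ∷ 1 ∷ 2 ∷ 2 ∷ 2 ∷ 4 ∷ 3 ∷ 3 ∷ 1 ∷ 1 ∷ 2 ∷ 0 ∷ 0 ∷ 1 ∷ 3 ∷ 4 ∷ []) ∷
      (5 , 2 ∷ 4 ∷ 0 ∷ 1 ∷ 3 ∷ 2 ∷ 2 ∷ 2 ∷ 0 ∷ 1 ∷ 1 ∷ 3 ∷ 3 ∷ 2 ∷ 4 ∷ 4 ∷ 3 ∷ 1 ∷ 0 ∷ []) ∷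
      (5 , 2 ∷ 0 ∷ 4 ∷ 1 ∷ 3 ∷ 2 ∷ 2 ∷ 4 ∷ 2 ∷ 3 ∷ 3 ∷ 1 ∷ 1 ∷ 0 ∷ 2 ∷ 4 ∷ 3 ∷ 1 ∷ 0 ∷ []) ∷
      []
  ; certificates =
      (0 ∷ 0 ∷ 2 ∷ 7 ∷ 9 ∷ 15 ∷ 16 ∷ 17 ∷ 18 ∷ [] , 3 ∷ 3 ∷ 6 ∷ 6 ∷ 8 ∷ 10 ∷ 11 ∷ 13 ∷ []) ∷
      (1 ∷ 1 ∷ 1 ∷ 3 ∷ 4 ∷ 4 ∷ 6 ∷ 6 ∷ 6 ∷ 6 ∷ 7 ∷ 8 ∷ 8 ∷ 16 ∷ [] , 0 ∷ 0 ∷ 0 ∷ 5 ∷ 9 ∷ 9 ∷ 10 ∷ 15 ∷ 15 ∷ 17 ∷ 17 ∷ 18 ∷ 18 ∷ []) ∷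
      (1 ∷ 1 ∷ 1 ∷ 3 ∷ 3 ∷ 3 ∷ 3 ∷ 5 ∷ 5 ∷ 6 ∷ 9 ∷ 10 ∷ 10 ∷ 18 ∷ [] , 0 ∷ 0 ∷ 0 ∷ 4 ∷ 7 ∷ 7 ∷ 8 ∷ 15 ∷ 15 ∷ 16 ∷ 16 ∷ 17 ∷ 17 ∷ []) ∷
      (1 ∷ 1 ∷ 3 ∷ 4 ∷ 5 ∷ 6 ∷ 11 ∷ 12 ∷ 12 ∷ 13 ∷ 15 ∷ 17 ∷ [] , 0 ∷ 0 ∷ 7 ∷ 7 ∷ 9 ∷ 9 ∷ 14 ∷ 16 ∷ 16 ∷ 18 ∷ 18 ∷ []) ∷
      (3 ∷ 6 ∷ 7 ∷ 9 ∷ 14 ∷ 14 ∷ 14 ∷ 16 ∷ 18 ∷ [] , 4 ∷ 5 ∷ 8 ∷ 10 ∷ 15 ∷ 15 ∷ 17 ∷ 17 ∷ []) ∷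
      (4 ∷ 4 ∷ 7 ∷ 9 ∷ 9 ∷ 9 ∷ 9 ∷ 14 ∷ 14 ∷ 14 ∷ 15 ∷ 16 ∷ 16 ∷ 16 ∷ 16 ∷ 18 ∷ [] , 3 ∷ 3 ∷ 5 ∷ 6 ∷ 6 ∷ 8 ∷ 10 ∷ 10 ∷ 10 ∷ 10 ∷ 13 ∷ 13 ∷ 13 ∷ 17 ∷ 17 ∷ []) ∷
      (4 ∷ 4 ∷ 7 ∷ 10 ∷ 10 ∷ 13 ∷ 13 ∷ 13 ∷ 15 ∷ 17 ∷ 17 ∷ 17 ∷ 17 ∷ 18 ∷ [] , 3 ∷ 3 ∷ 5 ∷ 6 ∷ 6 ∷ 8 ∷ 9 ∷ 9 ∷ 14 ∷ 14 ∷ 14 ∷ 16 ∷ 16 ∷ []) ∷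
      (5 ∷ 5 ∷ 7 ∷ 7 ∷ 7 ∷ 7 ∷ 9 ∷ 14 ∷ 14 ∷ 14 ∷ 16 ∷ 17 ∷ 18 ∷ 18 ∷ 18 ∷ 18 ∷ [] , 3 ∷ 3 ∷ 4 ∷ 6 ∷ 6 ∷ 8 ∷ 8 ∷ 8 ∷ 8 ∷ 10 ∷ 13 ∷ 13 ∷ 13 ∷ 15 ∷ 15 ∷ []) ∷
      (5 ∷ 5 ∷ 8 ∷ 8 ∷ 9 ∷ 13 ∷ 13 ∷ 13 ∷ 15 ∷ 15 ∷ 15 ∷ 15 ∷ 16 ∷ 17 ∷ [] , 3 ∷ 3 ∷ 4 ∷ 6 ∷ 6 ∷ 7 ∷ 7 ∷ 10 ∷ 14 ∷ 14 ∷ 14 ∷ 18 ∷ 18 ∷ []) ∷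
      (0 ∷ 0 ∷ 0 ∷ 6 ∷ 7 ∷ 7 ∷ 7 ∷ 7 ∷ 9 ∷ 10 ∷ 10 ∷ 16 ∷ 16 ∷ 16 ∷ 16 ∷ 18 ∷ [] , 1 ∷ 1 ∷ 1 ∷ 3 ∷ 3 ∷ 4 ∷ 5 ∷ 5 ∷ 5 ∷ 5 ∷ 8 ∷ 15 ∷ 15 ∷ 17 ∷ 17 ∷ []) ∷
      (0 ∷ 0 ∷ 0 ∷ 3 ∷ 7 ∷ 8 ∷ 8 ∷ 9 ∷ 9 ∷ 9 ∷ 9 ∷ 16 ∷ 18 ∷ 18 ∷ 18 ∷ 18 ∷ [] , 1 ∷ 1 ∷ 1 ∷ 4 ∷ 4 ∷ 4 ∷ 4 ∷ 5 ∷ 6 ∷ 6 ∷ 10 ∷ 15 ∷ 15 ∷ 17 ∷ 17 ∷ []) ∷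
      (3 ∷ 3 ∷ 4 ∷ 5 ∷ 6 ∷ 6 ∷ 8 ∷ 10 ∷ [] , 7 ∷ 9 ∷ 15 ∷ 16 ∷ 17 ∷ 18 ∷ []) ∷
      (0 ∷ 2 ∷ 3 ∷ 3 ∷ 7 ∷ 7 ∷ 9 ∷ 9 ∷ 12 ∷ 13 ∷ 15 ∷ 15 ∷ [] , 1 ∷ 1 ∷ 6 ∷ 11 ∷ 11 ∷ 14 ∷ 14 ∷ 16 ∷ 17 ∷ 18 ∷ []) ∷
      (1 ∷ 2 ∷ 3 ∷ 3 ∷ 3 ∷ 3 ∷ 3 ∷ 6 ∷ 6 ∷ 11 ∷ 14 ∷ 16 ∷ 16 ∷ 18 ∷ 18 ∷ [] , 0 ∷ 0 ∷ 7 ∷ 9 ∷ 12 ∷ 12 ∷ 13 ∷ 13 ∷ 15 ∷ 15 ∷ 15 ∷ 15 ∷ 17 ∷ []) ∷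
      (0 ∷ 6 ∷ 6 ∷ 7 ∷ 7 ∷ 9 ∷ 9 ∷ 12 ∷ 12 ∷ 13 ∷ 17 ∷ 17 ∷ [] , 1 ∷ 3 ∷ 8 ∷ 10 ∷ 11 ∷ 11 ∷ 14 ∷ 15 ∷ 16 ∷ 18 ∷ []) ∷
      (1 ∷ 2 ∷ 3 ∷ 3 ∷ 6 ∷ 6 ∷ 6 ∷ 6 ∷ 6 ∷ 11 ∷ 14 ∷ 16 ∷ 16 ∷ 18 ∷ 18 ∷ [] , 0 ∷ 0 ∷ 7 ∷ 9 ∷ 12 ∷ 12 ∷ 13 ∷ 13 ∷ 15 ∷ 17 ∷ 17 ∷ 17 ∷ 17 ∷ []) ∷
      (3 ∷ 7 ∷ 9 ∷ 15 ∷ 16 ∷ 17 ∷ 18 ∷ [] , 4 ∷ 5 ∷ 6 ∷ 6 ∷ 8 ∷ 10 ∷ []) ∷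
      (0 ∷ 7 ∷ 7 ∷ 9 ∷ 9 ∷ 12 ∷ 12 ∷ 13 ∷ 15 ∷ 15 ∷ 17 ∷ 17 ∷ [] , 1 ∷ 3 ∷ 6 ∷ 8 ∷ 10 ∷ 11 ∷ 11 ∷ 14 ∷ 16 ∷ 18 ∷ []) ∷
      (3 ∷ 6 ∷ 7 ∷ 9 ∷ 15 ∷ 16 ∷ 18 ∷ [] , 4 ∷ 5 ∷ 8 ∷ 10 ∷ 17 ∷ 17 ∷ []) ∷
      (0 ∷ 7 ∷ 7 ∷ 9 ∷ 9 ∷ 12 ∷ 12 ∷ 13 ∷ 15 ∷ 15 ∷ 15 ∷ 15 ∷ 15 ∷ 17 ∷ 17 ∷ [] , 1 ∷ 3 ∷ 6 ∷ 6 ∷ 6 ∷ 6 ∷ 8 ∷ 10 ∷ 11 ∷ 11 ∷ 14 ∷ 16 ∷ 18 ∷ []) ∷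
      (3 ∷ 6 ∷ 7 ∷ 9 ∷ 16 ∷ 17 ∷ 18 ∷ [] , 4 ∷ 5 ∷ 8 ∷ 10 ∷ 15 ∷ 15 ∷ []) ∷
      (1 ∷ 2 ∷ 3 ∷ 3 ∷ 6 ∷ 6 ∷ 11 ∷ 14 ∷ 16 ∷ 16 ∷ 18 ∷ 18 ∷ [] , 0 ∷ 0 ∷ 7 ∷ 9 ∷ 12 ∷ 12 ∷ 13 ∷ 13 ∷ 15 ∷ 17 ∷ []) ∷
      (1 ∷ 3 ∷ 3 ∷ 11 ∷ 11 ∷ 14 ∷ 16 ∷ 16 ∷ 17 ∷ 17 ∷ 18 ∷ 18 ∷ [] , 0 ∷ 4 ∷ 5 ∷ 6 ∷ 7 ∷ 9 ∷ 12 ∷ 12 ∷ 13 ∷ 15 ∷ []) ∷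
      (6 ∷ 7 ∷ 9 ∷ 15 ∷ 16 ∷ 17 ∷ 18 ∷ [] , 3 ∷ 3 ∷ 4 ∷ 5 ∷ 8 ∷ 10 ∷ []) ∷
      (0 ∷ 7 ∷ 7 ∷ 9 ∷ 9 ∷ 12 ∷ 12 ∷ 13 ∷ 15 ∷ 15 ∷ 17 ∷ 17 ∷ 17 ∷ 17 ∷ 17 ∷ [] , 1 ∷ 3 ∷ 3 ∷ 3 ∷ 3 ∷ 6 ∷ 8 ∷ 10 ∷ 11 ∷ 11 ∷ 14 ∷ 16 ∷ 18 ∷ []) ∷
      (1 ∷ 6 ∷ 6 ∷ 11 ∷ 11 ∷ 14 ∷ 15 ∷ 15 ∷ 16 ∷ 16 ∷ 18 ∷ 18 ∷ [] , 0 ∷ 3 ∷ 4 ∷ 5 ∷ 7 ∷ 9 ∷ 12 ∷ 12 ∷ 13 ∷ 17 ∷ []) ∷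
      (4 ∷ 5 ∷ 8 ∷ 10 ∷ 15 ∷ 15 ∷ 17 ∷ 17 ∷ [] , 3 ∷ 6 ∷ 7 ∷ 9 ∷ 16 ∷ 18 ∷ []) ∷
      []
  }

presentation5 : Presentation
presentation5 = record
  { m = 18
  ; k = 5
  ; lines =
      (0 , 1 , 2) ∷ (0 , 3 , 4) ∷ (0 , 5 , 6) ∷ (1 , 7 , 8) ∷ (1 , 9 , 10) ∷ (2 , 11 , 12) ∷
      (2 , 13 , 14) ∷ (3 , 8 , 16) ∷ (3 , 10 , 18) ∷ (4 , 9 , 17) ∷ (4 , 14 , 15) ∷ (5 , 8 , 11) ∷
      (5 , 10 , 14) ∷ (6 , 7 , 13) ∷ (6 , 9 , 12) ∷ (7 , 15 , 18) ∷ (11 , 17 , 18) ∷ (12 , 15 , 16) ∷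
      (13 , 16 , 17) ∷ []
  -- A pentagon. In units of 1/3, the weights x and y of the points 0 and 15 range over a square of
  -- side 2, and all others are affine in them; the weight 1 - x + y of point 3 must be nonnegative,
  -- which cuts off one corner.
  ; vertices =
      (2 , 0 ∷ 2 ∷ 1 ∷ 3 ∷ 0 ∷ 2 ∷ 1 ∷ 1 ∷ 0 ∷ 1 ∷ 0 ∷ 1 ∷ 1 ∷ 1 ∷ 1 ∷ 2 ∷ 0 ∷ 2 ∷ 0 ∷ []) ∷
      (2 , 0 ∷ 2 ∷ 1 ∷ 1 ∷ 2 ∷ 2 ∷ 1 ∷ 1 ∷ 0 ∷ 1 ∷ 0 ∷ 1 ∷ 1 ∷ 1 ∷ 1 ∷ 0 ∷ 2 ∷ 0 ∷ 2 ∷ []) ∷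
      (2 , 2 ∷ 0 ∷ 1 ∷ 1 ∷ 0 ∷ 0 ∷ 1 ∷ 1 ∷ 2 ∷ 1 ∷ 2 ∷ 1 ∷ 1 ∷ 1 ∷ 1 ∷ 2 ∷ 0 ∷ 2 ∷ 0 ∷ []) ∷
      (2 , 2 ∷ 0 ∷ 1 ∷ 0 ∷ 1 ∷ 0 ∷ 1 ∷ 1 ∷ 2 ∷ 1 ∷ 2 ∷ 1 ∷ 1 ∷ 1 ∷ 1 ∷ 1 ∷ 1 ∷ 1 ∷ 1 ∷ []) ∷
      (2 , 1 ∷ 1 ∷ 1 ∷ 0 ∷ 2 ∷ 1 ∷ 1 ∷ 1 ∷ 1 ∷ 1 ∷ 1 ∷ 1 ∷ 1 ∷ 1 ∷ 1 ∷ 0 ∷ 2 ∷ 0 ∷ 2 ∷ []) ∷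
      []
  ; certificates =
      (0 ∷ 0 ∷ 5 ∷ 7 ∷ 8 ∷ 9 ∷ 9 ∷ 13 ∷ [] , 1 ∷ 1 ∷ 3 ∷ 4 ∷ 14 ∷ 16 ∷ 18 ∷ []) ∷
      (2 ∷ 2 ∷ 5 ∷ 7 ∷ 8 ∷ 10 ∷ 10 ∷ 13 ∷ [] , 1 ∷ 1 ∷ 6 ∷ 11 ∷ 12 ∷ 15 ∷ 17 ∷ []) ∷
      (1 ∷ 5 ∷ 7 ∷ 12 ∷ 12 ∷ 13 ∷ 15 ∷ 15 ∷ [] , 2 ∷ 6 ∷ 8 ∷ 8 ∷ 10 ∷ 11 ∷ 17 ∷ []) ∷
      (1 ∷ 4 ∷ 4 ∷ 6 ∷ 7 ∷ 14 ∷ 15 ∷ 15 ∷ [] , 0 ∷ 3 ∷ 8 ∷ 8 ∷ 10 ∷ 13 ∷ 17 ∷ []) ∷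
      (1 ∷ 4 ∷ 4 ∷ 5 ∷ 7 ∷ 13 ∷ 16 ∷ 16 ∷ [] , 0 ∷ 3 ∷ 8 ∷ 8 ∷ 9 ∷ 14 ∷ 18 ∷ []) ∷
      (1 ∷ 3 ∷ 3 ∷ 6 ∷ 8 ∷ 14 ∷ 17 ∷ 17 ∷ [] , 0 ∷ 4 ∷ 7 ∷ 7 ∷ 10 ∷ 13 ∷ 15 ∷ []) ∷
      (1 ∷ 6 ∷ 8 ∷ 11 ∷ 11 ∷ 14 ∷ 18 ∷ 18 ∷ [] , 2 ∷ 5 ∷ 7 ∷ 7 ∷ 9 ∷ 12 ∷ 16 ∷ []) ∷
      (1 ∷ 6 ∷ 7 ∷ 12 ∷ 12 ∷ 14 ∷ 16 ∷ 16 ∷ [] , 2 ∷ 5 ∷ 8 ∷ 8 ∷ 9 ∷ 11 ∷ 18 ∷ []) ∷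
      (0 ∷ 1 ∷ 1 ∷ 3 ∷ 4 ∷ 14 ∷ 16 ∷ 18 ∷ [] , 5 ∷ 7 ∷ 8 ∷ 9 ∷ 9 ∷ 13 ∷ []) ∷
      (1 ∷ 1 ∷ 1 ∷ 1 ∷ 1 ∷ 1 ∷ 1 ∷ 1 ∷ 6 ∷ 7 ∷ 7 ∷ 12 ∷ 12 ∷ 12 ∷ 12 ∷ 14 ∷ 14 ∷ 14 ∷ 15 ∷ 16 ∷ 16 ∷ 16 ∷ [] , 2 ∷ 2 ∷ 5 ∷ 8 ∷ 8 ∷ 8 ∷ 8 ∷ 9 ∷ 9 ∷ 9 ∷ 10 ∷ 10 ∷ 10 ∷ 10 ∷ 10 ∷ 11 ∷ 11 ∷ 13 ∷ 17 ∷ 17 ∷ []) ∷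
      (1 ∷ 1 ∷ 2 ∷ 6 ∷ 11 ∷ 12 ∷ 15 ∷ 17 ∷ [] , 5 ∷ 7 ∷ 8 ∷ 10 ∷ 10 ∷ 13 ∷ []) ∷
      (0 ∷ 0 ∷ 3 ∷ 3 ∷ 3 ∷ 3 ∷ 3 ∷ 6 ∷ 8 ∷ 8 ∷ 8 ∷ 8 ∷ 10 ∷ 10 ∷ 11 ∷ 11 ∷ 11 ∷ 14 ∷ 17 ∷ 17 ∷ [] , 1 ∷ 1 ∷ 4 ∷ 5 ∷ 5 ∷ 5 ∷ 7 ∷ 7 ∷ 12 ∷ 12 ∷ 12 ∷ 13 ∷ 15 ∷ 15 ∷ 15 ∷ 15 ∷ []) ∷
      (0 ∷ 3 ∷ 4 ∷ 8 ∷ 8 ∷ 10 ∷ 13 ∷ 17 ∷ [] , 1 ∷ 6 ∷ 7 ∷ 14 ∷ 15 ∷ 15 ∷ []) ∷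
      (0 ∷ 0 ∷ 0 ∷ 0 ∷ 3 ∷ 4 ∷ 8 ∷ 8 ∷ 10 ∷ 10 ∷ 10 ∷ 10 ∷ 11 ∷ 11 ∷ 11 ∷ 13 ∷ 17 ∷ 17 ∷ 17 ∷ 17 ∷ [] , 1 ∷ 1 ∷ 1 ∷ 1 ∷ 5 ∷ 5 ∷ 5 ∷ 6 ∷ 7 ∷ 7 ∷ 7 ∷ 7 ∷ 12 ∷ 12 ∷ 12 ∷ 14 ∷ 15 ∷ 15 ∷ []) ∷
      (0 ∷ 0 ∷ 3 ∷ 3 ∷ 8 ∷ 9 ∷ 10 ∷ 16 ∷ 17 ∷ 18 ∷ [] , 1 ∷ 1 ∷ 4 ∷ 5 ∷ 6 ∷ 7 ∷ 7 ∷ 15 ∷ 15 ∷ []) ∷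
      (1 ∷ 5 ∷ 7 ∷ 8 ∷ 10 ∷ 10 ∷ 13 ∷ [] , 2 ∷ 6 ∷ 11 ∷ 12 ∷ 15 ∷ 17 ∷ []) ∷
      (1 ∷ 3 ∷ 3 ∷ 6 ∷ 7 ∷ 8 ∷ 14 ∷ [] , 0 ∷ 4 ∷ 10 ∷ 13 ∷ 15 ∷ 17 ∷ []) ∷
      (1 ∷ 1 ∷ 4 ∷ 4 ∷ 5 ∷ 5 ∷ 5 ∷ 7 ∷ 7 ∷ 8 ∷ 8 ∷ 12 ∷ 12 ∷ 13 ∷ [] , 0 ∷ 0 ∷ 6 ∷ 9 ∷ 10 ∷ 11 ∷ 11 ∷ 14 ∷ 15 ∷ 16 ∷ 17 ∷ 17 ∷ []) ∷
      (1 ∷ 4 ∷ 4 ∷ 5 ∷ 7 ∷ 7 ∷ 7 ∷ 7 ∷ 13 ∷ 16 ∷ 16 ∷ [] , 0 ∷ 3 ∷ 8 ∷ 8 ∷ 9 ∷ 11 ∷ 11 ∷ 11 ∷ 14 ∷ 18 ∷ []) ∷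
      (1 ∷ 6 ∷ 7 ∷ 8 ∷ 14 ∷ 15 ∷ 15 ∷ [] , 0 ∷ 3 ∷ 4 ∷ 10 ∷ 13 ∷ 17 ∷ []) ∷
      (2 ∷ 2 ∷ 5 ∷ 8 ∷ 8 ∷ 8 ∷ 8 ∷ 9 ∷ 9 ∷ 9 ∷ 10 ∷ 10 ∷ 10 ∷ 10 ∷ 10 ∷ 11 ∷ 11 ∷ 13 ∷ 17 ∷ 17 ∷ [] , 1 ∷ 1 ∷ 6 ∷ 7 ∷ 7 ∷ 12 ∷ 12 ∷ 12 ∷ 12 ∷ 14 ∷ 14 ∷ 14 ∷ 15 ∷ 16 ∷ 16 ∷ 16 ∷ []) ∷
      (0 ∷ 3 ∷ 8 ∷ 8 ∷ 9 ∷ 9 ∷ 9 ∷ 10 ∷ 13 ∷ 17 ∷ [] , 1 ∷ 4 ∷ 4 ∷ 6 ∷ 7 ∷ 14 ∷ 15 ∷ 15 ∷ []) ∷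
      (0 ∷ 3 ∷ 8 ∷ 8 ∷ 9 ∷ 11 ∷ 11 ∷ 11 ∷ 14 ∷ 18 ∷ [] , 1 ∷ 4 ∷ 4 ∷ 5 ∷ 7 ∷ 13 ∷ 16 ∷ 16 ∷ []) ∷
      (2 ∷ 5 ∷ 8 ∷ 8 ∷ 9 ∷ 11 ∷ 12 ∷ 18 ∷ [] , 1 ∷ 6 ∷ 7 ∷ 14 ∷ 16 ∷ 16 ∷ []) ∷
      (2 ∷ 2 ∷ 8 ∷ 9 ∷ 10 ∷ 11 ∷ 11 ∷ 15 ∷ 17 ∷ 18 ∷ [] , 1 ∷ 1 ∷ 7 ∷ 7 ∷ 12 ∷ 13 ∷ 14 ∷ 16 ∷ 16 ∷ []) ∷
      (0 ∷ 2 ∷ 3 ∷ 8 ∷ 9 ∷ 9 ∷ 11 ∷ 12 ∷ 18 ∷ 18 ∷ [] , 1 ∷ 1 ∷ 4 ∷ 4 ∷ 6 ∷ 7 ∷ 7 ∷ 13 ∷ 16 ∷ []) ∷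
      (0 ∷ 4 ∷ 7 ∷ 7 ∷ 10 ∷ 13 ∷ 15 ∷ 17 ∷ [] , 1 ∷ 3 ∷ 3 ∷ 6 ∷ 8 ∷ 14 ∷ []) ∷
      (2 ∷ 6 ∷ 8 ∷ 8 ∷ 10 ∷ 11 ∷ 15 ∷ 17 ∷ [] , 1 ∷ 5 ∷ 7 ∷ 12 ∷ 12 ∷ 13 ∷ []) ∷
      (2 ∷ 5 ∷ 7 ∷ 7 ∷ 9 ∷ 12 ∷ 16 ∷ 18 ∷ [] , 1 ∷ 6 ∷ 8 ∷ 11 ∷ 11 ∷ 14 ∷ []) ∷
      (0 ∷ 3 ∷ 8 ∷ 8 ∷ 9 ∷ 14 ∷ 16 ∷ 18 ∷ [] , 1 ∷ 4 ∷ 4 ∷ 5 ∷ 7 ∷ 13 ∷ []) ∷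
      []
  }

presentation6 : Presentation
presentation6 = record
  { m = 18
  ; k = 6
  ; lines =
      (0 , 1 , 2) ∷ (0 , 3 , 4) ∷ (0 , 5 , 6) ∷ (1 , 7 , 8) ∷ (1 , 9 , 10) ∷ (2 , 11 , 12) ∷
      (2 , 13 , 14) ∷ (3 , 7 , 15) ∷ (3 , 17 , 18) ∷ (4 , 8 , 12) ∷ (4 , 10 , 16) ∷ (5 , 7 , 14) ∷
      (5 , 11 , 16) ∷ (6 , 9 , 15) ∷ (6 , 12 , 18) ∷ (8 , 13 , 17) ∷ (9 , 11 , 17) ∷ (10 , 14 , 18) ∷
      (13 , 15 , 16) ∷ []
  -- An affinely regular hexagon centred at the constant weight 1/3: opposite vertices add up to 2/3
  -- at each point, and the displacement of the fourth vertex from the centre is the second vertex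
  -- minus the first.
  ; vertices =
      (8 , 5 ∷ 0 ∷ 4 ∷ 4 ∷ 0 ∷ 2 ∷ 2 ∷ 4 ∷ 5 ∷ 6 ∷ 3 ∷ 1 ∷ 4 ∷ 2 ∷ 3 ∷ 1 ∷ 6 ∷ 2 ∷ 3 ∷ []) ∷
      (8 , 4 ∷ 0 ∷ 5 ∷ 2 ∷ 3 ∷ 4 ∷ 1 ∷ 5 ∷ 4 ∷ 6 ∷ 3 ∷ 2 ∷ 2 ∷ 4 ∷ 0 ∷ 2 ∷ 3 ∷ 1 ∷ 6 ∷ []) ∷
      (8 , 1 ∷ 6 ∷ 2 ∷ 2 ∷ 6 ∷ 4 ∷ 4 ∷ 2 ∷ 1 ∷ 0 ∷ 3 ∷ 5 ∷ 2 ∷ 4 ∷ 3 ∷ 5 ∷ 0 ∷ 4 ∷ 3 ∷ []) ∷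
      (8 , 2 ∷ 3 ∷ 4 ∷ 1 ∷ 6 ∷ 5 ∷ 2 ∷ 4 ∷ 2 ∷ 3 ∷ 3 ∷ 4 ∷ 1 ∷ 5 ∷ 0 ∷ 4 ∷ 0 ∷ 2 ∷ 6 ∷ []) ∷
      (8 , 4 ∷ 3 ∷ 2 ∷ 5 ∷ 0 ∷ 1 ∷ 4 ∷ 2 ∷ 4 ∷ 3 ∷ 3 ∷ 2 ∷ 5 ∷ 1 ∷ 6 ∷ 2 ∷ 6 ∷ 4 ∷ 0 ∷ []) ∷
      (8 , 2 ∷ 6 ∷ 1 ∷ 4 ∷ 3 ∷ 2 ∷ 5 ∷ 1 ∷ 2 ∷ 0 ∷ 3 ∷ 4 ∷ 4 ∷ 2 ∷ 6 ∷ 4 ∷ 3 ∷ 5 ∷ 0 ∷ []) ∷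
      []
  ; certificates =
      (0 ∷ 0 ∷ 0 ∷ 1 ∷ 1 ∷ 1 ∷ 2 ∷ 2 ∷ 2 ∷ 5 ∷ 7 ∷ 15 ∷ 15 ∷ 16 ∷ 16 ∷ 17 ∷ 17 ∷ 17 ∷ 17 ∷ 18 ∷ 18 ∷ [] , 3 ∷ 4 ∷ 4 ∷ 6 ∷ 6 ∷ 6 ∷ 6 ∷ 8 ∷ 8 ∷ 8 ∷ 8 ∷ 9 ∷ 10 ∷ 10 ∷ 12 ∷ 12 ∷ 12 ∷ 13 ∷ 13 ∷ 13 ∷ []) ∷
      (0 ∷ 0 ∷ 2 ∷ 2 ∷ 5 ∷ 5 ∷ 5 ∷ 5 ∷ 6 ∷ 6 ∷ 6 ∷ 7 ∷ 8 ∷ 8 ∷ 8 ∷ 10 ∷ 10 ∷ 10 ∷ 10 ∷ 13 ∷ 13 ∷ [] , 1 ∷ 1 ∷ 1 ∷ 1 ∷ 4 ∷ 4 ∷ 11 ∷ 12 ∷ 14 ∷ 14 ∷ 14 ∷ 14 ∷ 16 ∷ 16 ∷ 16 ∷ 17 ∷ 17 ∷ 18 ∷ 18 ∷ 18 ∷ []) ∷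
      (1 ∷ 1 ∷ 2 ∷ 4 ∷ 4 ∷ 4 ∷ 4 ∷ 6 ∷ 6 ∷ 6 ∷ 7 ∷ 7 ∷ 7 ∷ 7 ∷ 7 ∷ 8 ∷ 8 ∷ 12 ∷ 12 ∷ 12 ∷ 15 ∷ [] , 0 ∷ 0 ∷ 0 ∷ 3 ∷ 10 ∷ 10 ∷ 11 ∷ 11 ∷ 11 ∷ 11 ∷ 13 ∷ 16 ∷ 16 ∷ 16 ∷ 17 ∷ 17 ∷ 18 ∷ 18 ∷ 18 ∷ 18 ∷ []) ∷
      (2 ∷ 2 ∷ 2 ∷ 2 ∷ 2 ∷ 4 ∷ 4 ∷ 4 ∷ 4 ∷ 5 ∷ 7 ∷ 8 ∷ 8 ∷ 8 ∷ 9 ∷ 9 ∷ 9 ∷ 11 ∷ 11 ∷ 12 ∷ 12 ∷ [] , 0 ∷ 1 ∷ 1 ∷ 1 ∷ 1 ∷ 3 ∷ 3 ∷ 3 ∷ 10 ∷ 10 ∷ 13 ∷ 14 ∷ 14 ∷ 14 ∷ 14 ∷ 16 ∷ 16 ∷ 16 ∷ 17 ∷ 17 ∷ []) ∷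
      (2 ∷ 2 ∷ 2 ∷ 3 ∷ 3 ∷ 5 ∷ 6 ∷ 6 ∷ 7 ∷ 10 ∷ 10 ∷ 10 ∷ 10 ∷ 13 ∷ 13 ∷ 13 ∷ 14 ∷ 14 ∷ 14 ∷ 15 ∷ 15 ∷ [] , 0 ∷ 0 ∷ 0 ∷ 4 ∷ 4 ∷ 8 ∷ 9 ∷ 9 ∷ 9 ∷ 9 ∷ 11 ∷ 11 ∷ 11 ∷ 16 ∷ 17 ∷ 17 ∷ 18 ∷ 18 ∷ 18 ∷ 18 ∷ []) ∷
      (2 ∷ 3 ∷ 3 ∷ 3 ∷ 5 ∷ 5 ∷ 7 ∷ 7 ∷ 7 ∷ 10 ∷ 10 ∷ 10 ∷ 10 ∷ 11 ∷ 11 ∷ 11 ∷ 14 ∷ 14 ∷ 15 ∷ 16 ∷ 16 ∷ [] , 0 ∷ 4 ∷ 4 ∷ 6 ∷ 8 ∷ 8 ∷ 8 ∷ 9 ∷ 9 ∷ 9 ∷ 9 ∷ 12 ∷ 12 ∷ 12 ∷ 12 ∷ 13 ∷ 13 ∷ 13 ∷ 17 ∷ 17 ∷ []) ∷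
      (2 ∷ 2 ∷ 3 ∷ 3 ∷ 3 ∷ 5 ∷ 7 ∷ 9 ∷ 9 ∷ 9 ∷ 12 ∷ 12 ∷ 13 ∷ 13 ∷ 15 ∷ 15 ∷ 15 ∷ 17 ∷ 17 ∷ 17 ∷ 17 ∷ [] , 0 ∷ 1 ∷ 4 ∷ 4 ∷ 10 ∷ 10 ∷ 11 ∷ 11 ∷ 11 ∷ 11 ∷ 14 ∷ 14 ∷ 14 ∷ 14 ∷ 16 ∷ 16 ∷ 16 ∷ 18 ∷ 18 ∷ 18 ∷ []) ∷
      (2 ∷ 2 ∷ 4 ∷ 5 ∷ 7 ∷ 10 ∷ 17 ∷ [] , 0 ∷ 1 ∷ 11 ∷ 12 ∷ 13 ∷ 14 ∷ []) ∷
      (1 ∷ 1 ∷ 2 ∷ 2 ∷ 3 ∷ 3 ∷ 3 ∷ 5 ∷ 5 ∷ 5 ∷ 5 ∷ 7 ∷ 12 ∷ 12 ∷ 16 ∷ 16 ∷ 16 ∷ 17 ∷ 17 ∷ 17 ∷ 17 ∷ [] , 0 ∷ 0 ∷ 0 ∷ 0 ∷ 4 ∷ 4 ∷ 8 ∷ 8 ∷ 8 ∷ 9 ∷ 9 ∷ 9 ∷ 10 ∷ 10 ∷ 11 ∷ 11 ∷ 11 ∷ 11 ∷ 13 ∷ 14 ∷ []) ∷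
      (2 ∷ 2 ∷ 4 ∷ 4 ∷ 4 ∷ 4 ∷ 5 ∷ 5 ∷ 5 ∷ 5 ∷ 7 ∷ 9 ∷ 9 ∷ 9 ∷ 11 ∷ 11 ∷ 14 ∷ 14 ∷ 18 ∷ 18 ∷ 18 ∷ [] , 0 ∷ 1 ∷ 3 ∷ 3 ∷ 3 ∷ 6 ∷ 6 ∷ 6 ∷ 10 ∷ 10 ∷ 12 ∷ 12 ∷ 12 ∷ 12 ∷ 13 ∷ 13 ∷ 13 ∷ 13 ∷ 17 ∷ 17 ∷ []) ∷
      (1 ∷ 1 ∷ 2 ∷ 2 ∷ 4 ∷ 4 ∷ 4 ∷ 4 ∷ 5 ∷ 6 ∷ 6 ∷ 6 ∷ 7 ∷ 14 ∷ 14 ∷ 15 ∷ 15 ∷ 15 ∷ 18 ∷ 18 ∷ 18 ∷ [] , 0 ∷ 0 ∷ 0 ∷ 0 ∷ 8 ∷ 8 ∷ 8 ∷ 9 ∷ 9 ∷ 9 ∷ 10 ∷ 10 ∷ 11 ∷ 12 ∷ 13 ∷ 13 ∷ 13 ∷ 13 ∷ 17 ∷ 17 ∷ []) ∷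
      (0 ∷ 0 ∷ 0 ∷ 2 ∷ 7 ∷ 7 ∷ 7 ∷ 7 ∷ 7 ∷ 9 ∷ 9 ∷ 9 ∷ 13 ∷ 13 ∷ 15 ∷ 17 ∷ 17 ∷ 17 ∷ 17 ∷ 18 ∷ 18 ∷ [] , 1 ∷ 1 ∷ 1 ∷ 1 ∷ 3 ∷ 3 ∷ 3 ∷ 3 ∷ 4 ∷ 4 ∷ 6 ∷ 6 ∷ 6 ∷ 8 ∷ 10 ∷ 10 ∷ 11 ∷ 14 ∷ 14 ∷ 14 ∷ []) ∷
      (0 ∷ 0 ∷ 2 ∷ 2 ∷ 5 ∷ 7 ∷ 8 ∷ 8 ∷ 8 ∷ 10 ∷ 10 ∷ 10 ∷ 10 ∷ 11 ∷ 11 ∷ 15 ∷ 15 ∷ 15 ∷ 16 ∷ 16 ∷ 16 ∷ [] , 1 ∷ 1 ∷ 1 ∷ 1 ∷ 3 ∷ 3 ∷ 3 ∷ 4 ∷ 4 ∷ 6 ∷ 6 ∷ 6 ∷ 12 ∷ 12 ∷ 12 ∷ 12 ∷ 13 ∷ 14 ∷ 17 ∷ 17 ∷ []) ∷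
      (0 ∷ 1 ∷ 4 ∷ 4 ∷ 11 ∷ 12 ∷ 13 ∷ 14 ∷ [] , 2 ∷ 2 ∷ 5 ∷ 7 ∷ 10 ∷ 17 ∷ []) ∷
      (0 ∷ 0 ∷ 0 ∷ 3 ∷ 4 ∷ 4 ∷ 8 ∷ 10 ∷ 10 ∷ 12 ∷ 12 ∷ 12 ∷ 14 ∷ 14 ∷ 14 ∷ 18 ∷ [] , 1 ∷ 2 ∷ 2 ∷ 5 ∷ 5 ∷ 6 ∷ 9 ∷ 11 ∷ 13 ∷ 16 ∷ 17 ∷ 17 ∷ 17 ∷ 17 ∷ []) ∷
      (0 ∷ 0 ∷ 0 ∷ 3 ∷ 4 ∷ 4 ∷ 8 ∷ 12 ∷ 12 ∷ 12 ∷ 14 ∷ 14 ∷ 14 ∷ 17 ∷ 17 ∷ 18 ∷ [] , 1 ∷ 2 ∷ 2 ∷ 5 ∷ 5 ∷ 6 ∷ 9 ∷ 10 ∷ 10 ∷ 10 ∷ 10 ∷ 11 ∷ 13 ∷ 16 ∷ []) ∷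
      (1 ∷ 4 ∷ 6 ∷ 9 ∷ 10 ∷ 11 ∷ 13 ∷ 16 ∷ [] , 2 ∷ 3 ∷ 5 ∷ 8 ∷ 17 ∷ 17 ∷ 18 ∷ []) ∷
      (1 ∷ 6 ∷ 9 ∷ 10 ∷ 11 ∷ 13 ∷ 16 ∷ 17 ∷ [] , 2 ∷ 3 ∷ 4 ∷ 4 ∷ 5 ∷ 8 ∷ 18 ∷ []) ∷
      (0 ∷ 1 ∷ 10 ∷ 10 ∷ 11 ∷ 12 ∷ 13 ∷ 14 ∷ [] , 2 ∷ 2 ∷ 4 ∷ 5 ∷ 7 ∷ 17 ∷ []) ∷
      (1 ∷ 4 ∷ 6 ∷ 9 ∷ 11 ∷ 13 ∷ 16 ∷ 17 ∷ [] , 2 ∷ 3 ∷ 5 ∷ 8 ∷ 10 ∷ 10 ∷ 18 ∷ []) ∷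
      (0 ∷ 1 ∷ 11 ∷ 12 ∷ 13 ∷ 14 ∷ 17 ∷ 17 ∷ [] , 2 ∷ 2 ∷ 4 ∷ 5 ∷ 7 ∷ 10 ∷ []) ∷
      (0 ∷ 0 ∷ 0 ∷ 3 ∷ 8 ∷ 10 ∷ 10 ∷ 12 ∷ 12 ∷ 12 ∷ 14 ∷ 14 ∷ 14 ∷ 17 ∷ 17 ∷ 18 ∷ [] , 1 ∷ 2 ∷ 2 ∷ 4 ∷ 4 ∷ 4 ∷ 4 ∷ 5 ∷ 5 ∷ 6 ∷ 9 ∷ 11 ∷ 13 ∷ 16 ∷ []) ∷
      []
  }

presentation7 : Presentation
presentation7 = record
  { m = 17
  ; k = 7
  ; lines =
      (0 , 1 , 2) ∷ (0 , 3 , 4) ∷ (0 , 5 , 6) ∷ (1 , 7 , 8) ∷ (1 , 9 , 10) ∷ (2 , 11 , 12) ∷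
      (2 , 13 , 14) ∷ (3 , 8 , 14) ∷ (3 , 10 , 15) ∷ (4 , 9 , 13) ∷ (4 , 12 , 17) ∷ (5 , 12 , 15) ∷
      (5 , 14 , 16) ∷ (6 , 8 , 11) ∷ (6 , 10 , 17) ∷ (7 , 13 , 15) ∷ (7 , 16 , 17) ∷ (9 , 11 , 16) ∷ []
  -- Point 13 has weight 1 at the first three vertices and 0 at the other four, which gives two
  -- opposite faces: a triangle, and a parallelogram whose diagonals join the fourth to the fifth
  -- and the sixth to the seventh vertex.
  ; vertices =
      (0 , 0 ∷ 1 ∷ 0 ∷ 1 ∷ 0 ∷ 1 ∷ 0 ∷ 0 ∷ 0 ∷ 0 ∷ 0 ∷ 1 ∷ 0 ∷ 1 ∷ 0 ∷ 0 ∷ 0 ∷ 1 ∷ []) ∷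
      (0 , 1 ∷ 0 ∷ 0 ∷ 0 ∷ 0 ∷ 0 ∷ 0 ∷ 0 ∷ 1 ∷ 0 ∷ 1 ∷ 0 ∷ 1 ∷ 1 ∷ 0 ∷ 0 ∷ 1 ∷ 0 ∷ []) ∷
      (0 , 0 ∷ 1 ∷ 0 ∷ 1 ∷ 0 ∷ 0 ∷ 1 ∷ 0 ∷ 0 ∷ 0 ∷ 0 ∷ 0 ∷ 1 ∷ 1 ∷ 0 ∷ 0 ∷ 1 ∷ 0 ∷ []) ∷
      (1 , 0 ∷ 1 ∷ 1 ∷ 1 ∷ 1 ∷ 0 ∷ 2 ∷ 1 ∷ 0 ∷ 1 ∷ 0 ∷ 0 ∷ 1 ∷ 0 ∷ 1 ∷ 1 ∷ 1 ∷ 0 ∷ []) ∷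
      (1 , 1 ∷ 0 ∷ 1 ∷ 0 ∷ 1 ∷ 1 ∷ 0 ∷ 1 ∷ 1 ∷ 1 ∷ 1 ∷ 1 ∷ 0 ∷ 0 ∷ 1 ∷ 1 ∷ 0 ∷ 1 ∷ []) ∷
      (1 , 0 ∷ 1 ∷ 1 ∷ 1 ∷ 1 ∷ 1 ∷ 1 ∷ 1 ∷ 0 ∷ 1 ∷ 0 ∷ 1 ∷ 0 ∷ 0 ∷ 1 ∷ 1 ∷ 0 ∷ 1 ∷ []) ∷
      (1 , 1 ∷ 0 ∷ 1 ∷ 0 ∷ 1 ∷ 0 ∷ 1 ∷ 1 ∷ 1 ∷ 1 ∷ 1 ∷ 0 ∷ 1 ∷ 0 ∷ 1 ∷ 1 ∷ 1 ∷ 0 ∷ []) ∷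
      []
  ; certificates =
      (0 ∷ 1 ∷ 4 ∷ 10 ∷ 15 ∷ 17 ∷ [] , 5 ∷ 8 ∷ 9 ∷ 9 ∷ 16 ∷ []) ∷
      (1 ∷ 2 ∷ 7 ∷ 17 ∷ [] , 9 ∷ 12 ∷ 13 ∷ []) ∷
      (0 ∷ 3 ∷ 11 ∷ 13 ∷ [] , 2 ∷ 5 ∷ 15 ∷ []) ∷
      (1 ∷ 3 ∷ 4 ∷ 12 ∷ 14 ∷ [] , 2 ∷ 7 ∷ 9 ∷ 16 ∷ []) ∷
      (0 ∷ 5 ∷ 8 ∷ 9 ∷ 9 ∷ 16 ∷ [] , 1 ∷ 4 ∷ 10 ∷ 15 ∷ 17 ∷ []) ∷
      (3 ∷ 7 ∷ 8 ∷ 9 ∷ 11 ∷ 16 ∷ [] , 4 ∷ 10 ∷ 12 ∷ 15 ∷ 15 ∷ []) ∷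
      (1 ∷ 3 ∷ 5 ∷ 8 ∷ 14 ∷ [] , 0 ∷ 10 ∷ 13 ∷ 15 ∷ []) ∷
      (1 ∷ 9 ∷ 12 ∷ 13 ∷ [] , 2 ∷ 7 ∷ 17 ∷ []) ∷
      (2 ∷ 3 ∷ 5 ∷ 11 ∷ [] , 0 ∷ 13 ∷ 15 ∷ []) ∷
      (3 ∷ 8 ∷ 9 ∷ 11 ∷ 12 ∷ 16 ∷ [] , 4 ∷ 7 ∷ 10 ∷ 15 ∷ 15 ∷ []) ∷
      (2 ∷ 3 ∷ 5 ∷ 15 ∷ [] , 0 ∷ 11 ∷ 13 ∷ []) ∷
      (2 ∷ 7 ∷ 9 ∷ 17 ∷ [] , 1 ∷ 12 ∷ 13 ∷ []) ∷
      (1 ∷ 4 ∷ 5 ∷ 10 ∷ 15 ∷ 17 ∷ [] , 0 ∷ 8 ∷ 9 ∷ 9 ∷ 16 ∷ []) ∷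
      (1 ∷ 12 ∷ 13 ∷ 17 ∷ [] , 2 ∷ 7 ∷ 9 ∷ []) ∷
      (4 ∷ 7 ∷ 10 ∷ 11 ∷ 16 ∷ [] , 3 ∷ 8 ∷ 9 ∷ 12 ∷ []) ∷
      (4 ∷ 7 ∷ 10 ∷ 12 ∷ 15 ∷ 15 ∷ [] , 3 ∷ 8 ∷ 9 ∷ 11 ∷ 16 ∷ []) ∷
      (0 ∷ 11 ∷ 13 ∷ 15 ∷ [] , 2 ∷ 3 ∷ 5 ∷ []) ∷
      (0 ∷ 11 ∷ 13 ∷ 16 ∷ 16 ∷ [] , 2 ∷ 3 ∷ 5 ∷ 15 ∷ []) ∷
      (2 ∷ [] , []) ∷
      (1 ∷ 2 ∷ 2 ∷ 13 ∷ 13 ∷ 15 ∷ 17 ∷ [] , 3 ∷ 7 ∷ 9 ∷ 11 ∷ 12 ∷ []) ∷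
      (0 ∷ 2 ∷ 13 ∷ 15 ∷ [] , 3 ∷ 5 ∷ 11 ∷ []) ∷
      (0 ∷ 2 ∷ 7 ∷ 10 ∷ 14 ∷ 15 ∷ 17 ∷ [] , 3 ∷ 5 ∷ 8 ∷ 9 ∷ 12 ∷ []) ∷
      (0 ∷ 0 ∷ 3 ∷ 5 ∷ 5 ∷ 9 ∷ 11 ∷ [] , 1 ∷ 2 ∷ 13 ∷ 15 ∷ 17 ∷ []) ∷
      (0 ∷ 0 ∷ 3 ∷ 8 ∷ 9 ∷ 12 ∷ [] , 1 ∷ 2 ∷ 4 ∷ 7 ∷ 15 ∷ []) ∷
      (1 ∷ 3 ∷ 10 ∷ 12 ∷ [] , 2 ∷ 7 ∷ 16 ∷ []) ∷
      (0 ∷ 1 ∷ 1 ∷ 3 ∷ 3 ∷ 8 ∷ 9 ∷ 10 ∷ 12 ∷ 12 ∷ 12 ∷ 13 ∷ [] , 2 ∷ 2 ∷ 2 ∷ 4 ∷ 5 ∷ 7 ∷ 7 ∷ 7 ∷ 15 ∷ 16 ∷ []) ∷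
      (1 ∷ 3 ∷ 4 ∷ 5 ∷ 15 ∷ [] , 0 ∷ 8 ∷ 9 ∷ 13 ∷ []) ∷
      (1 ∷ 3 ∷ 3 ∷ 3 ∷ 5 ∷ 12 ∷ 15 ∷ 17 ∷ [] , 0 ∷ 7 ∷ 9 ∷ 11 ∷ 13 ∷ 13 ∷ []) ∷
      (4 ∷ 7 ∷ 11 ∷ 17 ∷ [] , 8 ∷ 12 ∷ 13 ∷ []) ∷
      (0 ∷ 3 ∷ 7 ∷ 9 ∷ 11 ∷ 17 ∷ 17 ∷ 17 ∷ [] , 1 ∷ 5 ∷ 12 ∷ 13 ∷ 13 ∷ 15 ∷ []) ∷
      (1 ∷ 4 ∷ 4 ∷ 7 ∷ 10 ∷ 12 ∷ 15 ∷ 15 ∷ [] , 2 ∷ 3 ∷ 8 ∷ 8 ∷ 9 ∷ 9 ∷ 16 ∷ []) ∷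
      (0 ∷ 10 ∷ 11 ∷ 15 ∷ 17 ∷ [] , 2 ∷ 5 ∷ 9 ∷ 16 ∷ []) ∷
      (0 ∷ 10 ∷ 12 ∷ 12 ∷ 15 ∷ 17 ∷ [] , 2 ∷ 5 ∷ 9 ∷ 11 ∷ 16 ∷ []) ∷
      (0 ∷ 0 ∷ 0 ∷ 1 ∷ 11 ∷ 11 ∷ 11 ∷ 12 ∷ 13 ∷ 13 ∷ 15 ∷ 17 ∷ [] , 2 ∷ 2 ∷ 2 ∷ 2 ∷ 3 ∷ 5 ∷ 5 ∷ 5 ∷ 7 ∷ 9 ∷ []) ∷
      (5 ∷ 5 ∷ 7 ∷ 9 ∷ 11 ∷ 16 ∷ [] , 10 ∷ 12 ∷ 13 ∷ 15 ∷ 17 ∷ []) ∷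
      (0 ∷ 5 ∷ 8 ∷ 9 ∷ 9 ∷ 11 ∷ 16 ∷ 16 ∷ [] , 2 ∷ 4 ∷ 10 ∷ 10 ∷ 15 ∷ 15 ∷ 17 ∷ []) ∷
      (1 ∷ 1 ∷ 1 ∷ 3 ∷ 5 ∷ 9 ∷ 11 ∷ 12 ∷ [] , 0 ∷ 2 ∷ 2 ∷ 7 ∷ 15 ∷ 17 ∷ []) ∷
      (1 ∷ 3 ∷ 8 ∷ 9 ∷ 12 ∷ [] , 2 ∷ 4 ∷ 7 ∷ 15 ∷ []) ∷
      (1 ∷ 1 ∷ 2 ∷ 3 ∷ 3 ∷ 4 ∷ 5 ∷ 5 ∷ 5 ∷ 7 ∷ 15 ∷ 16 ∷ [] , 0 ∷ 0 ∷ 0 ∷ 8 ∷ 9 ∷ 10 ∷ 12 ∷ 13 ∷ 13 ∷ 13 ∷ []) ∷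
      (1 ∷ 3 ∷ 5 ∷ 16 ∷ [] , 0 ∷ 10 ∷ 13 ∷ []) ∷
      (2 ∷ 2 ∷ 3 ∷ 5 ∷ 7 ∷ 7 ∷ 7 ∷ 9 ∷ 11 ∷ 17 ∷ 17 ∷ 17 ∷ [] , 0 ∷ 1 ∷ 12 ∷ 12 ∷ 12 ∷ 13 ∷ 13 ∷ 13 ∷ 13 ∷ 15 ∷ []) ∷
      (7 ∷ 9 ∷ 11 ∷ 16 ∷ 17 ∷ [] , 10 ∷ 12 ∷ 13 ∷ 15 ∷ []) ∷
      (1 ∷ 4 ∷ 5 ∷ 7 ∷ 7 ∷ 15 ∷ [] , 0 ∷ 3 ∷ 8 ∷ 9 ∷ 13 ∷ []) ∷
      (0 ∷ 7 ∷ 11 ∷ 15 ∷ [] , 2 ∷ 3 ∷ 6 ∷ []) ∷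
      (1 ∷ 7 ∷ 7 ∷ 12 ∷ 12 ∷ 15 ∷ 17 ∷ [] , 2 ∷ 3 ∷ 9 ∷ 11 ∷ 13 ∷ []) ∷
      (0 ∷ 8 ∷ 11 ∷ 17 ∷ [] , 2 ∷ 4 ∷ 5 ∷ []) ∷
      (2 ∷ 2 ∷ 3 ∷ 9 ∷ 11 ∷ 13 ∷ 13 ∷ [] , 0 ∷ 1 ∷ 5 ∷ 15 ∷ 17 ∷ []) ∷
      (2 ∷ 3 ∷ 5 ∷ 8 ∷ 9 ∷ 12 ∷ 14 ∷ [] , 0 ∷ 7 ∷ 10 ∷ 15 ∷ 17 ∷ []) ∷
      (2 ∷ 9 ∷ 12 ∷ 13 ∷ [] , 1 ∷ 7 ∷ 17 ∷ []) ∷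
      (13 ∷ [] , []) ∷
      (2 ∷ 7 ∷ 9 ∷ 13 ∷ [] , 1 ∷ 12 ∷ 17 ∷ []) ∷
      (0 ∷ 7 ∷ 9 ∷ 11 ∷ 13 ∷ 14 ∷ 16 ∷ [] , 1 ∷ 4 ∷ 5 ∷ 12 ∷ 15 ∷ []) ∷
      (1 ∷ 4 ∷ 5 ∷ 12 ∷ 13 ∷ 14 ∷ 15 ∷ [] , 0 ∷ 7 ∷ 9 ∷ 11 ∷ 16 ∷ []) ∷
      (1 ∷ 4 ∷ 6 ∷ 13 ∷ 14 ∷ [] , 0 ∷ 7 ∷ 10 ∷ 17 ∷ []) ∷
      (14 ∷ [] , []) ∷
      (2 ∷ 5 ∷ 13 ∷ 15 ∷ [] , 0 ∷ 3 ∷ 11 ∷ []) ∷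
      (0 ∷ 2 ∷ 7 ∷ 9 ∷ 10 ∷ 14 ∷ 14 ∷ 14 ∷ 15 ∷ 17 ∷ [] , 1 ∷ 1 ∷ 3 ∷ 4 ∷ 4 ∷ 5 ∷ 8 ∷ 12 ∷ []) ∷
      []
  }

presentation10 : Presentation
presentation10 = record
  { m = 17
  ; k = 10
  ; lines =
      (0 , 1 , 2) ∷ (0 , 3 , 4) ∷ (0 , 5 , 6) ∷ (1 , 7 , 8) ∷ (1 , 9 , 10) ∷ (2 , 11 , 12) ∷
      (2 , 13 , 14) ∷ (3 , 9 , 11) ∷ (3 , 14 , 17) ∷ (4 , 7 , 12) ∷ (4 , 10 , 15) ∷ (5 , 9 , 13) ∷
      (5 , 15 , 17) ∷ (6 , 7 , 14) ∷ (6 , 10 , 16) ∷ (8 , 11 , 15) ∷ (8 , 13 , 16) ∷ (12 , 16 , 17) ∷ []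
  ; vertices =
      (0 , 1 ∷ 0 ∷ 0 ∷ 0 ∷ 0 ∷ 0 ∷ 0 ∷ 1 ∷ 0 ∷ 0 ∷ 1 ∷ 1 ∷ 0 ∷ 1 ∷ 0 ∷ 0 ∷ 0 ∷ 1 ∷ []) ∷
      (0 , 0 ∷ 1 ∷ 0 ∷ 0 ∷ 1 ∷ 0 ∷ 1 ∷ 0 ∷ 0 ∷ 0 ∷ 0 ∷ 1 ∷ 0 ∷ 1 ∷ 0 ∷ 0 ∷ 0 ∷ 1 ∷ []) ∷
      (0 , 0 ∷ 0 ∷ 1 ∷ 0 ∷ 1 ∷ 0 ∷ 1 ∷ 0 ∷ 1 ∷ 1 ∷ 0 ∷ 0 ∷ 0 ∷ 0 ∷ 0 ∷ 0 ∷ 0 ∷ 1 ∷ []) ∷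
      (0 , 0 ∷ 1 ∷ 0 ∷ 0 ∷ 1 ∷ 1 ∷ 0 ∷ 0 ∷ 0 ∷ 0 ∷ 0 ∷ 1 ∷ 0 ∷ 0 ∷ 1 ∷ 0 ∷ 1 ∷ 0 ∷ []) ∷
      (0 , 0 ∷ 1 ∷ 0 ∷ 1 ∷ 0 ∷ 0 ∷ 1 ∷ 0 ∷ 0 ∷ 0 ∷ 0 ∷ 0 ∷ 1 ∷ 1 ∷ 0 ∷ 1 ∷ 0 ∷ 0 ∷ []) ∷
      (1 , 1 ∷ 0 ∷ 1 ∷ 0 ∷ 1 ∷ 1 ∷ 0 ∷ 1 ∷ 1 ∷ 1 ∷ 1 ∷ 1 ∷ 0 ∷ 0 ∷ 1 ∷ 0 ∷ 1 ∷ 1 ∷ []) ∷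
      (1 , 1 ∷ 0 ∷ 1 ∷ 1 ∷ 0 ∷ 0 ∷ 1 ∷ 1 ∷ 1 ∷ 1 ∷ 1 ∷ 0 ∷ 1 ∷ 1 ∷ 0 ∷ 1 ∷ 0 ∷ 1 ∷ []) ∷
      (1 , 1 ∷ 0 ∷ 1 ∷ 1 ∷ 0 ∷ 1 ∷ 0 ∷ 1 ∷ 1 ∷ 1 ∷ 1 ∷ 0 ∷ 1 ∷ 0 ∷ 1 ∷ 1 ∷ 1 ∷ 0 ∷ []) ∷
      (1 , 1 ∷ 1 ∷ 0 ∷ 1 ∷ 0 ∷ 1 ∷ 0 ∷ 1 ∷ 0 ∷ 0 ∷ 1 ∷ 1 ∷ 1 ∷ 1 ∷ 1 ∷ 1 ∷ 1 ∷ 0 ∷ []) ∷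
      (1 , 0 ∷ 1 ∷ 1 ∷ 1 ∷ 1 ∷ 1 ∷ 1 ∷ 0 ∷ 1 ∷ 1 ∷ 0 ∷ 0 ∷ 1 ∷ 0 ∷ 1 ∷ 1 ∷ 1 ∷ 0 ∷ []) ∷
      []
  ; certificates =
      (0 ∷ [] , []) ∷
      (0 ∷ 0 ∷ 1 ∷ 1 ∷ 1 ∷ 2 ∷ 4 ∷ 4 ∷ 13 ∷ 15 ∷ 17 ∷ 17 ∷ [] , 3 ∷ 5 ∷ 5 ∷ 7 ∷ 7 ∷ 8 ∷ 12 ∷ 14 ∷ 14 ∷ []) ∷
      (0 ∷ 0 ∷ 2 ∷ 2 ∷ 4 ∷ 13 ∷ 15 ∷ 17 ∷ [] , 3 ∷ 5 ∷ 6 ∷ 11 ∷ 12 ∷ 14 ∷ []) ∷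
      (0 ∷ 2 ∷ 2 ∷ 3 ∷ 4 ∷ 8 ∷ 15 ∷ 15 ∷ 17 ∷ [] , 5 ∷ 7 ∷ 12 ∷ 12 ∷ 13 ∷ 14 ∷ []) ∷
      (0 ∷ 0 ∷ 2 ∷ 4 ∷ 4 ∷ 7 ∷ 13 ∷ 15 ∷ 17 ∷ 17 ∷ [] , 3 ∷ 5 ∷ 5 ∷ 8 ∷ 12 ∷ 14 ∷ 14 ∷ []) ∷
      (0 ∷ 2 ∷ 4 ∷ 17 ∷ [] , 5 ∷ 11 ∷ 14 ∷ []) ∷
      (1 ∷ [] , []) ∷
      (0 ∷ 1 ∷ 1 ∷ 1 ∷ 2 ∷ 2 ∷ 4 ∷ 13 ∷ 13 ∷ 15 ∷ 15 ∷ 17 ∷ [] , 3 ∷ 3 ∷ 5 ∷ 7 ∷ 8 ∷ 8 ∷ 12 ∷ 12 ∷ 14 ∷ []) ∷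
      (2 ∷ 10 ∷ 17 ∷ [] , 12 ∷ 14 ∷ []) ∷
      (1 ∷ 1 ∷ 1 ∷ 2 ∷ 4 ∷ 6 ∷ 6 ∷ 9 ∷ 15 ∷ 17 ∷ [] , 3 ∷ 5 ∷ 5 ∷ 7 ∷ 8 ∷ 8 ∷ 12 ∷ 14 ∷ []) ∷
      (0 ∷ 1 ∷ 10 ∷ 13 ∷ 15 ∷ 17 ∷ [] , 3 ∷ 5 ∷ 8 ∷ 14 ∷ []) ∷
      (2 ∷ [] , []) ∷
      (0 ∷ 2 ∷ 13 ∷ 15 ∷ [] , 3 ∷ 6 ∷ 12 ∷ []) ∷
      (0 ∷ 2 ∷ 2 ∷ 4 ∷ 8 ∷ 13 ∷ 13 ∷ 15 ∷ 15 ∷ 17 ∷ [] , 3 ∷ 3 ∷ 5 ∷ 7 ∷ 12 ∷ 12 ∷ 14 ∷ []) ∷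
      (0 ∷ 2 ∷ 7 ∷ 13 ∷ 16 ∷ 17 ∷ [] , 3 ∷ 5 ∷ 8 ∷ 11 ∷ []) ∷
      (0 ∷ 0 ∷ 3 ∷ 3 ∷ 5 ∷ 7 ∷ 12 ∷ 12 ∷ 13 ∷ 14 ∷ [] , 2 ∷ 2 ∷ 4 ∷ 8 ∷ 15 ∷ 15 ∷ 17 ∷ []) ∷
      (3 ∷ 5 ∷ 10 ∷ [] , 9 ∷ 15 ∷ []) ∷
      (0 ∷ 0 ∷ 3 ∷ 5 ∷ 5 ∷ 7 ∷ 12 ∷ 14 ∷ [] , 1 ∷ 2 ∷ 4 ∷ 9 ∷ 15 ∷ 17 ∷ []) ∷
      (0 ∷ 0 ∷ 3 ∷ 3 ∷ 5 ∷ 6 ∷ 6 ∷ 6 ∷ 7 ∷ 12 ∷ 12 ∷ 14 ∷ [] , 2 ∷ 2 ∷ 4 ∷ 8 ∷ 13 ∷ 13 ∷ 15 ∷ 15 ∷ 17 ∷ []) ∷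
      (0 ∷ 3 ∷ 5 ∷ 12 ∷ [] , 2 ∷ 9 ∷ 15 ∷ []) ∷
      (3 ∷ 7 ∷ 8 ∷ 12 ∷ [] , 11 ∷ 13 ∷ 15 ∷ []) ∷
      (1 ∷ 3 ∷ 12 ∷ 13 ∷ [] , 2 ∷ 8 ∷ 15 ∷ []) ∷
      (1 ∷ 3 ∷ 4 ∷ 4 ∷ 5 ∷ 8 ∷ 10 ∷ 14 ∷ [] , 0 ∷ 7 ∷ 7 ∷ 13 ∷ 15 ∷ 17 ∷ []) ∷
      (2 ∷ 3 ∷ 8 ∷ 12 ∷ [] , 1 ∷ 13 ∷ 15 ∷ []) ∷
      (0 ∷ 3 ∷ 3 ∷ 7 ∷ 12 ∷ 13 ∷ 13 ∷ 14 ∷ [] , 2 ∷ 4 ∷ 6 ∷ 8 ∷ 15 ∷ 16 ∷ []) ∷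
      (4 ∷ 5 ∷ 8 ∷ 14 ∷ [] , 6 ∷ 7 ∷ 17 ∷ []) ∷
      (3 ∷ [] , []) ∷
      (0 ∷ 3 ∷ 4 ∷ 7 ∷ 7 ∷ 12 ∷ 13 ∷ 13 ∷ 17 ∷ [] , 2 ∷ 5 ∷ 8 ∷ 8 ∷ 14 ∷ 15 ∷ []) ∷
      (0 ∷ 3 ∷ 12 ∷ 13 ∷ [] , 2 ∷ 6 ∷ 15 ∷ []) ∷
      (2 ∷ 3 ∷ 3 ∷ 4 ∷ 4 ∷ 5 ∷ 8 ∷ 8 ∷ 14 ∷ 15 ∷ [] , 0 ∷ 7 ∷ 7 ∷ 12 ∷ 13 ∷ 13 ∷ 17 ∷ []) ∷
      (2 ∷ 3 ∷ 3 ∷ 4 ∷ 5 ∷ 8 ∷ 15 ∷ 15 ∷ [] , 0 ∷ 7 ∷ 9 ∷ 10 ∷ 12 ∷ 13 ∷ []) ∷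
      (2 ∷ 3 ∷ 3 ∷ 4 ∷ 6 ∷ 8 ∷ 15 ∷ 16 ∷ [] , 0 ∷ 7 ∷ 12 ∷ 13 ∷ 13 ∷ 14 ∷ []) ∷
      (3 ∷ 4 ∷ 8 ∷ 15 ∷ [] , 7 ∷ 10 ∷ 13 ∷ []) ∷
      (4 ∷ [] , []) ∷
      (4 ∷ 7 ∷ 13 ∷ 17 ∷ [] , 8 ∷ 9 ∷ 14 ∷ []) ∷
      (0 ∷ 0 ∷ 4 ∷ 4 ∷ 7 ∷ 11 ∷ 11 ∷ 11 ∷ 13 ∷ 15 ∷ 17 ∷ 17 ∷ [] , 2 ∷ 2 ∷ 3 ∷ 5 ∷ 5 ∷ 8 ∷ 12 ∷ 14 ∷ 14 ∷ []) ∷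
      (0 ∷ 4 ∷ 7 ∷ 17 ∷ [] , 1 ∷ 5 ∷ 14 ∷ []) ∷
      (3 ∷ 4 ∷ 8 ∷ 14 ∷ [] , 7 ∷ 13 ∷ 16 ∷ []) ∷
      (4 ∷ 5 ∷ 8 ∷ 17 ∷ [] , 6 ∷ 7 ∷ 14 ∷ []) ∷
      (4 ∷ 8 ∷ 13 ∷ 17 ∷ [] , 7 ∷ 9 ∷ 14 ∷ []) ∷
      (0 ∷ 12 ∷ 15 ∷ 17 ∷ [] , 2 ∷ 5 ∷ 16 ∷ []) ∷
      (0 ∷ 12 ∷ 14 ∷ 17 ∷ [] , 2 ∷ 5 ∷ 10 ∷ []) ∷
      (0 ∷ 3 ∷ 5 ∷ 5 ∷ 7 ∷ 7 ∷ 8 ∷ 12 ∷ 14 ∷ 14 ∷ [] , 2 ∷ 4 ∷ 4 ∷ 13 ∷ 15 ∷ 17 ∷ 17 ∷ []) ∷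
      (1 ∷ 3 ∷ 6 ∷ 6 ∷ 6 ∷ 6 ∷ 7 ∷ 9 ∷ 12 ∷ 14 ∷ [] , 2 ∷ 4 ∷ 8 ∷ 8 ∷ 13 ∷ 13 ∷ 15 ∷ 17 ∷ []) ∷
      (3 ∷ 5 ∷ 6 ∷ 11 ∷ 12 ∷ 14 ∷ [] , 4 ∷ 13 ∷ 15 ∷ 17 ∷ []) ∷
      (0 ∷ 5 ∷ 7 ∷ 14 ∷ [] , 1 ∷ 4 ∷ 17 ∷ []) ∷
      (5 ∷ [] , []) ∷
      (0 ∷ 3 ∷ 5 ∷ 5 ∷ 6 ∷ 6 ∷ 6 ∷ 7 ∷ 7 ∷ 12 ∷ 14 ∷ 14 ∷ [] , 2 ∷ 4 ∷ 4 ∷ 8 ∷ 8 ∷ 13 ∷ 15 ∷ 17 ∷ 17 ∷ []) ∷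
      (0 ∷ 6 ∷ 7 ∷ 12 ∷ 14 ∷ 15 ∷ [] , 2 ∷ 4 ∷ 8 ∷ 16 ∷ []) ∷
      (6 ∷ [] , []) ∷
      (0 ∷ 11 ∷ 14 ∷ [] , 2 ∷ 4 ∷ []) ∷
      (1 ∷ 3 ∷ 7 ∷ 9 ∷ 12 ∷ 14 ∷ [] , 2 ∷ 4 ∷ 15 ∷ 17 ∷ []) ∷
      (1 ∷ 3 ∷ 5 ∷ 8 ∷ 10 ∷ 14 ∷ [] , 0 ∷ 13 ∷ 15 ∷ 17 ∷ []) ∷
      (1 ∷ 1 ∷ 1 ∷ 3 ∷ 5 ∷ 5 ∷ 7 ∷ 7 ∷ 8 ∷ 12 ∷ 14 ∷ 14 ∷ [] , 0 ∷ 0 ∷ 2 ∷ 4 ∷ 4 ∷ 13 ∷ 15 ∷ 17 ∷ 17 ∷ []) ∷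
      (1 ∷ 1 ∷ 1 ∷ 1 ∷ 3 ∷ 5 ∷ 6 ∷ 11 ∷ 12 ∷ 14 ∷ [] , 0 ∷ 0 ∷ 2 ∷ 2 ∷ 4 ∷ 13 ∷ 15 ∷ 17 ∷ []) ∷
      (1 ∷ 1 ∷ 1 ∷ 3 ∷ 3 ∷ 5 ∷ 7 ∷ 8 ∷ 8 ∷ 12 ∷ 12 ∷ 14 ∷ [] , 0 ∷ 2 ∷ 2 ∷ 4 ∷ 13 ∷ 13 ∷ 15 ∷ 15 ∷ 17 ∷ []) ∷
      (2 ∷ 3 ∷ 3 ∷ 5 ∷ 7 ∷ 8 ∷ 8 ∷ 12 ∷ 12 ∷ 14 ∷ [] , 0 ∷ 4 ∷ 13 ∷ 13 ∷ 15 ∷ 15 ∷ 17 ∷ []) ∷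
      (5 ∷ 7 ∷ 8 ∷ 14 ∷ [] , 4 ∷ 6 ∷ 17 ∷ []) ∷
      (1 ∷ 3 ∷ 5 ∷ [] , 0 ∷ 9 ∷ []) ∷
      (7 ∷ [] , []) ∷
      (3 ∷ 7 ∷ 8 ∷ 14 ∷ [] , 4 ∷ 13 ∷ 16 ∷ []) ∷
      (8 ∷ [] , []) ∷
      (0 ∷ 3 ∷ 7 ∷ 7 ∷ 8 ∷ 12 ∷ 14 ∷ 14 ∷ 17 ∷ [] , 2 ∷ 4 ∷ 4 ∷ 5 ∷ 13 ∷ 15 ∷ []) ∷
      (1 ∷ 5 ∷ 11 ∷ 12 ∷ 16 ∷ [] , 0 ∷ 7 ∷ 15 ∷ 17 ∷ []) ∷
      (1 ∷ 3 ∷ 7 ∷ 9 ∷ 12 ∷ 13 ∷ 13 ∷ 14 ∷ [] , 2 ∷ 4 ∷ 8 ∷ 8 ∷ 15 ∷ 17 ∷ []) ∷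
      (1 ∷ 4 ∷ 5 ∷ 14 ∷ [] , 0 ∷ 7 ∷ 17 ∷ []) ∷
      (9 ∷ [] , []) ∷
      (1 ∷ 3 ∷ 6 ∷ 6 ∷ 7 ∷ 9 ∷ 9 ∷ 9 ∷ 12 ∷ 14 ∷ [] , 2 ∷ 4 ∷ 5 ∷ 5 ∷ 8 ∷ 8 ∷ 15 ∷ 17 ∷ []) ∷
      (1 ∷ 12 ∷ 13 ∷ [] , 2 ∷ 8 ∷ []) ∷
      (1 ∷ 2 ∷ 3 ∷ 4 ∷ 6 ∷ 6 ∷ 9 ∷ 15 ∷ 16 ∷ 16 ∷ [] , 0 ∷ 0 ∷ 7 ∷ 12 ∷ 13 ∷ 13 ∷ 14 ∷ 17 ∷ []) ∷
      (1 ∷ 1 ∷ 4 ∷ 6 ∷ 11 ∷ 11 ∷ 11 ∷ 13 ∷ 15 ∷ 17 ∷ [] , 2 ∷ 2 ∷ 3 ∷ 5 ∷ 8 ∷ 8 ∷ 12 ∷ 14 ∷ []) ∷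
      (1 ∷ 4 ∷ 5 ∷ [] , 0 ∷ 7 ∷ []) ∷
      (1 ∷ 1 ∷ 3 ∷ 4 ∷ 5 ∷ 6 ∷ 10 ∷ 10 ∷ 11 ∷ 14 ∷ [] , 0 ∷ 0 ∷ 7 ∷ 7 ∷ 12 ∷ 13 ∷ 15 ∷ 17 ∷ []) ∷
      (10 ∷ [] , []) ∷
      (2 ∷ 2 ∷ 4 ∷ 5 ∷ 5 ∷ 8 ∷ 9 ∷ 9 ∷ 9 ∷ 15 ∷ 15 ∷ 17 ∷ [] , 0 ∷ 0 ∷ 3 ∷ 3 ∷ 7 ∷ 12 ∷ 12 ∷ 13 ∷ 14 ∷ []) ∷
      (1 ∷ 12 ∷ 13 ∷ 15 ∷ [] , 2 ∷ 3 ∷ 8 ∷ []) ∷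
      (1 ∷ 4 ∷ 5 ∷ 9 ∷ 16 ∷ [] , 0 ∷ 3 ∷ 7 ∷ 14 ∷ []) ∷
      (2 ∷ 4 ∷ 4 ∷ 5 ∷ 8 ∷ 8 ∷ 9 ∷ 9 ∷ 9 ∷ 15 ∷ 17 ∷ 17 ∷ [] , 0 ∷ 3 ∷ 7 ∷ 7 ∷ 12 ∷ 13 ∷ 13 ∷ 14 ∷ 14 ∷ []) ∷
      (6 ∷ 8 ∷ 9 ∷ 11 ∷ 15 ∷ [] , 3 ∷ 5 ∷ 7 ∷ 12 ∷ []) ∷
      (1 ∷ 1 ∷ 6 ∷ 10 ∷ 10 ∷ 11 ∷ 12 ∷ 13 ∷ 15 ∷ 17 ∷ [] , 2 ∷ 2 ∷ 3 ∷ 4 ∷ 5 ∷ 8 ∷ 8 ∷ 14 ∷ []) ∷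
      (1 ∷ 6 ∷ 6 ∷ 7 ∷ 9 ∷ 12 ∷ 14 ∷ 16 ∷ 16 ∷ 17 ∷ [] , 2 ∷ 3 ∷ 4 ∷ 5 ∷ 5 ∷ 8 ∷ 8 ∷ 15 ∷ []) ∷
      (0 ∷ 9 ∷ 12 ∷ 15 ∷ [] , 2 ∷ 3 ∷ 5 ∷ []) ∷
      (3 ∷ 5 ∷ 11 ∷ 12 ∷ 13 ∷ 14 ∷ [] , 4 ∷ 6 ∷ 15 ∷ 17 ∷ []) ∷
      (2 ∷ 2 ∷ 3 ∷ 4 ∷ 5 ∷ 5 ∷ 8 ∷ 12 ∷ 14 ∷ 14 ∷ [] , 0 ∷ 0 ∷ 7 ∷ 13 ∷ 15 ∷ 17 ∷ 17 ∷ []) ∷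
      (2 ∷ 5 ∷ 12 ∷ 14 ∷ [] , 0 ∷ 10 ∷ 17 ∷ []) ∷
      (2 ∷ 2 ∷ 3 ∷ 5 ∷ 5 ∷ 8 ∷ 11 ∷ 11 ∷ 11 ∷ 12 ∷ 14 ∷ 14 ∷ [] , 0 ∷ 0 ∷ 4 ∷ 4 ∷ 7 ∷ 13 ∷ 15 ∷ 17 ∷ 17 ∷ []) ∷
      (2 ∷ 2 ∷ 3 ∷ 5 ∷ 8 ∷ 12 ∷ 12 ∷ 14 ∷ [] , 0 ∷ 1 ∷ 10 ∷ 13 ∷ 15 ∷ 17 ∷ []) ∷
      (2 ∷ 3 ∷ 5 ∷ 8 ∷ 11 ∷ 16 ∷ [] , 0 ∷ 7 ∷ 13 ∷ 17 ∷ []) ∷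
      (11 ∷ [] , []) ∷
      (2 ∷ 4 ∷ 5 ∷ 8 ∷ 9 ∷ 12 ∷ [] , 0 ∷ 7 ∷ 10 ∷ 13 ∷ []) ∷
      (2 ∷ 3 ∷ 3 ∷ 5 ∷ 8 ∷ 8 ∷ 11 ∷ 11 ∷ 11 ∷ 12 ∷ 12 ∷ 14 ∷ [] , 0 ∷ 4 ∷ 7 ∷ 7 ∷ 13 ∷ 13 ∷ 15 ∷ 15 ∷ 17 ∷ []) ∷
      (12 ∷ [] , []) ∷
      (3 ∷ 7 ∷ 13 ∷ 14 ∷ [] , 4 ∷ 8 ∷ 16 ∷ []) ∷
      (13 ∷ [] , []) ∷
      (0 ∷ 3 ∷ 7 ∷ 7 ∷ 12 ∷ 13 ∷ 13 ∷ 14 ∷ 14 ∷ 17 ∷ [] , 2 ∷ 4 ∷ 4 ∷ 5 ∷ 8 ∷ 8 ∷ 15 ∷ []) ∷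
      (2 ∷ 3 ∷ 5 ∷ 15 ∷ [] , 0 ∷ 9 ∷ 12 ∷ []) ∷
      (4 ∷ 7 ∷ 13 ∷ 15 ∷ [] , 3 ∷ 8 ∷ 10 ∷ []) ∷
      (2 ∷ 4 ∷ 5 ∷ 14 ∷ [] , 0 ∷ 11 ∷ 17 ∷ []) ∷
      (2 ∷ 4 ∷ 4 ∷ 5 ∷ 8 ∷ 8 ∷ 13 ∷ 14 ∷ 15 ∷ [] , 0 ∷ 3 ∷ 7 ∷ 7 ∷ 12 ∷ 17 ∷ []) ∷
      (14 ∷ [] , []) ∷
      (2 ∷ 5 ∷ 15 ∷ 17 ∷ [] , 0 ∷ 12 ∷ 16 ∷ []) ∷
      (2 ∷ 8 ∷ 13 ∷ 15 ∷ [] , 1 ∷ 3 ∷ 12 ∷ []) ∷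
      (7 ∷ 12 ∷ 13 ∷ 15 ∷ [] , 3 ∷ 8 ∷ 11 ∷ []) ∷
      (7 ∷ 13 ∷ 14 ∷ 17 ∷ [] , 4 ∷ 8 ∷ 9 ∷ []) ∷
      (2 ∷ 2 ∷ 4 ∷ 6 ∷ 6 ∷ 6 ∷ 8 ∷ 13 ∷ 13 ∷ 15 ∷ 15 ∷ 17 ∷ [] , 0 ∷ 0 ∷ 3 ∷ 3 ∷ 5 ∷ 7 ∷ 12 ∷ 12 ∷ 14 ∷ []) ∷
      (0 ∷ 7 ∷ 7 ∷ 12 ∷ 13 ∷ 13 ∷ 14 ∷ 14 ∷ 16 ∷ 16 ∷ 16 ∷ 17 ∷ [] , 2 ∷ 3 ∷ 3 ∷ 4 ∷ 4 ∷ 5 ∷ 8 ∷ 8 ∷ 15 ∷ []) ∷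
      (4 ∷ 8 ∷ 13 ∷ 15 ∷ [] , 3 ∷ 7 ∷ 10 ∷ []) ∷
      (0 ∷ 7 ∷ 14 ∷ 17 ∷ [] , 1 ∷ 4 ∷ 5 ∷ []) ∷
      (2 ∷ 2 ∷ 3 ∷ 4 ∷ 5 ∷ 5 ∷ 8 ∷ 15 ∷ 15 ∷ 17 ∷ [] , 0 ∷ 0 ∷ 7 ∷ 12 ∷ 12 ∷ 13 ∷ 14 ∷ []) ∷
      (2 ∷ 3 ∷ 5 ∷ 8 ∷ 11 ∷ 15 ∷ 15 ∷ 16 ∷ [] , 0 ∷ 7 ∷ 12 ∷ 12 ∷ 13 ∷ 17 ∷ []) ∷
      (15 ∷ [] , []) ∷
      (2 ∷ 4 ∷ 6 ∷ 8 ∷ 15 ∷ 16 ∷ [] , 0 ∷ 7 ∷ 12 ∷ 14 ∷ []) ∷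
      (16 ∷ [] , []) ∷
      (2 ∷ 4 ∷ 4 ∷ 5 ∷ 7 ∷ 13 ∷ 15 ∷ 17 ∷ 17 ∷ [] , 0 ∷ 3 ∷ 8 ∷ 12 ∷ 14 ∷ 14 ∷ []) ∷
      (4 ∷ 6 ∷ 7 ∷ 7 ∷ 11 ∷ 13 ∷ 15 ∷ 17 ∷ [] , 3 ∷ 5 ∷ 8 ∷ 8 ∷ 12 ∷ 14 ∷ []) ∷
      (0 ∷ 4 ∷ 7 ∷ 7 ∷ 12 ∷ 13 ∷ 13 ∷ 15 ∷ 15 ∷ 17 ∷ [] , 2 ∷ 3 ∷ 3 ∷ 5 ∷ 8 ∷ 8 ∷ 14 ∷ []) ∷
      (4 ∷ 13 ∷ 16 ∷ [] , 3 ∷ 14 ∷ []) ∷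
      (6 ∷ 7 ∷ 17 ∷ [] , 5 ∷ 8 ∷ []) ∷
      (2 ∷ 4 ∷ 5 ∷ 5 ∷ 8 ∷ 15 ∷ 17 ∷ 17 ∷ [] , 0 ∷ 6 ∷ 7 ∷ 12 ∷ 14 ∷ 16 ∷ []) ∷
      (0 ∷ 12 ∷ 13 ∷ 15 ∷ [] , 2 ∷ 3 ∷ 6 ∷ []) ∷
      (2 ∷ 4 ∷ 4 ∷ 5 ∷ 8 ∷ 8 ∷ 13 ∷ 15 ∷ 17 ∷ 17 ∷ [] , 0 ∷ 3 ∷ 7 ∷ 7 ∷ 12 ∷ 14 ∷ 14 ∷ []) ∷
      (17 ∷ [] , []) ∷
      (4 ∷ 6 ∷ 8 ∷ 8 ∷ 11 ∷ 13 ∷ 15 ∷ 17 ∷ [] , 3 ∷ 5 ∷ 7 ∷ 7 ∷ 12 ∷ 14 ∷ []) ∷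
      (0 ∷ 6 ∷ 7 ∷ 12 ∷ 14 ∷ 16 ∷ 17 ∷ 17 ∷ [] , 2 ∷ 4 ∷ 5 ∷ 5 ∷ 8 ∷ 15 ∷ []) ∷
      (0 ∷ 4 ∷ 8 ∷ 12 ∷ 13 ∷ 13 ∷ 15 ∷ 15 ∷ 17 ∷ [] , 2 ∷ 3 ∷ 3 ∷ 5 ∷ 7 ∷ 14 ∷ []) ∷
      (0 ∷ 0 ∷ 7 ∷ 12 ∷ 12 ∷ 13 ∷ 14 ∷ 15 ∷ 17 ∷ 17 ∷ [] , 2 ∷ 2 ∷ 3 ∷ 4 ∷ 5 ∷ 5 ∷ 8 ∷ []) ∷
      []
  }

presentation11 : Presentation
presentation11 = record
  { m = 18
  ; k = 11
  ; lines =
      (0 , 1 , 2) ∷ (0 , 3 , 4) ∷ (0 , 5 , 6) ∷ (1 , 7 , 8) ∷ (1 , 9 , 10) ∷ (2 , 11 , 12) ∷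
      (2 , 13 , 14) ∷ (3 , 7 , 13) ∷ (3 , 16 , 18) ∷ (4 , 9 , 14) ∷ (4 , 12 , 15) ∷ (5 , 10 , 13) ∷
      (5 , 15 , 17) ∷ (6 , 8 , 14) ∷ (6 , 12 , 18) ∷ (7 , 11 , 17) ∷ (8 , 15 , 16) ∷ (9 , 17 , 18) ∷
      (10 , 11 , 16) ∷ []
  -- A three-dimensional polytope: the points 3, 5, 8 and 9 have weight 1/3 at every vertex, and the
  -- line equations then express all other weights through those of the points 0, 1 and 11.
  ; vertices =
      (2 , 0 ∷ 0 ∷ 3 ∷ 1 ∷ 2 ∷ 1 ∷ 2 ∷ 2 ∷ 1 ∷ 1 ∷ 2 ∷ 0 ∷ 0 ∷ 0 ∷ 0 ∷ 1 ∷ 1 ∷ 1 ∷ 1 ∷ []) ∷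
      (2 , 1 ∷ 2 ∷ 0 ∷ 1 ∷ 1 ∷ 1 ∷ 1 ∷ 0 ∷ 1 ∷ 1 ∷ 0 ∷ 3 ∷ 0 ∷ 2 ∷ 1 ∷ 2 ∷ 0 ∷ 0 ∷ 2 ∷ []) ∷
      (2 , 2 ∷ 0 ∷ 1 ∷ 1 ∷ 0 ∷ 1 ∷ 0 ∷ 2 ∷ 1 ∷ 1 ∷ 2 ∷ 1 ∷ 1 ∷ 0 ∷ 2 ∷ 2 ∷ 0 ∷ 0 ∷ 2 ∷ []) ∷
      (2 , 2 ∷ 1 ∷ 0 ∷ 1 ∷ 0 ∷ 1 ∷ 0 ∷ 1 ∷ 1 ∷ 1 ∷ 1 ∷ 0 ∷ 3 ∷ 1 ∷ 2 ∷ 0 ∷ 2 ∷ 2 ∷ 0 ∷ []) ∷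
      (2 , 0 ∷ 2 ∷ 1 ∷ 1 ∷ 2 ∷ 1 ∷ 2 ∷ 0 ∷ 1 ∷ 1 ∷ 0 ∷ 1 ∷ 1 ∷ 2 ∷ 0 ∷ 0 ∷ 2 ∷ 2 ∷ 0 ∷ []) ∷
      (2 , 2 ∷ 0 ∷ 1 ∷ 1 ∷ 0 ∷ 1 ∷ 0 ∷ 2 ∷ 1 ∷ 1 ∷ 2 ∷ 0 ∷ 2 ∷ 0 ∷ 2 ∷ 1 ∷ 1 ∷ 1 ∷ 1 ∷ []) ∷
      (2 , 0 ∷ 2 ∷ 1 ∷ 1 ∷ 2 ∷ 1 ∷ 2 ∷ 0 ∷ 1 ∷ 1 ∷ 0 ∷ 2 ∷ 0 ∷ 2 ∷ 0 ∷ 1 ∷ 1 ∷ 1 ∷ 1 ∷ []) ∷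
      (2 , 1 ∷ 0 ∷ 2 ∷ 1 ∷ 1 ∷ 1 ∷ 1 ∷ 2 ∷ 1 ∷ 1 ∷ 2 ∷ 1 ∷ 0 ∷ 0 ∷ 1 ∷ 2 ∷ 0 ∷ 0 ∷ 2 ∷ []) ∷
      (2 , 2 ∷ 1 ∷ 0 ∷ 1 ∷ 0 ∷ 1 ∷ 0 ∷ 1 ∷ 1 ∷ 1 ∷ 1 ∷ 2 ∷ 1 ∷ 1 ∷ 2 ∷ 2 ∷ 0 ∷ 0 ∷ 2 ∷ []) ∷
      (2 , 1 ∷ 2 ∷ 0 ∷ 1 ∷ 1 ∷ 1 ∷ 1 ∷ 0 ∷ 1 ∷ 1 ∷ 0 ∷ 1 ∷ 2 ∷ 2 ∷ 1 ∷ 0 ∷ 2 ∷ 2 ∷ 0 ∷ []) ∷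
      (2 , 0 ∷ 1 ∷ 2 ∷ 1 ∷ 2 ∷ 1 ∷ 2 ∷ 1 ∷ 1 ∷ 1 ∷ 1 ∷ 0 ∷ 1 ∷ 1 ∷ 0 ∷ 0 ∷ 2 ∷ 2 ∷ 0 ∷ []) ∷
      []
  ; certificates =
      (1 ∷ 1 ∷ 1 ∷ 4 ∷ 4 ∷ 5 ∷ 5 ∷ 7 ∷ 7 ∷ 8 ∷ 12 ∷ 12 ∷ 12 ∷ 13 ∷ [] , 0 ∷ 0 ∷ 2 ∷ 9 ∷ 10 ∷ 10 ∷ 11 ∷ 11 ∷ 15 ∷ 15 ∷ 16 ∷ 17 ∷ []) ∷
      (2 ∷ 2 ∷ 3 ∷ 3 ∷ 3 ∷ 5 ∷ 5 ∷ 8 ∷ 9 ∷ 9 ∷ 11 ∷ 12 ∷ 12 ∷ 12 ∷ [] , 0 ∷ 0 ∷ 4 ∷ 7 ∷ 10 ∷ 10 ∷ 13 ∷ 13 ∷ 15 ∷ 15 ∷ 16 ∷ 17 ∷ []) ∷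
      (1 ∷ 1 ∷ 1 ∷ 3 ∷ 3 ∷ 3 ∷ 5 ∷ 5 ∷ 11 ∷ 13 ∷ 16 ∷ 16 ∷ 17 ∷ 17 ∷ [] , 0 ∷ 0 ∷ 2 ∷ 4 ∷ 7 ∷ 8 ∷ 8 ∷ 9 ∷ 10 ∷ 10 ∷ 15 ∷ 15 ∷ []) ∷
      (2 ∷ 4 ∷ 5 ∷ 7 ∷ 9 ∷ 16 ∷ 17 ∷ [] , 0 ∷ 8 ∷ 10 ∷ 11 ∷ 13 ∷ 15 ∷ []) ∷
      (0 ∷ 0 ∷ 1 ∷ 5 ∷ 16 ∷ 17 ∷ [] , 3 ∷ 4 ∷ 8 ∷ 10 ∷ 15 ∷ []) ∷
      (0 ∷ 0 ∷ 1 ∷ 1 ∷ 1 ∷ 2 ∷ 9 ∷ 10 ∷ 10 ∷ 11 ∷ 11 ∷ 15 ∷ 15 ∷ 16 ∷ 17 ∷ [] , 4 ∷ 4 ∷ 5 ∷ 5 ∷ 7 ∷ 7 ∷ 8 ∷ 12 ∷ 12 ∷ 12 ∷ 13 ∷ []) ∷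
      (0 ∷ 0 ∷ 1 ∷ 2 ∷ 2 ∷ 2 ∷ 4 ∷ 7 ∷ 13 ∷ 14 ∷ 14 ∷ 15 ∷ 15 ∷ 16 ∷ 16 ∷ [] , 3 ∷ 3 ∷ 3 ∷ 5 ∷ 5 ∷ 8 ∷ 8 ∷ 9 ∷ 11 ∷ 12 ∷ 12 ∷ []) ∷
      (0 ∷ 0 ∷ 2 ∷ 9 ∷ 15 ∷ 16 ∷ 16 ∷ 18 ∷ [] , 3 ∷ 4 ∷ 5 ∷ 5 ∷ 10 ∷ 12 ∷ 13 ∷ []) ∷
      (0 ∷ 1 ∷ 1 ∷ 6 ∷ 15 ∷ 15 ∷ 16 ∷ 17 ∷ [] , 3 ∷ 5 ∷ 5 ∷ 7 ∷ 8 ∷ 9 ∷ 10 ∷ []) ∷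
      (0 ∷ 0 ∷ 3 ∷ 5 ∷ 8 ∷ 12 ∷ [] , 1 ∷ 2 ∷ 14 ∷ 15 ∷ 16 ∷ []) ∷
      (0 ∷ 0 ∷ 3 ∷ 3 ∷ 3 ∷ 4 ∷ 7 ∷ 8 ∷ 9 ∷ 9 ∷ 12 ∷ 14 ∷ 14 ∷ 15 ∷ 15 ∷ [] , 1 ∷ 1 ∷ 5 ∷ 5 ∷ 11 ∷ 13 ∷ 13 ∷ 16 ∷ 17 ∷ 17 ∷ 17 ∷ []) ∷
      (0 ∷ 0 ∷ 1 ∷ 3 ∷ 4 ∷ 4 ∷ 4 ∷ 11 ∷ 12 ∷ 12 ∷ 13 ∷ 14 ∷ 14 ∷ 18 ∷ 18 ∷ [] , 2 ∷ 2 ∷ 2 ∷ 5 ∷ 5 ∷ 7 ∷ 9 ∷ 16 ∷ 16 ∷ 17 ∷ 17 ∷ []) ∷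
      (0 ∷ 0 ∷ 4 ∷ 7 ∷ 10 ∷ 12 ∷ 12 ∷ 14 ∷ [] , 1 ∷ 2 ∷ 5 ∷ 5 ∷ 11 ∷ 15 ∷ 17 ∷ []) ∷
      (0 ∷ 3 ∷ 3 ∷ 6 ∷ 8 ∷ 12 ∷ 14 ∷ 14 ∷ [] , 2 ∷ 5 ∷ 5 ∷ 7 ∷ 13 ∷ 15 ∷ 16 ∷ []) ∷
      (5 ∷ 6 ∷ 6 ∷ 7 ∷ 16 ∷ 17 ∷ [] , 8 ∷ 9 ∷ 10 ∷ 13 ∷ 15 ∷ []) ∷
      (5 ∷ 6 ∷ 6 ∷ 8 ∷ 12 ∷ 13 ∷ [] , 7 ∷ 11 ∷ 14 ∷ 15 ∷ 16 ∷ []) ∷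
      (2 ∷ 3 ∷ 3 ∷ 9 ∷ 10 ∷ 10 ∷ 15 ∷ 18 ∷ [] , 0 ∷ 4 ∷ 5 ∷ 5 ∷ 12 ∷ 13 ∷ 16 ∷ []) ∷
      (1 ∷ 1 ∷ 3 ∷ 10 ∷ 11 ∷ 14 ∷ 18 ∷ 18 ∷ [] , 0 ∷ 2 ∷ 5 ∷ 5 ∷ 7 ∷ 8 ∷ 16 ∷ []) ∷
      (3 ∷ 5 ∷ 9 ∷ 10 ∷ 10 ∷ 11 ∷ [] , 4 ∷ 6 ∷ 12 ∷ 15 ∷ 16 ∷ []) ∷
      (1 ∷ 3 ∷ 6 ∷ 6 ∷ 8 ∷ 8 ∷ 9 ∷ 9 ∷ 9 ∷ 10 ∷ 10 ∷ 11 ∷ 13 ∷ 15 ∷ 15 ∷ [] , 2 ∷ 4 ∷ 5 ∷ 5 ∷ 7 ∷ 7 ∷ 7 ∷ 16 ∷ 16 ∷ 17 ∷ 17 ∷ []) ∷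
      (2 ∷ 2 ∷ 4 ∷ 7 ∷ 10 ∷ 14 ∷ 15 ∷ 15 ∷ [] , 0 ∷ 1 ∷ 5 ∷ 5 ∷ 11 ∷ 12 ∷ 17 ∷ []) ∷
      (1 ∷ 4 ∷ 4 ∷ 13 ∷ 14 ∷ 14 ∷ 15 ∷ 18 ∷ [] , 0 ∷ 3 ∷ 5 ∷ 5 ∷ 8 ∷ 9 ∷ 17 ∷ []) ∷
      (2 ∷ 4 ∷ 5 ∷ 7 ∷ 14 ∷ 14 ∷ [] , 0 ∷ 8 ∷ 11 ∷ 15 ∷ 17 ∷ []) ∷
      (2 ∷ 4 ∷ 4 ∷ 6 ∷ 6 ∷ 8 ∷ 9 ∷ 12 ∷ 13 ∷ 13 ∷ 13 ∷ 14 ∷ 14 ∷ 15 ∷ 15 ∷ [] , 1 ∷ 3 ∷ 3 ∷ 5 ∷ 5 ∷ 11 ∷ 11 ∷ 16 ∷ 17 ∷ 17 ∷ 17 ∷ []) ∷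
      (2 ∷ 3 ∷ 5 ∷ 9 ∷ 15 ∷ 15 ∷ [] , 0 ∷ 10 ∷ 12 ∷ 13 ∷ 17 ∷ []) ∷
      (2 ∷ 3 ∷ 6 ∷ 6 ∷ 7 ∷ 7 ∷ 7 ∷ 9 ∷ 11 ∷ 14 ∷ 14 ∷ 15 ∷ 15 ∷ 16 ∷ 16 ∷ [] , 1 ∷ 4 ∷ 5 ∷ 5 ∷ 8 ∷ 8 ∷ 12 ∷ 12 ∷ 13 ∷ 13 ∷ 13 ∷ []) ∷
      (1 ∷ 5 ∷ 11 ∷ 13 ∷ 18 ∷ 18 ∷ [] , 2 ∷ 6 ∷ 8 ∷ 10 ∷ 16 ∷ []) ∷
      (1 ∷ 4 ∷ 6 ∷ 6 ∷ 7 ∷ 10 ∷ 10 ∷ 11 ∷ 11 ∷ 11 ∷ 13 ∷ 17 ∷ 17 ∷ 18 ∷ 18 ∷ [] , 2 ∷ 3 ∷ 5 ∷ 5 ∷ 8 ∷ 8 ∷ 9 ∷ 9 ∷ 9 ∷ 12 ∷ 12 ∷ []) ∷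
      (2 ∷ 5 ∷ 9 ∷ 16 ∷ 18 ∷ 18 ∷ [] , 0 ∷ 4 ∷ 10 ∷ 11 ∷ 13 ∷ []) ∷
      (1 ∷ 5 ∷ 12 ∷ 13 ∷ 15 ∷ 15 ∷ [] , 2 ∷ 3 ∷ 6 ∷ 7 ∷ 10 ∷ []) ∷
      (4 ∷ 5 ∷ 7 ∷ 10 ∷ 10 ∷ 16 ∷ [] , 1 ∷ 3 ∷ 6 ∷ 9 ∷ 18 ∷ []) ∷
      (3 ∷ 5 ∷ 11 ∷ 14 ∷ 14 ∷ 17 ∷ [] , 2 ∷ 4 ∷ 6 ∷ 13 ∷ 15 ∷ []) ∷
      (0 ∷ 6 ∷ 7 ∷ 7 ∷ 10 ∷ 10 ∷ 16 ∷ 17 ∷ [] , 1 ∷ 3 ∷ 5 ∷ 5 ∷ 8 ∷ 9 ∷ 15 ∷ []) ∷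
      (3 ∷ 6 ∷ 6 ∷ 10 ∷ 11 ∷ 14 ∷ 17 ∷ 17 ∷ [] , 4 ∷ 5 ∷ 5 ∷ 9 ∷ 12 ∷ 13 ∷ 15 ∷ []) ∷
      (0 ∷ 6 ∷ 8 ∷ 9 ∷ 9 ∷ 12 ∷ 18 ∷ 18 ∷ [] , 1 ∷ 4 ∷ 5 ∷ 5 ∷ 10 ∷ 11 ∷ 17 ∷ []) ∷
      (1 ∷ 6 ∷ 6 ∷ 12 ∷ 12 ∷ 13 ∷ 15 ∷ 18 ∷ [] , 2 ∷ 5 ∷ 5 ∷ 7 ∷ 10 ∷ 11 ∷ 16 ∷ []) ∷
      (0 ∷ 0 ∷ 2 ∷ 7 ∷ 7 ∷ 8 ∷ 9 ∷ 10 ∷ 10 ∷ 12 ∷ 16 ∷ 16 ∷ 16 ∷ 18 ∷ 18 ∷ [] , 1 ∷ 1 ∷ 1 ∷ 3 ∷ 3 ∷ 5 ∷ 5 ∷ 11 ∷ 11 ∷ 13 ∷ 17 ∷ []) ∷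
      (0 ∷ 0 ∷ 4 ∷ 7 ∷ 10 ∷ 10 ∷ 12 ∷ 12 ∷ 12 ∷ 13 ∷ 13 ∷ 15 ∷ 15 ∷ 16 ∷ 17 ∷ [] , 2 ∷ 2 ∷ 3 ∷ 3 ∷ 3 ∷ 5 ∷ 5 ∷ 8 ∷ 9 ∷ 9 ∷ 11 ∷ []) ∷
      (0 ∷ 0 ∷ 3 ∷ 8 ∷ 8 ∷ 8 ∷ 9 ∷ 9 ∷ 11 ∷ 14 ∷ 14 ∷ 16 ∷ 17 ∷ 18 ∷ 18 ∷ [] , 1 ∷ 1 ∷ 4 ∷ 4 ∷ 4 ∷ 5 ∷ 5 ∷ 7 ∷ 12 ∷ 13 ∷ 13 ∷ []) ∷
      (0 ∷ 0 ∷ 1 ∷ 8 ∷ 11 ∷ 11 ∷ 12 ∷ 13 ∷ 14 ∷ 14 ∷ 15 ∷ 15 ∷ 17 ∷ 17 ∷ 17 ∷ [] , 2 ∷ 2 ∷ 2 ∷ 4 ∷ 4 ∷ 5 ∷ 5 ∷ 7 ∷ 7 ∷ 9 ∷ 16 ∷ []) ∷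
      (5 ∷ [] , []) ∷
      []
  }

theorem2p2 : (k : ℕ) → k ∈ 1 ∷ 2 ∷ 3 ∷ 4 ∷ 5 ∷ 6 ∷ 7 ∷ 10 ∷ 11 ∷ [] →
    Σ[ L ∈ FiniteOMP ]
    ( FiniteOMP.IsHomogeneous L 3 3
    × (∃[ n ] (n ≤ⁿ 19 × HasExactly _≡_ n (FiniteOMP.IsAtom L)))
    × HasExactly _≐_ k (FiniteOMP.IsPureState L) )
theorem2p2 _ (here refl) =
  -- Type checking evaluates `valid?`; once it computes to yes, the remaining argument has the unit
  -- type.
  realisation presentation1 (toWitness {a? = Presented.valid? presentation1} _)
theorem2p2 _ (there (here refl)) =
  realisation presentation2 (toWitness {a? = Presented.valid? presentation2} _)
theorem2p2 _ (there (there (here refl))) =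
  realisation presentation3 (toWitness {a? = Presented.valid? presentation3} _)
theorem2p2 _ (there (there (there (here refl)))) =
  realisation presentation4 (toWitness {a? = Presented.valid? presentation4} _)
theorem2p2 _ (there (there (there (there (here refl))))) =
  realisation presentation5 (toWitness {a? = Presented.valid? presentation5} _)
theorem2p2 _ (there (there (there (there (there (here refl)))))) =
  realisation presentation6 (toWitness {a? = Presented.valid? presentation6} _)
theorem2p2 _ (there (there (there (there (there (there (here refl))))))) =
  realisation presentation7 (toWitness {a? = Presented.valid? presentation7} _)
theorem2p2 _ (there (there (there (there (there (there (there (here refl)))))))) =
  realisation presentation10 (toWitness {a? = Presented.valid? presentation10} _)
theorem2p2 _ (there (there (there (there (there (there (there (there (here refl))))))))) =
  realisation presentation11 (toWitness {a? = Presented.valid? presentation11} _)
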